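{- Let $\mathrm{Peak}^c_{\mathcal N_2(0)}(t)=0$ and, for $n\ge1$, let $\mathrm{Peak}^c_{\mathcal N_2(n)}(t)=\sum t^{\mathrm{peak}(\mathbf a)}$, the sum being over all area sequences $\mathbf a$ of size $n$ with $\mathrm{pnest}(\mathbf a)\le2$ and $\Gamma_{\mathbf a}$ connected. Then $\mathrm{Peak}^c_{\mathcal N_2(1)}(t)=\mathrm{Peak}^c_{\mathcal N_2(2)}(t)=t$, and for $n\ge3$ $$\mathrm{Peak}^c_{\mathcal N_2(n)}(t)=(t+2)\,\mathrm{Peak}^c_{\mathcal N_2(n-1)}(t)-\mathrm{Peak}^c_{\mathcal N_2(n-2)}(t).$$ Moreover, $\mathrm{Peak}^c_{\mathcal N_2(n)}(t)$ is real-rooted for every $n\ge0$ and $\{\mathrm{Peak}^c_{\mathcal N_2(n)}(t)\}_{n\ge0}$ is a generalized Sturm sequence.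
   Context: Write $[n]=\{1,\dots,n\}$. An area sequence of size $n$ is a sequence $\mathbf a=(a_1,\dots,a_n)$ of nonnegative integers with $a_i<i$ for all $i$ and $a_i\le a_{i-1}+1$ for all $i\ge 2$. It defines a graph $\Gamma_{\mathbf a}$ (a unit interval graph) on $[n]$ with edges $\{j,i\}$ for $1\le j<i\le n$ with $i-a_i\le j$. If $\{i,j\}$ with $i<j$ is an edge then $\{i,i+1,\dots,j\}$ is a clique. A peak-edge of $\Gamma_{\mathbf a}$ is either an isolated vertex $i$ (put $j=i$) or an edge $\{i,j\}$, $i<j$, such that neither $\{i,j+1\}$ nor $\{i-1,j\}$ is an edge (pairs not contained in $[n]$ are not edges). The corresponding peak-clique is $\{i,\dots,j\}$. The number of peak-edges is $\mathrm{peak}(\mathbf a)$. The peak-nesting of a vertex is the number of peak-cliques containing it, and $\mathrm{pnest}(\mathbf a)$ is the maximum over all vertices. A real polynomial is real-rooted if all its zeros are real (constants, including $0$, are real-rooted). For real-rooted $f,g$ with positive leading coefficients and zeros (with multiplicity) $\cdots\le\lambda_2\le\lambda_1$ and $\cdots\le\delta_2\le\delta_1$ respectively, write $g\ll f$ if $\cdots\le\delta_2\le\lambda_2\le\delta_1\le\lambda_1$ (so the degrees differ by at most one, $\deg g\le\deg f$); by convention also $0\ll0$, $0\ll f$, $f\ll0$. A sequence $\{f_i\}_{i\ge0}$ of real-rooted polynomials with positive leading coefficients (the zero polynomial being allowed under this convention) is a generalized Sturm sequence if $f_{i-1}\ll f_i$ for all $i\ge1$. -}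

module Defs where

open import Algebra.Bundles using (RawRing)
open import Data.Empty using (⊥-elim)
open import Data.Fin.Base as Fin using (Fin; toℕ; inject₁)
open import Data.Fin.Properties as Fin using (all?; toℕ-inject₁)
import Data.Integer.Base as ℤ
open ℤ using (ℤ)
open import Data.List.Base using (List; []; _∷_; length; filter; cartesianProduct; cartesianProductWith; allFin; upTo; foldr; map)
open import Data.List.Extrema.Nat using (max)
open import Data.List.Relation.Unary.Linked using (Linked)
open import Data.Nat.Base as ℕ using (ℕ; zero; suc; _∸_; _⊔_; z≤n; s≤s)
import Data.Nat.Properties as ℕ
open import Data.Product.Base using (∃-syntax; _×_; _,_; proj₁; proj₂)
open import Data.Rational.Base as ℚ using (ℚ; 0ℚ; 1ℚ)
import Data.Rational.Properties as ℚ
open import Data.Sum.Base as Sum using (_⊎_; inj₁; inj₂)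
open import Data.Vec.Base using (Vec; []; _∷_; lookup)
open import Level using (Level; 0ℓ)
open import Relation.Binary.Construct.Closure.ReflexiveTransitive using (Star; ε; _◅_; _◅◅_; reverse)
open import Relation.Binary.PropositionalEquality
open import Relation.Nullary using (Dec; yes; no; ¬_; ¬?)
open import Relation.Nullary.Decidable using (map′; _×-dec_; _⊎-dec_; _→-dec_)

------------------------------------------------------------------------
-- Univariate polynomials

-- A polynomial is the list of its coefficients, constant term first.  Trailing
-- zeros are allowed, so equality of polynomials is _≈ₚ_, not _≡_.

module Polynomials {c ℓ : Level} (R : RawRing c ℓ) where
  open RawRing R

  Poly : Set c
  Poly = List Carrier

  coeff : Poly → ℕ → Carrier
  coeff []      _       = 0#
  coeff (x ∷ _) zero    = x
  coeff (_ ∷ p) (suc k) = coeff p k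

  infix  4 _≈ₚ_
  infixl 6 _+ₚ_ _-ₚ_
  infixl 7 _*ₚ_ _·ₚ_

  _≈ₚ_ : Poly → Poly → Set ℓ
  p ≈ₚ q = ∀ k → coeff p k ≈ coeff q k

  0ₚ 1ₚ X : Poly
  0ₚ = []
  1ₚ = 1# ∷ []
  X  = 0# ∷ 1# ∷ []

  const : Carrier → Poly
  const x = x ∷ []

  _+ₚ_ : Poly → Poly → Poly
  []      +ₚ q       = q
  (x ∷ p) +ₚ []      = x ∷ p
  (x ∷ p) +ₚ (y ∷ q) = (x + y) ∷ (p +ₚ q)

  _·ₚ_ : Carrier → Poly → Poly
  x ·ₚ p = map (x *_) p

  _-ₚ_ : Poly → Poly → Poly
  p -ₚ q = p +ₚ map (-_) q

  _*ₚ_ : Poly → Poly → Poly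
  []      *ₚ q = []
  (x ∷ p) *ₚ q = (x ·ₚ q) +ₚ (0# ∷ (p *ₚ q))

  X^_ : ℕ → Poly
  X^ zero  = 1ₚ
  X^ suc k = X *ₚ (X^ k)

  ∑ₚ ∏ₚ : List Poly → Poly
  ∑ₚ = foldr _+ₚ_ 0ₚ
  ∏ₚ = foldr _*ₚ_ 1ₚ

------------------------------------------------------------------------
-- Real numbers: Cauchy sequences of rationals, as a setoid

IsCauchy : (ℕ → ℚ) → Set
IsCauchy x = ∀ e → 0ℚ ℚ.< e →
  ∃[ N ] ∀ m n → N ℕ.≤ m → N ℕ.≤ n → ℚ.∣ x m ℚ.- x n ∣ ℚ.< e

record ℝ : Set where
  constructor mkℝ
  field
    seq    : ℕ → ℚ
    cauchy : IsCauchy seq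

open ℝ public

infix 4 _≈ᵣ_ _≤ᵣ_ _≥ᵣ_ _<ᵣ_ _#ᵣ_

record _≈ᵣ_ (x y : ℝ) : Set where
  constructor mk≈
  field
    close : ∀ e → 0ℚ ℚ.< e → ∃[ N ] ∀ n → N ℕ.≤ n → ℚ.∣ seq x n ℚ.- seq y n ∣ ℚ.< e

record _≤ᵣ_ (x y : ℝ) : Set where
  constructor mk≤
  field
    below : ∀ e → 0ℚ ℚ.< e → ∃[ N ] ∀ n → N ℕ.≤ n → seq x n ℚ.≤ seq y n ℚ.+ e

record _<ᵣ_ (x y : ℝ) : Set where
  constructor mk<
  field
    gap       : ℚ
    0<gap     : 0ℚ ℚ.< gap
    separated : ∃[ N ] ∀ n → N ℕ.≤ n → seq x n ℚ.+ gap ℚ.≤ seq y n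

_≥ᵣ_ _#ᵣ_ : ℝ → ℝ → Set
x ≥ᵣ y = y ≤ᵣ x
x #ᵣ y = x <ᵣ y ⊎ y <ᵣ x

half : ∀ {e} → 0ℚ ℚ.< e → ∃[ d ] 0ℚ ℚ.< d × d ℚ.+ d ≡ e
half {e} 0<e = e ℚ.* ℚ.½ , ℚ.positive⁻¹ _ {{ℚ.pos*pos⇒pos e {{ℚ.positive 0<e}} ℚ.½}} ,
  trans (sym (ℚ.*-distribˡ-+ e ℚ.½ ℚ.½)) (ℚ.*-identityʳ e)

+-swap : ∀ a b c d → (a ℚ.+ b) ℚ.- (c ℚ.+ d) ≡ (a ℚ.- c) ℚ.+ (b ℚ.- d)
+-swap a b c d = begin
  (a ℚ.+ b) ℚ.- (c ℚ.+ d)                ≡⟨ cong ((a ℚ.+ b) ℚ.+_) (ℚ.neg-distrib-+ c d) ⟩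
  (a ℚ.+ b) ℚ.+ (ℚ.- c ℚ.+ ℚ.- d)        ≡⟨ ℚ.+-assoc a b _ ⟩
  a ℚ.+ (b ℚ.+ (ℚ.- c ℚ.+ ℚ.- d))        ≡⟨ cong (a ℚ.+_) (sym (ℚ.+-assoc b (ℚ.- c) (ℚ.- d))) ⟩
  a ℚ.+ ((b ℚ.+ ℚ.- c) ℚ.+ ℚ.- d)        ≡⟨ cong (λ z → a ℚ.+ (z ℚ.+ ℚ.- d)) (ℚ.+-comm b (ℚ.- c)) ⟩
  a ℚ.+ ((ℚ.- c ℚ.+ b) ℚ.+ ℚ.- d)        ≡⟨ cong (a ℚ.+_) (ℚ.+-assoc (ℚ.- c) b (ℚ.- d)) ⟩
  a ℚ.+ (ℚ.- c ℚ.+ (b ℚ.+ ℚ.- d))        ≡⟨ sym (ℚ.+-assoc a (ℚ.- c) _) ⟩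
  (a ℚ.- c) ℚ.+ (b ℚ.- d)                ∎
  where open ≡-Reasoning

telescope : ∀ a b c → (a ℚ.- b) ℚ.+ (b ℚ.- c) ≡ a ℚ.- c
telescope a b c = begin
  (a ℚ.- b) ℚ.+ (b ℚ.- c)          ≡⟨ ℚ.+-assoc a (ℚ.- b) _ ⟩
  a ℚ.+ (ℚ.- b ℚ.+ (b ℚ.- c))      ≡⟨ cong (a ℚ.+_) (sym (ℚ.+-assoc (ℚ.- b) b (ℚ.- c))) ⟩
  a ℚ.+ ((ℚ.- b ℚ.+ b) ℚ.- c)      ≡⟨ cong (λ z → a ℚ.+ (z ℚ.- c)) (ℚ.+-inverseˡ b) ⟩
  a ℚ.+ (0ℚ ℚ.- c)                 ≡⟨ cong (a ℚ.+_) (ℚ.+-identityˡ (ℚ.- c)) ⟩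
  a ℚ.- c                          ∎
  where open ≡-Reasoning

*-swap : ∀ a b c d → (a ℚ.* b) ℚ.- (c ℚ.* d) ≡ a ℚ.* (b ℚ.- d) ℚ.+ (a ℚ.- c) ℚ.* d
*-swap a b c d = sym (begin
  a ℚ.* (b ℚ.- d) ℚ.+ (a ℚ.- c) ℚ.* d
    ≡⟨ cong₂ ℚ._+_ (ℚ.*-distribˡ-+ a b (ℚ.- d)) (ℚ.*-distribʳ-+ d a (ℚ.- c)) ⟩
  (a ℚ.* b ℚ.+ a ℚ.* ℚ.- d) ℚ.+ (a ℚ.* d ℚ.+ ℚ.- c ℚ.* d)
    ≡⟨ cong₂ (λ u v → (a ℚ.* b ℚ.+ u) ℚ.+ (a ℚ.* d ℚ.+ v)) (sym (ℚ.neg-distribʳ-* a d)) (sym (ℚ.neg-distribˡ-* c d)) ⟩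
  (a ℚ.* b ℚ.- a ℚ.* d) ℚ.+ (a ℚ.* d ℚ.- c ℚ.* d)
    ≡⟨ telescope (a ℚ.* b) (a ℚ.* d) (c ℚ.* d) ⟩
  a ℚ.* b ℚ.- c ℚ.* d ∎)
  where open ≡-Reasoning

0<1 : 0ℚ ℚ.< 1ℚ
0<1 = ℚ.positive⁻¹ 1ℚ

eventuallyBounded : ∀ x → IsCauchy x →
  ∃[ B ] 0ℚ ℚ.< B × ∃[ N ] ∀ n → N ℕ.≤ n → ℚ.∣ x n ∣ ℚ.≤ B
eventuallyBounded x cx with cx 1ℚ 0<1
... | N , close = B , 0<B , N , bound
  where
  B : ℚ
  B = 1ℚ ℚ.+ ℚ.∣ x N ∣

  0<B : 0ℚ ℚ.< B
  0<B = ℚ.+-mono-<-≤ 0<1 (ℚ.0≤∣p∣ (x N))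

  split : ∀ a b → a ≡ (a ℚ.- b) ℚ.+ b
  split a b = sym (trans (ℚ.+-assoc a (ℚ.- b) b)
    (trans (cong (a ℚ.+_) (ℚ.+-inverseˡ b)) (ℚ.+-identityʳ a)))

  bound : ∀ n → N ℕ.≤ n → ℚ.∣ x n ∣ ℚ.≤ B
  bound n N≤n = begin
    ℚ.∣ x n ∣                              ≡⟨ cong ℚ.∣_∣ (split (x n) (x N)) ⟩
    ℚ.∣ (x n ℚ.- x N) ℚ.+ x N ∣            ≤⟨ ℚ.∣p+q∣≤∣p∣+∣q∣ (x n ℚ.- x N) (x N) ⟩
    ℚ.∣ x n ℚ.- x N ∣ ℚ.+ ℚ.∣ x N ∣        ≤⟨ ℚ.+-monoˡ-≤ ℚ.∣ x N ∣ (ℚ.<⇒≤ (close n N N≤n ℕ.≤-refl)) ⟩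
    B                                      ∎
    where open ℚ.≤-Reasoning

const-cauchy : ∀ q → IsCauchy (λ _ → q)
const-cauchy q e 0<e = 0 , λ _ _ _ _ →
  subst (ℚ._< e) (sym (cong ℚ.∣_∣ (ℚ.+-inverseʳ q))) 0<e

+-cauchy : ∀ x y → IsCauchy x → IsCauchy y → IsCauchy (λ n → x n ℚ.+ y n)
+-cauchy x y cx cy e 0<e with half 0<e
... | d , 0<d , d+d≡e with cx d 0<d | cy d 0<d
... | M , close₁ | N , close₂ = M ⊔ N , λ m n p q → begin-strict
  ℚ.∣ (x m ℚ.+ y m) ℚ.- (x n ℚ.+ y n) ∣            ≡⟨ cong ℚ.∣_∣ (+-swap (x m) (y m) (x n) (y n)) ⟩
  ℚ.∣ (x m ℚ.- x n) ℚ.+ (y m ℚ.- y n) ∣            ≤⟨ ℚ.∣p+q∣≤∣p∣+∣q∣ (x m ℚ.- x n) (y m ℚ.- y n) ⟩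
  ℚ.∣ x m ℚ.- x n ∣ ℚ.+ ℚ.∣ y m ℚ.- y n ∣          <⟨ ℚ.+-mono-<
                                                        (close₁ m n (ℕ.m⊔n≤o⇒m≤o M N p) (ℕ.m⊔n≤o⇒m≤o M N q))
                                                        (close₂ m n (ℕ.m⊔n≤o⇒n≤o M N p) (ℕ.m⊔n≤o⇒n≤o M N q)) ⟩
  d ℚ.+ d                                          ≡⟨ d+d≡e ⟩
  e                                                ∎
  where open ℚ.≤-Reasoning

neg-cauchy : ∀ x → IsCauchy x → IsCauchy (λ n → ℚ.- x n)
neg-cauchy x cx e 0<e with cx e 0<e
... | N , close = N , λ m n p q → subst (ℚ._< e) (eq (x m) (x n)) (close m n p q)
  where
  eq : ∀ a b → ℚ.∣ a ℚ.- b ∣ ≡ ℚ.∣ ℚ.- a ℚ.- (ℚ.- b) ∣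
  eq a b = trans (sym (ℚ.∣-p∣≡∣p∣ (a ℚ.- b))) (cong ℚ.∣_∣ (ℚ.neg-distrib-+ a (ℚ.- b)))

*-cauchy : ∀ x y → IsCauchy x → IsCauchy y → IsCauchy (λ n → x n ℚ.* y n)
*-cauchy x y cx cy e 0<e with eventuallyBounded x cx | eventuallyBounded y cy
... | A , 0<A , K , boundˣ | B , 0<B , L , boundʸ = go (cx d 0<d) (cy d 0<d)
  where
  S : ℚ
  S = A ℚ.+ B

  0<S : 0ℚ ℚ.< S
  0<S = ℚ.+-mono-< 0<A 0<B

  instance
    S-pos : ℚ.Positive S
    S-pos = ℚ.positive 0<S

    S-nonZero : ℚ.NonZero S
    S-nonZero = ℚ.pos⇒nonZero S

    e-pos : ℚ.Positive e
    e-pos = ℚ.positive 0<e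

  d : ℚ
  d = (ℚ.1/ S) ℚ.* e

  d-pos : ℚ.Positive d
  d-pos = ℚ.pos*pos⇒pos (ℚ.1/ S) {{ℚ.1/pos⇒pos S}} e

  0<d : 0ℚ ℚ.< d
  0<d = ℚ.positive⁻¹ d {{d-pos}}

  *-mono : ∀ {p q r s} → 0ℚ ℚ.≤ q → 0ℚ ℚ.< r → p ℚ.≤ r → q ℚ.≤ s → p ℚ.* q ℚ.≤ r ℚ.* s
  *-mono {p} {q} {r} {s} 0≤q 0<r p≤r q≤s = ℚ.≤-trans
    (ℚ.*-monoʳ-≤-nonNeg q {{ℚ.nonNegative 0≤q}} p≤r)
    (ℚ.*-monoˡ-≤-nonNeg r {{ℚ.nonNegative (ℚ.<⇒≤ 0<r)}} q≤s)

  Close : (ℕ → ℚ) → Set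
  Close z = ∃[ N ] ∀ m n → N ℕ.≤ m → N ℕ.≤ n → ℚ.∣ z m ℚ.- z n ∣ ℚ.< d

  go : Close x → Close y →
       ∃[ N ] ∀ m n → N ℕ.≤ m → N ℕ.≤ n → ℚ.∣ x m ℚ.* y m ℚ.- x n ℚ.* y n ∣ ℚ.< e
  go (M , close₁) (N , close₂) = (K ⊔ L) ⊔ (M ⊔ N) , λ m n p q →
    let p₁ = ℕ.m⊔n≤o⇒m≤o (K ⊔ L) (M ⊔ N) p ; p₂ = ℕ.m⊔n≤o⇒n≤o (K ⊔ L) (M ⊔ N) p
        q₁ = ℕ.m⊔n≤o⇒m≤o (K ⊔ L) (M ⊔ N) q ; q₂ = ℕ.m⊔n≤o⇒n≤o (K ⊔ L) (M ⊔ N) q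
        dx = ℚ.∣ x m ℚ.- x n ∣ ; dy = ℚ.∣ y m ℚ.- y n ∣
    in begin-strict
    ℚ.∣ x m ℚ.* y m ℚ.- x n ℚ.* y n ∣
      ≡⟨ cong ℚ.∣_∣ (*-swap (x m) (y m) (x n) (y n)) ⟩
    ℚ.∣ x m ℚ.* (y m ℚ.- y n) ℚ.+ (x m ℚ.- x n) ℚ.* y n ∣
      ≤⟨ ℚ.∣p+q∣≤∣p∣+∣q∣ (x m ℚ.* (y m ℚ.- y n)) ((x m ℚ.- x n) ℚ.* y n) ⟩
    ℚ.∣ x m ℚ.* (y m ℚ.- y n) ∣ ℚ.+ ℚ.∣ (x m ℚ.- x n) ℚ.* y n ∣
      ≡⟨ cong₂ ℚ._+_ (ℚ.∣p*q∣≡∣p∣*∣q∣ (x m) (y m ℚ.- y n))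
                     (trans (ℚ.∣p*q∣≡∣p∣*∣q∣ (x m ℚ.- x n) (y n)) (ℚ.*-comm dx ℚ.∣ y n ∣)) ⟩
    ℚ.∣ x m ∣ ℚ.* dy ℚ.+ ℚ.∣ y n ∣ ℚ.* dx
      ≤⟨ ℚ.+-mono-≤
           (ℚ.*-monoʳ-≤-nonNeg dy {{ℚ.∣-∣-nonNeg (y m ℚ.- y n)}} (boundˣ m (ℕ.m⊔n≤o⇒m≤o K L p₁)))
           (*-mono (ℚ.0≤∣p∣ (x m ℚ.- x n)) 0<B (boundʸ n (ℕ.m⊔n≤o⇒n≤o K L q₁))
             (ℚ.<⇒≤ (close₁ m n (ℕ.m⊔n≤o⇒m≤o M N p₂) (ℕ.m⊔n≤o⇒m≤o M N q₂)))) ⟩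
    A ℚ.* dy ℚ.+ B ℚ.* d
      <⟨ ℚ.+-monoˡ-< (B ℚ.* d) (ℚ.*-monoʳ-<-pos A {{ℚ.positive 0<A}}
           (close₂ m n (ℕ.m⊔n≤o⇒n≤o M N p₂) (ℕ.m⊔n≤o⇒n≤o M N q₂))) ⟩
    A ℚ.* d ℚ.+ B ℚ.* d
      ≡⟨ sym (ℚ.*-distribʳ-+ d A B) ⟩
    S ℚ.* ((ℚ.1/ S) ℚ.* e)
      ≡⟨ sym (ℚ.*-assoc S (ℚ.1/ S) e) ⟩
    (S ℚ.* (ℚ.1/ S)) ℚ.* e
      ≡⟨ cong (ℚ._* e) (ℚ.*-inverseʳ S) ⟩
    1ℚ ℚ.* e
      ≡⟨ ℚ.*-identityˡ e ⟩
    e ∎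
    where open ℚ.≤-Reasoning

infixl 6 _+ᵣ_
infixl 7 _*ᵣ_
infix  8 -ᵣ_

fromℚ : ℚ → ℝ
fromℚ q = mkℝ (λ _ → q) (const-cauchy q)

fromℤ : ℤ → ℝ
fromℤ i = fromℚ (i ℚ./ 1)

0ᵣ 1ᵣ : ℝ
0ᵣ = fromℚ 0ℚ
1ᵣ = fromℚ 1ℚ

_+ᵣ_ _*ᵣ_ : ℝ → ℝ → ℝ
x +ᵣ y = mkℝ (λ n → seq x n ℚ.+ seq y n) (+-cauchy (seq x) (seq y) (cauchy x) (cauchy y))
x *ᵣ y = mkℝ (λ n → seq x n ℚ.* seq y n) (*-cauchy (seq x) (seq y) (cauchy x) (cauchy y))

-ᵣ_ : ℝ → ℝ
-ᵣ x = mkℝ (λ n → ℚ.- seq x n) (neg-cauchy (seq x) (cauchy x))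

ℝ-rawRing : RawRing 0ℓ 0ℓ
ℝ-rawRing = record
  { Carrier = ℝ ; _≈_ = _≈ᵣ_ ; _+_ = _+ᵣ_ ; _*_ = _*ᵣ_ ; -_ = -ᵣ_ ; 0# = 0ᵣ ; 1# = 1ᵣ }

------------------------------------------------------------------------
-- Complex numbers

record ℂ : Set where
  constructor _+i_
  field
    re im : ℝ

open ℂ public

infix 4 _≈ᶜ_
infixl 6 _+ᶜ_
infixl 7 _*ᶜ_

_≈ᶜ_ : ℂ → ℂ → Set
w ≈ᶜ z = re w ≈ᵣ re z × im w ≈ᵣ im z

fromℝ : ℝ → ℂ
fromℝ x = x +i 0ᵣ

_+ᶜ_ _*ᶜ_ : ℂ → ℂ → ℂ
w +ᶜ z = (re w +ᵣ re z) +i (im w +ᵣ im z)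
w *ᶜ z = (re w *ᵣ re z +ᵣ -ᵣ (im w *ᵣ im z)) +i (re w *ᵣ im z +ᵣ im w *ᵣ re z)

------------------------------------------------------------------------
-- Real-rooted polynomials, interlacing, generalized Sturm sequences

module ℤ[t] = Polynomials ℤ.+-*-rawRing
module ℝ[t] = Polynomials ℝ-rawRing

toℝ[t] : ℤ[t].Poly → ℝ[t].Poly
toℝ[t] = map fromℤ

evalᶜ : ℝ[t].Poly → ℂ → ℂ
evalᶜ []      z = fromℝ 0ᵣ
evalᶜ (x ∷ f) z = fromℝ x +ᶜ z *ᶜ evalᶜ f z

IsConstant : ℝ[t].Poly → Set
IsConstant f = ∀ k → ℝ[t].coeff f (suc k) ≈ᵣ 0ᵣ

-- The first disjunct only matters for the zero polynomial.
RealRooted : ℝ[t].Poly → Set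
RealRooted f = IsConstant f ⊎ (∀ z → evalᶜ f z ≈ᶜ fromℝ 0ᵣ → im z ≈ᵣ 0ᵣ)

PositiveLeadingCoefficient : ℝ[t].Poly → Set
PositiveLeadingCoefficient f =
  ∃[ d ] 0ᵣ <ᵣ ℝ[t].coeff f d × (∀ k → d ℕ.< k → ℝ[t].coeff f k ≈ᵣ 0ᵣ)

-- f is nonzero, and zs lists its zeros with multiplicity in decreasing order.
HasZeros : ℝ[t].Poly → List ℝ → Set
HasZeros f zs = Linked _≥ᵣ_ zs ×
  (∃[ c ] c #ᵣ 0ᵣ × f ℝ[t].≈ₚ c ℝ[t].·ₚ ℝ[t].∏ₚ (map (λ z → ℝ[t].X ℝ[t].-ₚ ℝ[t].const z) zs))

alternate : {A : Set} → List A → List A → List A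
alternate []       ys = ys
alternate (x ∷ xs) ys = x ∷ alternate ys xs

-- For zs = λ₁ ≥ λ₂ ≥ … and ws = δ₁ ≥ δ₂ ≥ …, this is the chain λ₁ ≥ δ₁ ≥ λ₂ ≥ δ₂ ≥ ….
-- The length conditions ensure that no two consecutive terms come from the same list.
Interlaces : List ℝ → List ℝ → Set
Interlaces ws zs =
  length ws ℕ.≤ length zs × length zs ℕ.≤ suc (length ws) × Linked _≥ᵣ_ (alternate zs ws)

-- Only used between real-rooted polynomials that are zero or have positive
-- leading coefficient; see IsGeneralizedSturm.
infix 4 _≪_
_≪_ : ℝ[t].Poly → ℝ[t].Poly → Set
g ≪ f = g ℝ[t].≈ₚ ℝ[t].0ₚ ⊎ f ℝ[t].≈ₚ ℝ[t].0ₚ ⊎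
  (∃[ ws ] ∃[ zs ] HasZeros g ws × HasZeros f zs × Interlaces ws zs)

IsGeneralizedSturm : (ℕ → ℝ[t].Poly) → Set
IsGeneralizedSturm f =
  (∀ i → RealRooted (f i) × (f i ℝ[t].≈ₚ ℝ[t].0ₚ ⊎ PositiveLeadingCoefficient (f i))) ×
  (∀ i → f i ≪ f (suc i))

------------------------------------------------------------------------
-- Area sequences and their unit interval graphs

-- Vertices and indices are elements of Fin n; label gives the corresponding
-- element of {1,…,n}.
label : ∀ {n} → Fin n → ℕ
label i = suc (toℕ i)

module _ {n : ℕ} (a : Vec ℕ n) where

  IsAreaSequence : Set
  IsAreaSequence =
    (∀ i → lookup a i ℕ.< label i) ×
    (∀ i j → label i ≡ suc (label j) → lookup a i ℕ.≤ suc (lookup a j))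

  Adj< : Fin n → Fin n → Set
  Adj< j i = label j ℕ.< label i × label i ∸ lookup a i ℕ.≤ label j

  Adj : Fin n → Fin n → Set
  Adj i j = Adj< i j ⊎ Adj< j i

  Connected : Set
  Connected = ∀ i j → Star Adj i j

  Isolated : Fin n → Set
  Isolated i = ∀ j → ¬ Adj i j

  -- The pair (i , i) stands for the isolated vertex i.
  PeakEdge : Fin n × Fin n → Set
  PeakEdge (i , j) =
    (i ≡ j × Isolated i) ⊎
    (Adj< i j ×
     (∀ k → label k ≡ suc (label j) → ¬ Adj i k) ×
     (∀ k → suc (label k) ≡ label i → ¬ Adj k j))

  InPeakClique : Fin n → Fin n × Fin n → Set
  InPeakClique v (i , j) = label i ℕ.≤ label v × label v ℕ.≤ label j

  isAreaSequence? : Dec IsAreaSequence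
  isAreaSequence? =
    all? (λ i → lookup a i ℕ.<? label i) ×-dec
    all? (λ i → all? λ j → (label i ℕ.≟ suc (label j)) →-dec (lookup a i ℕ.≤? suc (lookup a j)))

  adj<? : ∀ j i → Dec (Adj< j i)
  adj<? j i = (label j ℕ.<? label i) ×-dec (label i ∸ lookup a i ℕ.≤? label j)

  adj? : ∀ i j → Dec (Adj i j)
  adj? i j = adj<? i j ⊎-dec adj<? j i

  peakEdge? : ∀ e → Dec (PeakEdge e)
  peakEdge? (i , j) =
    ((i Fin.≟ j) ×-dec all? (λ k → ¬? (adj? i k))) ⊎-dec
    (adj<? i j ×-dec
     (all? (λ k → (label k ℕ.≟ suc (label j)) →-dec ¬? (adj? i k)) ×-dec
      all? (λ k → (suc (label k) ℕ.≟ label i) →-dec ¬? (adj? k j))))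

  inPeakClique? : ∀ v e → Dec (InPeakClique v e)
  inPeakClique? v (i , j) = (label i ℕ.≤? label v) ×-dec (label v ℕ.≤? label j)

  peakEdges : List (Fin n × Fin n)
  peakEdges = filter peakEdge? (cartesianProduct (allFin n) (allFin n))

  peak : ℕ
  peak = length peakEdges

  peakNesting : Fin n → ℕ
  peakNesting v = length (filter (inPeakClique? v) peakEdges)

  pnest : ℕ
  pnest = max 0 (map peakNesting (allFin n))

-- For an area sequence, Γ is connected iff aᵢ ≠ 0 for all i ≥ 2: if aᵢ = 0 then no
-- edge joins {1,…,i-1} to {i,…,n}.  This is used only to decide connectedness.
NoCut : ∀ {n} → Vec ℕ n → Set
NoCut a = ∀ i → 1 ℕ.< label i → ¬ lookup a i ≡ 0

noCut? : ∀ {n} (a : Vec ℕ n) → Dec (NoCut a)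
noCut? a = all? λ i → (1 ℕ.<? label i) →-dec ¬? (lookup a i ℕ.≟ 0)

noCut⇒connected : ∀ {n} (a : Vec ℕ n) → NoCut a → Connected a
noCut⇒connected {zero}  a nc ()
noCut⇒connected {suc n} a nc i j =
  reverse Sum.swap (path (toℕ i) i refl) ◅◅ path (toℕ j) j refl
  where
  path : ∀ d (k : Fin (suc n)) → toℕ k ≡ d → Star (Adj a) Fin.zero k
  path _       Fin.zero    _  = ε
  path (suc d) (Fin.suc k) eq =
    path d (inject₁ k) (trans (toℕ-inject₁ k) (ℕ.suc-injective eq)) ◅◅ (inj₁ edge ◅ ε)
    where
    edge : Adj< a (inject₁ k) (Fin.suc k)
    edge rewrite toℕ-inject₁ k with lookup a (Fin.suc k) | nc (Fin.suc k) (s≤s (s≤s z≤n))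
    ... | zero  | nz = ⊥-elim (nz refl)
    ... | suc m | _  = ℕ.≤-refl , ℕ.m∸n≤m (suc (toℕ k)) m

growth : ∀ {n} (a : Vec ℕ n) → IsAreaSequence a → ∀ i → lookup a i ≡ 0 →
         ∀ d k → toℕ k ≡ d ℕ.+ toℕ i → lookup a k ℕ.≤ d
growth a ar i a0 zero k eq =
  subst (λ z → lookup a z ℕ.≤ 0) (Fin.toℕ-injective (sym eq)) (ℕ.≤-reflexive a0)
growth a ar i a0 (suc d) (Fin.suc k) eq = ℕ.≤-trans
  (proj₂ ar (Fin.suc k) (inject₁ k) (cong (λ z → suc (suc z)) (sym (toℕ-inject₁ k))))
  (s≤s (growth a ar i a0 d (inject₁ k) (trans (toℕ-inject₁ k) (ℕ.suc-injective eq))))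

noCrossing : ∀ {n} (a : Vec ℕ n) → IsAreaSequence a → ∀ i → lookup a i ≡ 0 →
             ∀ j k → label j ℕ.< label i → label i ℕ.≤ label k → ¬ Adj< a j k
noCrossing a ar i a0 j k j<i (s≤s i≤k) (_ , k∸a≤j) = ℕ.<⇒≱ j<i (begin
  label i                               ≡⟨ ℕ.m∸[m∸n]≡n (s≤s i≤k) ⟨
  label k ∸ (label k ∸ label i)         ≤⟨ ℕ.∸-monoʳ-≤ (label k) (growth a ar i a0 _ k (sym (ℕ.m∸n+n≡m i≤k))) ⟩
  label k ∸ lookup a k                  ≤⟨ k∸a≤j ⟩
  label j                               ∎)
  where open ℕ.≤-Reasoning

staysBelow : ∀ {n} (a : Vec ℕ n) → IsAreaSequence a → ∀ i → lookup a i ≡ 0 →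
             ∀ {j k} → Star (Adj a) j k → label j ℕ.< label i → label k ℕ.< label i
staysBelow a ar i a0 ε              j<i = j<i
staysBelow a ar i a0 {j} (_◅_ {j = m} e p) j<i = staysBelow a ar i a0 p (step e)
  where
  step : Adj a j m → label m ℕ.< label i
  step (inj₂ (m<j , _)) = ℕ.<-trans m<j j<i
  step (inj₁ e<) with label m ℕ.<? label i
  ... | yes m<i = m<i
  ... | no  m≮i = ⊥-elim (noCrossing a ar i a0 j m j<i (ℕ.≮⇒≥ m≮i) e<)

connected⇒noCut : ∀ {n} (a : Vec ℕ n) → IsAreaSequence a → Connected a → NoCut a
connected⇒noCut {suc n} a ar con i 1<i a0 =
  ℕ.<-irrefl refl (staysBelow a ar i a0 (con Fin.zero i) 1<i)

connected? : ∀ {n} (a : Vec ℕ n) → IsAreaSequence a → Dec (Connected a)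
connected? a ar = map′ (noCut⇒connected a) (connected⇒noCut a ar) (noCut? a)

------------------------------------------------------------------------
-- The polynomials Peakᶜ

InN₂ᶜ : ∀ {n} → Vec ℕ n → Set
InN₂ᶜ a = IsAreaSequence a × pnest a ℕ.≤ 2 × Connected a

inN₂ᶜ? : ∀ {n} (a : Vec ℕ n) → Dec (InN₂ᶜ a)
inN₂ᶜ? a with isAreaSequence? a
... | no ¬ar = no λ p → ¬ar (proj₁ p)
... | yes ar = map′ (ar ,_) proj₂ ((pnest a ℕ.≤? 2) ×-dec connected? a ar)

-- All vectors of length n with entries less than m, each once.
vectors : ℕ → ∀ n → List (Vec ℕ n)
vectors m zero    = [] ∷ []
vectors m (suc n) = cartesianProductWith _∷_ (upTo m) (vectors m n)

-- The entries of an area sequence of size n are less than n.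
N₂ᶜ : ∀ n → List (Vec ℕ n)
N₂ᶜ n = filter inN₂ᶜ? (vectors n n)

Peakᶜ : ℕ → ℤ[t].Poly
Peakᶜ zero      = ℤ[t].0ₚ
Peakᶜ n@(suc _) = ℤ[t].∑ₚ (map (λ a → ℤ[t].X^ (peak a)) (N₂ᶜ n))

{-# OPTIONS --safe #-}

-- Read from the left, a connected area sequence with peak-nesting at most 2 is determined by where
-- its peak-cliques begin and end, and nesting at most 2 means that each clique begins after the
-- last but one has ended.  So the number of admissible continuations depends only on the distance
-- d back to the right end of the last complete clique: the generating function F(s, d) for the s
-- remaining entries satisfies F(0, d) = t and F(s + 1, d) = F(s, d + 1) + d t F(s, 1).  Hence it is
-- affine in d, and eliminating the slope gives the three-term recurrence for F(s, 0).
--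
-- For n ≥ 2 the polynomials are t Q(n - 2) with Q(0) = 1, Q(1) = t + 1 and
-- Q(m + 2) = (t + 2) Q(m + 1) - Q(m).  At a zero of Q(m + 1) the values of Q(m + 2) and Q(m) are
-- opposite, and Q(m)(0) = 1, Q(m)(-4) = (-1)ᵐ (2m + 1); so if the zeros of Q(m + 1) and Q(m)
-- interlace strictly in (-4, 0), then Q(m + 2) changes sign between consecutive points among 0, the
-- zeros of Q(m + 1), and -4.  Constructively, the zeros are found by bisection with rational
-- endpoints, where the sign of an integer polynomial is decidable, and the strict signs at real
-- points come from the factorization of Q(m) into linear factors.

module Submission where

-- With `t + 2 = 2 x`, Q(m) is `U_m(x) - U_(m-1)(x)` for the Chebyshev polynomials U of the second
-- kind, and 0 and -4 are the points x = 1 and x = -1. The zeros are thus given by cosines, but the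
-- values at the two endpoints and the recurrence already locate them, so no trigonometric function
-- is constructed.
--
-- The obstacle on the analytic side is that order and equality of Cauchy reals are undecidable. A
-- sign at a real zero cannot be computed; it is derived as a strict inequality from the place of
-- that zero in a chain. Likewise, a vanishing product does not reveal which factor vanishes, so
-- real-rootedness comes from an estimate: if f is a product of k factors z - r with real r, then
-- `(im z)^(2k) ≤ |f(z)|²`.
--
-- On the combinatorial side the next entry depends on the current height p as well as on d. The
-- height drops out of the count because a rise admits the single entry p + 1, a completed clique
-- admits the d entries 1, ..., d, and the invariant d ≤ p keeps the two cases disjoint.

-- Cauchy reals: ring laws, order and cancellation.

module RealNumbers where

  open import Algebra.Structures using (IsCommutativeRing)
  open import Data.Integer.Base as ℤ using (ℤ; +_; -[1+_])
  import Data.Integer.Properties as ℤ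
  open import Data.Nat.Base as ℕ using (ℕ; zero; suc; _⊔_; s≤s)
  import Data.Nat.Properties as ℕ
  open import Data.Nat.Solver using () renaming (module +-*-Solver to ℕ-Solver)
  open import Data.Product.Base using (∃-syntax; _×_; _,_; proj₁; proj₂)
  open import Data.Rational.Base as ℚ using (ℚ; 0ℚ; 1ℚ; mkℚ; toℚᵘ; fromℚᵘ)
  import Data.Rational.Properties as ℚ
  open import Data.Rational.Solver using (module +-*-Solver)
  open import Data.Rational.Unnormalised.Base as ℚᵘ using (mkℚᵘ)
  import Data.Rational.Unnormalised.Properties as ℚᵘ
  open import Data.Sum.Base using (inj₁; inj₂)
  open import Defs
  open import Relation.Binary.PropositionalEquality
  open import Relation.Nullary using (yes; no)

  Eventually : (ℕ → Set) → Set
  Eventually P = ∃[ N ] ∀ n → N ℕ.≤ n → P n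

  always : ∀ {P : ℕ → Set} → (∀ n → P n) → Eventually P
  always p = 0 , λ n _ → p n

  eventually-map : ∀ {P Q : ℕ → Set} → (∀ n → P n → Q n) → Eventually P → Eventually Q
  eventually-map f (N , p) = N , λ n N≤n → f n (p n N≤n)

  eventually-zip : ∀ {P Q R : ℕ → Set} → (∀ n → P n → Q n → R n) →
                   Eventually P → Eventually Q → Eventually R
  eventually-zip f (M , p) (N , q) = M ⊔ N , λ n l →
    f n (p n (ℕ.m⊔n≤o⇒m≤o M N l)) (q n (ℕ.m⊔n≤o⇒n≤o M N l))

  eventually⇒∃ : ∀ {P : ℕ → Set} → Eventually P → ∃[ n ] P n
  eventually⇒∃ (N , p) = N , p N ℕ.≤-refl

  -- Equality of reals says that the difference is null. Compatibility of the operations with `≈ᵣ`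
  -- thus reduces to null sequences being closed under sums and under multiplication by bounded
  -- sequences.
  Null : (ℕ → ℚ) → Set
  Null x = ∀ e → 0ℚ ℚ.< e → Eventually (λ n → ℚ.∣ x n ∣ ℚ.< e)

  null-resp : ∀ {x y} → (∀ n → x n ≡ y n) → Null x → Null y
  null-resp eq nx e 0<e = eventually-map (λ n → subst (λ z → ℚ.∣ z ∣ ℚ.< e) (eq n)) (nx e 0<e)

  null-0 : Null (λ _ → 0ℚ)
  null-0 e 0<e = always λ _ → 0<e

  null-+ : ∀ {x y} → Null x → Null y → Null (λ n → x n ℚ.+ y n)
  null-+ {x} {y} nx ny e 0<e with half 0<e
  ... | d , 0<d , refl = eventually-zip
    (λ n p q → ℚ.≤-<-trans (ℚ.∣p+q∣≤∣p∣+∣q∣ (x n) (y n)) (ℚ.+-mono-< p q))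
    (nx d 0<d) (ny d 0<d)

  null-neg : ∀ {x} → Null x → Null (λ n → ℚ.- x n)
  null-neg {x} nx e 0<e = eventually-map (λ n → subst (ℚ._< e) (sym (ℚ.∣-p∣≡∣p∣ (x n)))) (nx e 0<e)

  divide : ∀ {g e} → 0ℚ ℚ.< g → 0ℚ ℚ.< e → ∃[ d ] 0ℚ ℚ.< d × g ℚ.* d ≡ e
  divide {g} {e} 0<g 0<e = (ℚ.1/ g) ℚ.* e
    , ℚ.positive⁻¹ _ {{ℚ.pos*pos⇒pos (ℚ.1/ g) {{ℚ.1/pos⇒pos g}} e}}
    , trans (sym (ℚ.*-assoc g (ℚ.1/ g) e)) (trans (cong (ℚ._* e) (ℚ.*-inverseʳ g)) (ℚ.*-identityˡ e))
    where
    instance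
      g-pos : ℚ.Positive g
      g-pos = ℚ.positive 0<g
      g-nonZero : ℚ.NonZero g
      g-nonZero = ℚ.pos⇒nonZero g
      e-pos : ℚ.Positive e
      e-pos = ℚ.positive 0<e

  null-bounded* : ∀ (b x : ℕ → ℚ) {B} → 0ℚ ℚ.< B → Eventually (λ n → ℚ.∣ b n ∣ ℚ.≤ B) → Null x →
                  Null (λ n → b n ℚ.* x n)
  null-bounded* b x {B} 0<B bounded nx e 0<e with divide 0<B 0<e
  ... | d , 0<d , refl = eventually-zip step bounded (nx d 0<d)
    where
    step : ∀ n → ℚ.∣ b n ∣ ℚ.≤ B → ℚ.∣ x n ∣ ℚ.< d → ℚ.∣ b n ℚ.* x n ∣ ℚ.< B ℚ.* d
    step n p q = begin-strict
      ℚ.∣ b n ℚ.* x n ∣          ≡⟨ ℚ.∣p*q∣≡∣p∣*∣q∣ (b n) (x n) ⟩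
      ℚ.∣ b n ∣ ℚ.* ℚ.∣ x n ∣    ≤⟨ ℚ.*-monoʳ-≤-nonNeg ℚ.∣ x n ∣ {{ℚ.∣-∣-nonNeg (x n)}} p ⟩
      B ℚ.* ℚ.∣ x n ∣            <⟨ ℚ.*-monoʳ-<-pos B {{ℚ.positive 0<B}} q ⟩
      B ℚ.* d                    ∎
      where open ℚ.≤-Reasoning

  null-seq* : ∀ x {y} → Null y → Null (λ n → seq x n ℚ.* y n)
  null-seq* x {y} ny with eventuallyBounded (seq x) (cauchy x)
  ... | B , 0<B , bounded = null-bounded* (seq x) y 0<B bounded ny

  ≈⇒null : ∀ {x y} → x ≈ᵣ y → Null (λ n → seq x n ℚ.- seq y n)
  ≈⇒null (mk≈ c) = c

  null⇒≈ : ∀ {x y} → Null (λ n → seq x n ℚ.- seq y n) → x ≈ᵣ y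
  null⇒≈ = mk≈

  pointwise : ∀ {x y} → (∀ n → seq x n ≡ seq y n) → x ≈ᵣ y
  pointwise {x} {y} eq = null⇒≈ (null-resp (λ n → sym (trans (cong (ℚ._- seq y n) (eq n)) (ℚ.+-inverseʳ
      (seq y n)))) null-0)

  ≈-refl : ∀ {x} → x ≈ᵣ x
  ≈-refl = pointwise λ _ → refl

  ≈-sym : ∀ {x y} → x ≈ᵣ y → y ≈ᵣ x
  ≈-sym {x} {y} p = null⇒≈ (null-resp (λ n → solve 2 (λ a b → :- (a :- b)
      := b :- a) refl (seq x n) (seq y n)) (null-neg (≈⇒null p)))
    where open +-*-Solver

  ≈-trans : ∀ {x y z} → x ≈ᵣ y → y ≈ᵣ z → x ≈ᵣ z
  ≈-trans {x} {y} {z} p q = null⇒≈ (null-resp (λ n → telescope (seq x n) (seq y n) (seq z n)) (null-+ (≈⇒null p)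
      (≈⇒null q)))

  +ᵣ-cong : ∀ {x y u v} → x ≈ᵣ y → u ≈ᵣ v → x +ᵣ u ≈ᵣ y +ᵣ v
  +ᵣ-cong {x} {y} {u} {v} p q = null⇒≈ (null-resp
    (λ n → sym (+-swap (seq x n) (seq u n) (seq y n) (seq v n)))
    (null-+ (≈⇒null p) (≈⇒null q)))

  -ᵣ-cong : ∀ {x y} → x ≈ᵣ y → -ᵣ x ≈ᵣ -ᵣ y
  -ᵣ-cong {x} {y} p = null⇒≈ (null-resp (λ n → ℚ.neg-distrib-+ (seq x n) (ℚ.- seq y n)) (null-neg (≈⇒null p)))

  *ᵣ-cong : ∀ {x y u v} → x ≈ᵣ y → u ≈ᵣ v → x *ᵣ u ≈ᵣ y *ᵣ v
  *ᵣ-cong {x} {y} {u} {v} p q = null⇒≈ (null-resp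
    (λ n → trans (cong (seq x n ℚ.* (seq u n ℚ.- seq v n) ℚ.+_) (ℚ.*-comm (seq v n) _))
                 (sym (*-swap (seq x n) (seq u n) (seq y n) (seq v n))))
    (null-+ (null-seq* x (≈⇒null q)) (null-seq* v (≈⇒null p))))

  ℝ-isCommutativeRing : IsCommutativeRing _≈ᵣ_ _+ᵣ_ _*ᵣ_ -ᵣ_ 0ᵣ 1ᵣ
  ℝ-isCommutativeRing = record
      { isRing = record
        { +-isAbelianGroup = record
          { isGroup = record
            { isMonoid = record
              { isSemigroup = record
                { isMagma = record
                  { isEquivalence = record { refl = ≈-refl ; sym = ≈-sym ; trans = ≈-trans }
                  ; ∙-cong = +ᵣ-cong }
                ; assoc = λ x y z → pointwise λ n → ℚ.+-assoc (seq x n) (seq y n) (seq z n) }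
              ; identity = (λ x → pointwise λ n → ℚ.+-identityˡ (seq x n))
                         , (λ x → pointwise λ n → ℚ.+-identityʳ (seq x n)) }
            ; inverse = (λ x → pointwise λ n → ℚ.+-inverseˡ (seq x n))
                      , (λ x → pointwise λ n → ℚ.+-inverseʳ (seq x n))
            ; ⁻¹-cong = -ᵣ-cong }
          ; comm = λ x y → pointwise λ n → ℚ.+-comm (seq x n) (seq y n) }
        ; *-cong = *ᵣ-cong
        ; *-assoc = λ x y z → pointwise λ n → ℚ.*-assoc (seq x n) (seq y n) (seq z n)
        ; *-identity = (λ x → pointwise λ n → ℚ.*-identityˡ (seq x n))
                     , (λ x → pointwise λ n → ℚ.*-identityʳ (seq x n))
        ; distrib = (λ x y z → pointwise λ n → ℚ.*-distribˡ-+ (seq x n) (seq y n) (seq z n))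
                  , (λ x y z → pointwise λ n → ℚ.*-distribʳ-+ (seq x n) (seq y n) (seq z n)) }
      ; *-comm = λ x y → pointwise λ n → ℚ.*-comm (seq x n) (seq y n) }

  pos-* : ∀ {p q} → 0ℚ ℚ.< p → 0ℚ ℚ.< q → 0ℚ ℚ.< p ℚ.* q
  pos-* {p} {q} 0<p 0<q = ℚ.positive⁻¹ _ {{ℚ.pos*pos⇒pos p {{ℚ.positive 0<p}} q {{ℚ.positive 0<q}}}}

  p≤∣p∣ : ∀ p → p ℚ.≤ ℚ.∣ p ∣
  p≤∣p∣ p with ℚ.≤-total 0ℚ p
  ... | inj₁ 0≤p = ℚ.≤-reflexive (sym (ℚ.0≤p⇒∣p∣≡p 0≤p))
  ... | inj₂ p≤0 = ℚ.≤-trans p≤0 (ℚ.0≤∣p∣ p)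

  ∣p-q∣<e⇒p≤q+e : ∀ {p q e} → ℚ.∣ p ℚ.- q ∣ ℚ.< e → p ℚ.≤ q ℚ.+ e
  ∣p-q∣<e⇒p≤q+e {p} {q} {e} l = subst (ℚ._≤ q ℚ.+ e)
    (solve 2 (λ a b → b :+ (a :- b) := a) refl p q)
    (ℚ.+-monoʳ-≤ q (ℚ.≤-trans (p≤∣p∣ (p ℚ.- q)) (ℚ.<⇒≤ l)))
    where open +-*-Solver

  ∣p-q∣-comm : ∀ p q → ℚ.∣ p ℚ.- q ∣ ≡ ℚ.∣ q ℚ.- p ∣
  ∣p-q∣-comm p q = trans (sym (ℚ.∣-p∣≡∣p∣ (p ℚ.- q)))
    (cong ℚ.∣_∣ (solve 2 (λ a b → :- (a :- b) := b :- a) refl p q))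
    where open +-*-Solver

  ≤-pointwise : ∀ {x y} → Eventually (λ n → seq x n ℚ.≤ seq y n) → x ≤ᵣ y
  ≤-pointwise {x} {y} ev = mk≤ λ e 0<e → eventually-map
    (λ n l → subst (ℚ._≤ seq y n ℚ.+ e) (ℚ.+-identityʳ (seq x n)) (ℚ.+-mono-≤ l (ℚ.<⇒≤ 0<e))) ev

  ≈⇒≤ : ∀ {x y} → x ≈ᵣ y → x ≤ᵣ y
  ≈⇒≤ (mk≈ close) = mk≤ λ e 0<e → eventually-map (λ n → ∣p-q∣<e⇒p≤q+e) (close e 0<e)

  ≤ᵣ-trans : ∀ {x y z} → x ≤ᵣ y → y ≤ᵣ z → x ≤ᵣ z
  ≤ᵣ-trans {x} {y} {z} (mk≤ f) (mk≤ g) = mk≤ λ e 0<e → go e (half 0<e)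
    where
    go : ∀ e → ∃[ d ] 0ℚ ℚ.< d × d ℚ.+ d ≡ e → Eventually (λ n → seq x n ℚ.≤ seq z n ℚ.+ e)
    go _ (d , 0<d , refl) = eventually-zip
      (λ n p q → ℚ.≤-trans p (ℚ.≤-trans (ℚ.+-monoˡ-≤ d q) (ℚ.≤-reflexive (ℚ.+-assoc (seq z n) d d))))
      (f d 0<d) (g d 0<d)

  ≤ᵣ-antisym : ∀ {x y} → x ≤ᵣ y → y ≤ᵣ x → x ≈ᵣ y
  ≤ᵣ-antisym {x} {y} (mk≤ f) (mk≤ g) = mk≈ λ e 0<e → go e (half 0<e)
    where
    p≤q+d⇒p-q≤d : ∀ {p q d} → p ℚ.≤ q ℚ.+ d → p ℚ.- q ℚ.≤ d
    p≤q+d⇒p-q≤d {p} {q} {d} l = subst (p ℚ.- q ℚ.≤_)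
      (solve 2 (λ q d → (q :+ d) :- q := d) refl q d) (ℚ.+-monoˡ-≤ (ℚ.- q) l)
      where open +-*-Solver
    bound : ∀ {p q d} → p ℚ.≤ q ℚ.+ d → q ℚ.≤ p ℚ.+ d → ℚ.∣ p ℚ.- q ∣ ℚ.≤ d
    bound {p} {q} {d} l m with ℚ.∣p∣≡p∨∣p∣≡-p (p ℚ.- q)
    ... | inj₁ eq = subst (ℚ._≤ d) (sym eq) (p≤q+d⇒p-q≤d l)
    ... | inj₂ eq = subst (ℚ._≤ d)
      (sym (trans eq (solve 2 (λ p q → :- (p :- q) := q :- p) refl p q))) (p≤q+d⇒p-q≤d m)
      where open +-*-Solver
    go : ∀ e → ∃[ d ] 0ℚ ℚ.< d × d ℚ.+ d ≡ e → Eventually (λ n → ℚ.∣ seq x n ℚ.- seq y n ∣ ℚ.< e)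
    go _ (d , 0<d , refl) = eventually-zip
      (λ n p q → ℚ.≤-<-trans (bound p q) (subst (ℚ._< d ℚ.+ d) (ℚ.+-identityʳ d) (ℚ.+-monoʳ-< d 0<d)))
      (f d 0<d) (g d 0<d)

  <⇒≤ᵣ : ∀ {x y} → x <ᵣ y → x ≤ᵣ y
  <⇒≤ᵣ {x} (mk< g 0<g ev) = ≤-pointwise (eventually-map
    (λ n → ℚ.≤-trans (ℚ.≤-trans (ℚ.≤-reflexive (sym (ℚ.+-identityʳ (seq x n)))) (ℚ.+-monoʳ-≤ (seq x n)
        (ℚ.<⇒≤ 0<g)))) ev)

  -- Half of the gap absorbs the tolerance allowed by `≤ᵣ`; the other half remains as the new gap.
  <ᵣ-≤ᵣ-trans : ∀ {x y z} → x <ᵣ y → y ≤ᵣ z → x <ᵣ z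
  <ᵣ-≤ᵣ-trans {x} {y} {z} (mk< g 0<g ev) (mk≤ f) with half 0<g
  ... | d , 0<d , refl = mk< d 0<d (eventually-zip (λ n → step (seq x n) (seq y n) (seq z n)) ev (f d 0<d))
    where
    step : ∀ p q r → p ℚ.+ (d ℚ.+ d) ℚ.≤ q → q ℚ.≤ r ℚ.+ d → p ℚ.+ d ℚ.≤ r
    step p q r l m = subst₂ ℚ._≤_
      (solve 2 (λ p d → p :+ (d :+ d) :- d := p :+ d) refl p d)
      (solve 2 (λ r d → r :+ d :- d := r) refl r d)
      (ℚ.+-monoˡ-≤ (ℚ.- d) (ℚ.≤-trans l m))
      where open +-*-Solver

  ≤ᵣ-<ᵣ-trans : ∀ {x y z} → x ≤ᵣ y → y <ᵣ z → x <ᵣ z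
  ≤ᵣ-<ᵣ-trans {x} {y} {z} (mk≤ f) (mk< g 0<g ev) with half 0<g
  ... | d , 0<d , refl = mk< d 0<d (eventually-zip (λ n → step (seq x n) (seq y n) (seq z n)) (f d 0<d) ev)
    where
    step : ∀ p q r → p ℚ.≤ q ℚ.+ d → q ℚ.+ (d ℚ.+ d) ℚ.≤ r → p ℚ.+ d ℚ.≤ r
    step p q r l m = ℚ.≤-trans (ℚ.+-monoˡ-≤ d l) (ℚ.≤-trans (ℚ.≤-reflexive (ℚ.+-assoc q d d)) m)

  <ᵣ-resp-≈ : ∀ {x y u v} → x ≈ᵣ u → y ≈ᵣ v → x <ᵣ y → u <ᵣ v
  <ᵣ-resp-≈ p q l = ≤ᵣ-<ᵣ-trans (≈⇒≤ (≈-sym p)) (<ᵣ-≤ᵣ-trans l (≈⇒≤ q))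

  fromℚ-mono-< : ∀ {p q} → p ℚ.< q → fromℚ p <ᵣ fromℚ q
  fromℚ-mono-< {p} {q} p<q = mk< (q ℚ.- p)
    (subst (ℚ._< q ℚ.- p) (ℚ.+-inverseʳ p) (ℚ.+-monoˡ-< (ℚ.- p) p<q))
    (always λ _ → ℚ.≤-reflexive (solve 2 (λ p q → p :+ (q :- p) := q) refl p q))
    where open +-*-Solver

  x<y⇒0<y-x : ∀ {x y} → x <ᵣ y → 0ᵣ <ᵣ y +ᵣ -ᵣ x
  x<y⇒0<y-x {x} {y} (mk< g 0<g ev) = mk< g 0<g (eventually-map (λ n l →
    subst (ℚ._≤ seq y n ℚ.- seq x n)
      (solve 2 (λ a g → (a :+ g) :- a := con 0ℚ :+ g) refl (seq x n) g)
      (ℚ.+-monoˡ-≤ (ℚ.- seq x n) l)) ev)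
    where open +-*-Solver

  neg-mono-< : ∀ {x y} → x <ᵣ y → -ᵣ y <ᵣ -ᵣ x
  neg-mono-< {x} {y} (mk< g 0<g ev) = mk< g 0<g (eventually-map (λ n l →
    subst₂ ℚ._≤_
      (solve 3 (λ a b g → (a :+ g) :+ (:- a :- b) := :- b :+ g) refl (seq x n) (seq y n) g)
      (solve 2 (λ a b → b :+ (:- a :- b) := :- a) refl (seq x n) (seq y n))
      (ℚ.+-monoˡ-≤ (ℚ.- seq x n ℚ.- seq y n) l)) ev)
    where open +-*-Solver

  *ᵣ-pos : ∀ {x y} → 0ᵣ <ᵣ x → 0ᵣ <ᵣ y → 0ᵣ <ᵣ x *ᵣ y
  *ᵣ-pos {x} {y} (mk< g 0<g ev) (mk< h 0<h ev′) = mk< (g ℚ.* h) (pos-* 0<g 0<h)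
    (eventually-zip (λ n → step (seq x n) (seq y n)) ev ev′)
    where
    step : ∀ p q → 0ℚ ℚ.+ g ℚ.≤ p → 0ℚ ℚ.+ h ℚ.≤ q → 0ℚ ℚ.+ g ℚ.* h ℚ.≤ p ℚ.* q
    step p q l m rewrite ℚ.+-identityˡ g | ℚ.+-identityˡ h | ℚ.+-identityˡ (g ℚ.* h) = ℚ.≤-trans
      (ℚ.*-monoʳ-≤-nonNeg h {{ℚ.nonNegative (ℚ.<⇒≤ 0<h)}} l)
      (ℚ.*-monoˡ-≤-nonNeg p {{ℚ.nonNegative (ℚ.≤-trans (ℚ.<⇒≤ 0<g) l)}} m)

  -- A positive `x` eventually stays above its gap g, so `|y| ≤ |x y| / g` there. This replaces
  -- division by `x`.
  *ᵣ-cancelˡ-pos : ∀ {x y} → 0ᵣ <ᵣ x → x *ᵣ y ≈ᵣ 0ᵣ → y ≈ᵣ 0ᵣ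
  *ᵣ-cancelˡ-pos {x} {y} (mk< g 0<g ev) (mk≈ close) = mk≈ λ e 0<e →
    eventually-zip (λ n → step (seq x n) (seq y n) e 0<e) ev (close (g ℚ.* e) (pos-* 0<g 0<e))
    where
    step : ∀ p q e → 0ℚ ℚ.< e → 0ℚ ℚ.+ g ℚ.≤ p → ℚ.∣ p ℚ.* q ℚ.- 0ℚ ∣ ℚ.< g ℚ.* e → ℚ.∣ q ℚ.- 0ℚ ∣ ℚ.< e
    step p q e 0<e l m rewrite ℚ.+-identityˡ g | ℚ.+-identityʳ q | ℚ.+-identityʳ (p ℚ.* q) =
      ℚ.*-cancelˡ-<-nonNeg g {{ℚ.nonNegative (ℚ.<⇒≤ 0<g)}} (ℚ.≤-<-trans (begin
        g ℚ.* ℚ.∣ q ∣           ≤⟨ ℚ.*-monoʳ-≤-nonNeg ℚ.∣ q ∣ {{ℚ.∣-∣-nonNeg q}} (ℚ.≤-trans l (p≤∣p∣ p)) ⟩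
        ℚ.∣ p ∣ ℚ.* ℚ.∣ q ∣     ≡⟨ ℚ.∣p*q∣≡∣p∣*∣q∣ p q ⟨
        ℚ.∣ p ℚ.* q ∣           ∎) m)
      where open ℚ.≤-Reasoning

  sandwich : ∀ {x y} → (∀ n → 0ℚ ℚ.≤ seq x n) → (∀ n → seq x n ℚ.≤ seq y n) → y ≈ᵣ 0ᵣ → x ≈ᵣ 0ᵣ
  sandwich 0≤x x≤y y≈0 = ≤ᵣ-antisym (≤ᵣ-trans (≤-pointwise (always x≤y)) (≈⇒≤ y≈0)) (≤-pointwise (always 0≤x))

  square-nonNeg : ∀ p → 0ℚ ℚ.≤ p ℚ.* p
  square-nonNeg p with ℚ.≤-total 0ℚ p
  ... | inj₁ 0≤p = ℚ.nonNegative⁻¹ _ {{ℚ.nonNeg*nonNeg⇒nonNeg p {{ℚ.nonNegative 0≤p}} p {{ℚ.nonNegative 0≤p}}}}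
  ... | inj₂ p≤0 = subst (0ℚ ℚ.≤_) (solve 1 (λ p → (:- p) :* (:- p) := p :* p) refl p)
    (ℚ.nonNegative⁻¹ _ {{ℚ.nonNeg*nonNeg⇒nonNeg (ℚ.- p) {{p≤0⇒}} (ℚ.- p) {{p≤0⇒}}}})
    where
    open +-*-Solver
    p≤0⇒ : ℚ.NonNegative (ℚ.- p)
    p≤0⇒ = ℚ.nonNegative (ℚ.neg-antimono-≤ p≤0)

  -- Closeness e² for the square gives closeness e for `x`. It serves both the intermediate value
  -- theorem and real-rootedness, where only a square can be bounded.
  x²≈0⇒x≈0 : ∀ {x} → x *ᵣ x ≈ᵣ 0ᵣ → x ≈ᵣ 0ᵣ
  x²≈0⇒x≈0 {x} (mk≈ close) = mk≈ λ e 0<e →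
    eventually-map (λ n → step (seq x n) e 0<e) (close (e ℚ.* e) (pos-* 0<e 0<e))
    where
    step : ∀ p e → 0ℚ ℚ.< e → ℚ.∣ p ℚ.* p ℚ.- 0ℚ ∣ ℚ.< e ℚ.* e → ℚ.∣ p ℚ.- 0ℚ ∣ ℚ.< e
    step p e 0<e l rewrite ℚ.+-identityʳ p | ℚ.+-identityʳ (p ℚ.* p) | ℚ.∣p*q∣≡∣p∣*∣q∣ p p =
      ℚ.≰⇒> λ e≤∣p∣ → ℚ.<-irrefl refl (ℚ.<-≤-trans l (ℚ.≤-trans
        (ℚ.*-monoʳ-≤-nonNeg e {{ℚ.nonNegative (ℚ.<⇒≤ 0<e)}} e≤∣p∣)
        (ℚ.*-monoˡ-≤-nonNeg ℚ.∣ p ∣ {{ℚ.∣-∣-nonNeg p}} e≤∣p∣)))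

  -- Rational approximation and the intermediate value theorem.

  ½^ : ℕ → ℚ
  ½^ zero    = 1ℚ
  ½^ (suc k) = ℚ.½ ℚ.* ½^ k

  ½^-pos : ∀ k → 0ℚ ℚ.< ½^ k
  ½^-pos zero    = 0<1
  ½^-pos (suc k) = pos-* (ℚ.positive⁻¹ ℚ.½) (½^-pos k)

  recip : ℕ → ℚ
  recip k = fromℚᵘ (mkℚᵘ (+ 1) k)

  ½*recip : ∀ k → ℚ.½ ℚ.* recip k ℚ.≤ recip (suc k)
  ½*recip k = ℚ.toℚᵘ-cancel-≤ (begin
    toℚᵘ (ℚ.½ ℚ.* recip k)                 ≃⟨ ℚ.toℚᵘ-homo-* ℚ.½ (recip k) ⟩
    toℚᵘ ℚ.½ ℚᵘ.* toℚᵘ (recip k)           ≃⟨ ℚᵘ.*-congˡ {toℚᵘ ℚ.½} (ℚ.toℚᵘ-fromℚᵘ (mkℚᵘ (+ 1) k)) ⟩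
    toℚᵘ ℚ.½ ℚᵘ.* mkℚᵘ (+ 1) k             ≤⟨ ℚᵘ.*≤* (ℤ.+≤+ (ℕ.≤-trans
      (ℕ.m≤m+n _ k)
      (ℕ.≤-reflexive (ℕ-Solver.solve 1 (λ k → (con 1 :* (con 2 :+ k)) :+ k
          := con 1 :* (con 2 :* (con 1 :+ k))) refl k)))) ⟩
    mkℚᵘ (+ 1) (suc k)                     ≃⟨ ℚ.toℚᵘ-fromℚᵘ (mkℚᵘ (+ 1) (suc k)) ⟨
    toℚᵘ (recip (suc k))                   ∎)
    where
    open ℚᵘ.≤-Reasoning
    open ℕ-Solver using (con; _:*_; _:+_; _:=_)

  ½^≤recip : ∀ k → ½^ k ℚ.≤ recip k
  ½^≤recip zero    = ℚ.≤-refl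
  ½^≤recip (suc k) = ℚ.≤-trans (ℚ.*-monoˡ-≤-nonNeg ℚ.½ (½^≤recip k)) (½*recip k)

  -- For e = (p + 1)/(d + 1) every k > d works, since 1/(k + 1) < 1/(d + 1) ≤ e.
  recip-null : ∀ e → 0ℚ ℚ.< e → Eventually (λ k → recip k ℚ.< e)
  recip-null (mkℚ -[1+ p ] d _)   (ℚ.*<* ())
  recip-null (mkℚ (+ zero) d _)  (ℚ.*<* (ℤ.+<+ ()))
  recip-null e@(mkℚ (+ suc p) d _)  0<e = suc d , λ k d<k → ℚ.toℚᵘ-cancel-< (begin-strict
    toℚᵘ (recip k)        ≃⟨ ℚ.toℚᵘ-fromℚᵘ (mkℚᵘ (+ 1) k) ⟩
    mkℚᵘ (+ 1) k          <⟨ ℚᵘ.*<* (ℤ.+<+ (ℕ.<-≤-trans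
                               (s≤s (ℕ.≤-trans (ℕ.≤-reflexive (ℕ.+-identityʳ (suc d))) d<k))
                               (ℕ.m≤m+n (suc k) (p ℕ.* suc k)))) ⟩
    toℚᵘ e                ∎)
    where open ℚᵘ.≤-Reasoning

  ½^-null : Null ½^
  ½^-null e 0<e = eventually-map
    (λ k l → subst (ℚ._< e) (sym (ℚ.0≤p⇒∣p∣≡p (ℚ.<⇒≤ (½^-pos k)))) (ℚ.≤-<-trans (½^≤recip k) l))
    (recip-null e 0<e)

  close-cauchy : ∀ (x : ℕ → ℚ) y → Null (λ k → x k ℚ.- seq y k) → IsCauchy x
  close-cauchy x y null e 0<e = go e (half 0<e)
    where
    go : ∀ e → ∃[ d ] 0ℚ ℚ.< d × d ℚ.+ d ≡ e →
         ∃[ N ] ∀ m n → N ℕ.≤ m → N ℕ.≤ n → ℚ.∣ x m ℚ.- x n ∣ ℚ.< e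
    go _ (d , 0<d , refl) with half 0<d
    -- The tolerance is 4c: one c for each of the two distances to `y`, and 2c for the variation of
    -- `y` itself.
    ... | c , 0<c , refl with null c 0<c | cauchy y (c ℚ.+ c) 0<d
    ... | M , p | N , q = M ⊔ N , λ m n l l′ →
      let M≤m = ℕ.m⊔n≤o⇒m≤o M N l ; M≤n = ℕ.m⊔n≤o⇒m≤o M N l′
          N≤m = ℕ.m⊔n≤o⇒n≤o M N l ; N≤n = ℕ.m⊔n≤o⇒n≤o M N l′ in
      begin-strict
      ℚ.∣ x m ℚ.- x n ∣
        ≡⟨ cong ℚ.∣_∣ (solve 4 (λ a b s t → a :- b
            := (a :- s) :+ (:- (b :- t)) :+ (s :- t)) refl (x m) (x n) (seq y m) (seq y n)) ⟩
      ℚ.∣ (x m ℚ.- seq y m) ℚ.+ ℚ.- (x n ℚ.- seq y n) ℚ.+ (seq y m ℚ.- seq y n) ∣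
        ≤⟨ ℚ.∣p+q∣≤∣p∣+∣q∣ ((x m ℚ.- seq y m) ℚ.+ ℚ.- (x n ℚ.- seq y n)) (seq y m ℚ.- seq y n) ⟩
      ℚ.∣ (x m ℚ.- seq y m) ℚ.+ ℚ.- (x n ℚ.- seq y n) ∣ ℚ.+ ℚ.∣ seq y m ℚ.- seq y n ∣
        ≤⟨ ℚ.+-monoˡ-≤ ℚ.∣ seq y m ℚ.- seq y n ∣ (ℚ.∣p+q∣≤∣p∣+∣q∣ (x m ℚ.- seq y m) (ℚ.- (x n ℚ.- seq y n))) ⟩
      ℚ.∣ x m ℚ.- seq y m ∣ ℚ.+ ℚ.∣ ℚ.- (x n ℚ.- seq y n) ∣ ℚ.+ ℚ.∣ seq y m ℚ.- seq y n ∣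
        ≡⟨ cong (λ z → ℚ.∣ x m ℚ.- seq y m ∣ ℚ.+ z ℚ.+ ℚ.∣ seq y m ℚ.- seq y n ∣) (ℚ.∣-p∣≡∣p∣ (x n ℚ.- seq y n)) ⟩
      ℚ.∣ x m ℚ.- seq y m ∣ ℚ.+ ℚ.∣ x n ℚ.- seq y n ∣ ℚ.+ ℚ.∣ seq y m ℚ.- seq y n ∣
        <⟨ ℚ.+-mono-< (ℚ.+-mono-< (p m M≤m) (p n M≤n)) (q m n N≤m N≤n) ⟩
      c ℚ.+ c ℚ.+ (c ℚ.+ c) ∎
      where
      open ℚ.≤-Reasoning
      open +-*-Solver

  -- Bisection starts at rational points, while the root must lie strictly above a real `a`. Beyond
  -- index `N k` the sequence of `a` varies by less than `½^ k`, so adding `2 ½^ k` leaves a gap of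
  -- `½^ k`. Taking an index of at least k makes these points converge to `a`.
  approxAbove : ∀ a → ∃[ x ] x ≈ᵣ a × (∀ k → a <ᵣ fromℚ (seq x k))
  approxAbove a = mkℝ x (close-cauchy x a diff) , null⇒≈ diff , above
    where
    N : ℕ → ℕ
    N k = proj₁ (cauchy a (½^ k) (½^-pos k))

    x : ℕ → ℚ
    x k = seq a (N k ⊔ k) ℚ.+ (½^ k ℚ.+ ½^ k)

    above : ∀ k → a <ᵣ fromℚ (x k)
    above k = mk< (½^ k) (½^-pos k) (N k ⊔ k , λ n l → step (seq a n) (seq a (N k ⊔ k)) (½^ k)
      (proj₂ (cauchy a (½^ k) (½^-pos k)) n (N k ⊔ k) (ℕ.m⊔n≤o⇒m≤o (N k) k l) (ℕ.m≤m⊔n (N k) k)))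
      where
      step : ∀ p q d → ℚ.∣ p ℚ.- q ∣ ℚ.< d → p ℚ.+ d ℚ.≤ q ℚ.+ (d ℚ.+ d)
      step p q d l = ℚ.≤-trans (ℚ.+-monoˡ-≤ d (∣p-q∣<e⇒p≤q+e {p} {q} l)) (ℚ.≤-reflexive (ℚ.+-assoc q d d))

    shift : Null (λ k → seq a (N k ⊔ k) ℚ.- seq a k)
    shift e 0<e with cauchy a e 0<e
    ... | M , c = M , λ k M≤k → c (N k ⊔ k) k (ℕ.≤-trans M≤k (ℕ.m≤n⊔m (N k) k)) M≤k

    diff : Null (λ k → x k ℚ.- seq a k)
    diff = null-resp
      (λ k → solve 3 (λ p q d → (p :- q) :+ (d :+ d) := (p :+ (d :+ d)) :- q) refl (seq a (N k ⊔ k)) (seq a k) (½^ k))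
      (null-+ shift (null-+ ½^-null ½^-null))
      where open +-*-Solver

  approxBelow : ∀ a → ∃[ x ] x ≈ᵣ a × (∀ k → fromℚ (seq x k) <ᵣ a)
  approxBelow a = go (approxAbove (-ᵣ a))
    where
    neg-neg : ∀ a → -ᵣ (-ᵣ a) ≈ᵣ a
    neg-neg a = pointwise λ n → solve 1 (λ p → :- (:- p) := p) refl (seq a n)
      where open +-*-Solver

    go : ∃[ x ] x ≈ᵣ -ᵣ a × (∀ k → -ᵣ a <ᵣ fromℚ (seq x k)) → ∃[ x ] x ≈ᵣ a × (∀ k → fromℚ (seq x k) <ᵣ a)
    go (x , x≈-a , above) = -ᵣ x , ≈-trans {y = -ᵣ (-ᵣ a)} (-ᵣ-cong x≈-a) (neg-neg a)
      , λ k → <ᵣ-resp-≈ { -ᵣ fromℚ (seq x k)} { -ᵣ (-ᵣ a)} (pointwise λ _ → refl) (neg-neg a) (neg-mono-< (above k))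

  -- The function is given twice: `φ` on rationals, where bisection can decide signs, and `f` on
  -- reals, which applies `φ` to each term of a representing sequence.
  module IntermediateValue (φ : ℚ → ℚ) (f : ℝ → ℝ)
    (f-cong : ∀ {x y} → x ≈ᵣ y → f x ≈ᵣ f y)
    (f-seq : ∀ x n → seq (f x) n ≡ φ (seq x n)) where

    record Bracket : Set where
      field
        lo hi : ℚ
        lo≤hi : lo ℚ.≤ hi
        signs : φ lo ℚ.* φ hi ℚ.≤ 0ℚ

      width : ℚ
      width = hi ℚ.- lo

    open Bracket

    mid : Bracket → ℚ
    mid I = ℚ.½ ℚ.* (lo I ℚ.+ hi I)

    lo≤mid : ∀ I → lo I ℚ.≤ mid I
    lo≤mid I = subst (ℚ._≤ mid I)
      (solve 1 (λ a → con ℚ.½ :* (a :+ a) := a) refl (lo I))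
      (ℚ.*-monoˡ-≤-nonNeg ℚ.½ (ℚ.+-monoʳ-≤ (lo I) (lo≤hi I)))
      where open +-*-Solver

    mid≤hi : ∀ I → mid I ℚ.≤ hi I
    mid≤hi I = subst (mid I ℚ.≤_)
      (solve 1 (λ a → con ℚ.½ :* (a :+ a) := a) refl (hi I))
      (ℚ.*-monoˡ-≤-nonNeg ℚ.½ (ℚ.+-monoˡ-≤ (hi I) (lo≤hi I)))
      where open +-*-Solver

    -- Multiplying `q r` by the positive number `p q` gives `q² (p r)`, which is at most 0. No case
    -- distinction on individual signs is made.
    opposite : ∀ {p q r} → p ℚ.* r ℚ.≤ 0ℚ → 0ℚ ℚ.< p ℚ.* q → q ℚ.* r ℚ.≤ 0ℚ
    opposite {p} {q} {r} pr≤0 0<pq = ℚ.*-cancelˡ-≤-pos (p ℚ.* q) {{ℚ.positive 0<pq}} (begin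
      p ℚ.* q ℚ.* (q ℚ.* r)    ≡⟨ solve 3 (λ p q r → p :* q :* (q :* r) := (q :* q) :* (p :* r)) refl p q r ⟩
      q ℚ.* q ℚ.* (p ℚ.* r)    ≤⟨ ℚ.*-monoˡ-≤-nonNeg (q ℚ.* q) {{ℚ.nonNegative (square-nonNeg q)}} pr≤0 ⟩
      q ℚ.* q ℚ.* 0ℚ           ≡⟨ solve 2 (λ p q → q :* q :* con 0ℚ := p :* q :* con 0ℚ) refl p q ⟩
      p ℚ.* q ℚ.* 0ℚ           ∎)
      where
      open ℚ.≤-Reasoning
      open +-*-Solver

    bisect : ∀ I → ∃[ J ] lo I ℚ.≤ lo J × hi J ℚ.≤ hi I × width J ≡ ℚ.½ ℚ.* width I
    bisect I with φ (lo I) ℚ.* φ (mid I) ℚ.≤? 0ℚ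
    ... | yes s = record { lo = lo I ; hi = mid I ; lo≤hi = lo≤mid I ; signs = s }
      , ℚ.≤-refl , mid≤hi I
      , solve 2 (λ a b → con ℚ.½ :* (a :+ b) :- a := con ℚ.½ :* (b :- a)) refl (lo I) (hi I)
      where open +-*-Solver
    ... | no ¬s = record { lo = mid I ; hi = hi I ; lo≤hi = mid≤hi I
                         ; signs = opposite {φ (lo I)} {φ (mid I)} {φ (hi I)} (signs I) (ℚ.≰⇒> ¬s) }
      , lo≤mid I , ℚ.≤-refl
      , solve 2 (λ a b → b :- con ℚ.½ :* (a :+ b) := con ℚ.½ :* (b :- a)) refl (lo I) (hi I)
      where open +-*-Solver

    module _ (I₀ : Bracket) where

      bracket : ℕ → Bracket
      bracket zero    = I₀
      bracket (suc k) = proj₁ (bisect (bracket k))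

      lo-mono : ∀ d k → lo (bracket k) ℚ.≤ lo (bracket (d ℕ.+ k))
      lo-mono zero    k = ℚ.≤-refl
      lo-mono (suc d) k = ℚ.≤-trans (lo-mono d k) (proj₁ (proj₂ (bisect (bracket (d ℕ.+ k)))))

      hi-mono : ∀ d k → hi (bracket (d ℕ.+ k)) ℚ.≤ hi (bracket k)
      hi-mono zero    k = ℚ.≤-refl
      hi-mono (suc d) k = ℚ.≤-trans (proj₁ (proj₂ (proj₂ (bisect (bracket (d ℕ.+ k)))))) (hi-mono d k)

      width≡ : ∀ k → width (bracket k) ≡ width I₀ ℚ.* ½^ k
      width≡ zero    = sym (ℚ.*-identityʳ _)
      width≡ (suc k) = trans (proj₂ (proj₂ (proj₂ (bisect (bracket k)))))
        (trans (cong (ℚ.½ ℚ.*_) (width≡ k))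
          (solve 2 (λ w p → con ℚ.½ :* (w :* p) := w :* (con ℚ.½ :* p)) refl (width I₀) (½^ k)))
        where open +-*-Solver

      width-null : Null (λ k → hi (bracket k) ℚ.- lo (bracket k))
      width-null = null-resp (λ k → sym (width≡ k)) (null-seq* (fromℚ (width I₀)) ½^-null)

      lo-spread : ∀ N m → N ℕ.≤ m → ℚ.∣ lo (bracket m) ℚ.- lo (bracket N) ∣ ℚ.≤ width (bracket N)
      lo-spread N m N≤m with ℕ.m∸n+n≡m N≤m
      ... | eq = subst (λ m → ℚ.∣ lo (bracket m) ℚ.- lo (bracket N) ∣ ℚ.≤ width (bracket N)) eq
        (ℚ.≤-trans
          (ℚ.≤-reflexive (ℚ.0≤p⇒∣p∣≡p (subst (ℚ._≤ lo (bracket (m ℕ.∸ N ℕ.+ N)) ℚ.- lo (bracket N)) (ℚ.+-inverseʳ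
              (lo (bracket N)))
            (ℚ.+-monoˡ-≤ (ℚ.- lo (bracket N)) (lo-mono (m ℕ.∸ N) N)))))
          (ℚ.+-monoˡ-≤ (ℚ.- lo (bracket N)) (ℚ.≤-trans (lo≤hi (bracket (m ℕ.∸ N ℕ.+ N))) (hi-mono (m ℕ.∸ N) N))))

      lo-cauchy : IsCauchy (λ k → lo (bracket k))
      lo-cauchy e 0<e = go e (half 0<e)
        where
        go : ∀ e → ∃[ d ] 0ℚ ℚ.< d × d ℚ.+ d ≡ e →
             ∃[ N ] ∀ m n → N ℕ.≤ m → N ℕ.≤ n → ℚ.∣ lo (bracket m) ℚ.- lo (bracket n) ∣ ℚ.< e
        go _ (d , 0<d , refl) with width-null d 0<d
        ... | N , narrow = N , λ m n l l′ → begin-strict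
          ℚ.∣ L m ℚ.- L n ∣                                ≡⟨ cong ℚ.∣_∣ (telescope (L m) (L N) (L n)) ⟨
          ℚ.∣ (L m ℚ.- L N) ℚ.+ (L N ℚ.- L n) ∣            ≤⟨ ℚ.∣p+q∣≤∣p∣+∣q∣ (L m ℚ.- L N) (L N ℚ.- L n) ⟩
          ℚ.∣ L m ℚ.- L N ∣ ℚ.+ ℚ.∣ L N ℚ.- L n ∣          ≡⟨ cong (ℚ.∣ L m ℚ.- L N ∣ ℚ.+_) (∣p-q∣-comm (L N) (L n)) ⟩
          ℚ.∣ L m ℚ.- L N ∣ ℚ.+ ℚ.∣ L n ℚ.- L N ∣          ≤⟨ ℚ.+-mono-≤ (lo-spread N m l) (lo-spread N n l′) ⟩
          width (bracket N) ℚ.+ width (bracket N)          <⟨ ℚ.+-mono-< narrow′ narrow′ ⟩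
          d ℚ.+ d                                          ∎
          where
          open ℚ.≤-Reasoning
          L : ℕ → ℚ
          L k = lo (bracket k)
          narrow′ : width (bracket N) ℚ.< d
          narrow′ = ℚ.≤-<-trans (p≤∣p∣ (width (bracket N))) (narrow N ℕ.≤-refl)

      left right : ℝ
      left  = mkℝ (λ k → lo (bracket k)) lo-cauchy
      right = mkℝ (λ k → hi (bracket k)) (close-cauchy (λ k → hi (bracket k)) left width-null)

      right≈left : right ≈ᵣ left
      right≈left = null⇒≈ {right} {left} width-null

      -- The bracket condition gives `f left * f right ≤ 0` term by term. Since `left` and `right`
      -- are equal reals, this bounds the square of `f left` above by 0, and hence the square
      -- vanishes.
      left-root : f left ≈ᵣ 0ᵣ
      left-root = x²≈0⇒x≈0 {f left} (≤ᵣ-antisym {f left *ᵣ f left}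
        (≤ᵣ-trans {f left *ᵣ f left} {f left *ᵣ f right} (≈⇒≤ {f left *ᵣ f left} {f left *ᵣ f right} (*ᵣ-cong
            {f left} {f left} {f left} {f right} (≈-refl {f left}) (f-cong (≈-sym {right} {left} right≈left))))
          (≤-pointwise (always λ n → subst (ℚ._≤ 0ℚ)
            (sym (cong₂ ℚ._*_ (f-seq left n) (f-seq right n))) (signs (bracket n)))))
        (≤-pointwise (always λ n → square-nonNeg (seq (f left) n))))

      lo≤left : fromℚ (lo I₀) ≤ᵣ left
      lo≤left = ≤-pointwise (always λ n → subst (λ m → lo I₀ ℚ.≤ lo (bracket m)) (ℕ.+-identityʳ n) (lo-mono n 0))

      left≤hi : left ≤ᵣ fromℚ (hi I₀)
      left≤hi = ≤-pointwise (always λ n → ℚ.≤-trans (lo≤hi (bracket n))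
        (subst (λ m → hi (bracket m) ℚ.≤ hi I₀) (ℕ.+-identityʳ n) (hi-mono n 0)))

    seq-< : ∀ {x y} → x <ᵣ y → Eventually (λ n → seq x n ℚ.< seq y n)
    seq-< {x} {y} (mk< g 0<g ev) = eventually-map
      (λ n → ℚ.<-≤-trans (subst (ℚ._< seq x n ℚ.+ g) (ℚ.+-identityʳ (seq x n)) (ℚ.+-monoʳ-< (seq x n) 0<g))) ev

    root-between : ∀ {a b} → a <ᵣ b → f a *ᵣ f b <ᵣ 0ᵣ → ∃[ r ] f r ≈ᵣ 0ᵣ × a <ᵣ r × r <ᵣ b
    root-between {a} {b} a<b fafb<0 = approximate (approxAbove a) (approxBelow b)
      where
      approximate : ∃[ x ] x ≈ᵣ a × (∀ k → a <ᵣ fromℚ (seq x k)) →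
                    ∃[ y ] y ≈ᵣ b × (∀ k → fromℚ (seq y k) <ᵣ b) →
                    ∃[ r ] f r ≈ᵣ 0ᵣ × a <ᵣ r × r <ᵣ b
      approximate (x , x≈a , above) (y , y≈b , below) =
        -- As reals, `x < y` and `f x * f y < 0`; at a common large index both become inequalities
        -- between rationals, and the terms there form a bracket strictly inside (a, b).
        choose (eventually⇒∃ (eventually-zip {Q = λ n → seq (f x *ᵣ f y) n ℚ.< 0ℚ} (λ _ → _,_)
          (seq-< (<ᵣ-resp-≈ (≈-sym x≈a) (≈-sym y≈b) a<b))
          (seq-< (<ᵣ-resp-≈ {f a *ᵣ f b} {0ᵣ} {f x *ᵣ f y} {0ᵣ} (*ᵣ-cong {f a} {f x} {f b} {f y} (f-cong (≈-sym {x}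
              {a} x≈a)) (f-cong (≈-sym {y} {b} y≈b))) (≈-refl {0ᵣ}) fafb<0))))
        where
        choose : ∃[ n ] seq x n ℚ.< seq y n × seq (f x *ᵣ f y) n ℚ.< 0ℚ →
             ∃[ r ] f r ≈ᵣ 0ᵣ × a <ᵣ r × r <ᵣ b
        choose (n , x<y , opposite-signs) = left I , left-root I
          , <ᵣ-≤ᵣ-trans (above n) (lo≤left I) , ≤ᵣ-<ᵣ-trans (left≤hi I) (below n)
          where
          I : Bracket
          I = record { lo = seq x n ; hi = seq y n ; lo≤hi = ℚ.<⇒≤ x<y
                     ; signs = ℚ.<⇒≤ (subst (ℚ._< 0ℚ) (cong₂ ℚ._*_ (f-seq x n) (f-seq y n)) opposite-signs) }

-- Polynomials over a commutative ring: evaluation, factorization and zeros of factored polynomials.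

module PolynomialRings where

  open import Algebra.Bundles using (CommutativeRing; RawRing)
  import Algebra.Properties.Ring
  import Algebra.Solver.Ring
  open import Algebra.Solver.Ring.AlmostCommutativeRing using (fromCommutativeRing; _-Raw-AlmostCommutative⟶_)
  open import Algebra.Structures using (IsCommutativeRing)
  import Data.Integer.Base as ℤ
  import Data.Integer.Properties as ℤ
  open import Data.List.Base using (List; []; _∷_; length; map)
  open import Data.List.Relation.Unary.All as All using (All; []; _∷_)
  open import Data.List.Relation.Unary.AllPairs using (AllPairs; []; _∷_)
  import Data.Maybe.Base as Maybe
  open import Data.Nat.Base as ℕ using (ℕ; zero; suc; s≤s; z≤n)
  open import Data.Product.Base using (_×_; _,_)
  open import Defs using (module Polynomials)
  open import Function.Base using (id)
  open import Level using (_⊔_)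
  open import Relation.Binary.PropositionalEquality as ≡ using (_≡_)
  import Relation.Binary.Reasoning.Setoid
  open import Relation.Nullary.Decidable using (dec⇒maybe)

  -- The laws are kept apart from the operations so that, over ℝ-rawRing, the polynomials below are
  -- definitionally those of Defs without unfolding the Cauchy sequences.
  IsCR : ∀ {c ℓ} → RawRing c ℓ → Set (c ⊔ ℓ)
  IsCR 𝓡 = IsCommutativeRing _≈_ _+_ _*_ -_ 0# 1#
    where open RawRing 𝓡

  bundle : ∀ {c ℓ} (𝓡 : RawRing c ℓ) → IsCR 𝓡 → CommutativeRing c ℓ
  bundle 𝓡 isR = record { RawRing 𝓡 ; isCommutativeRing = isR }

  Respects : ∀ {c ℓ c′ ℓ′} (𝓡 : RawRing c ℓ) (A : CommutativeRing c′ ℓ′) →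
             𝓡 -Raw-AlmostCommutative⟶ fromCommutativeRing A → Set (c ⊔ ℓ ⊔ ℓ′)
  Respects 𝓡 A h = ∀ {x y} → x ≈ y → CommutativeRing._≈_ A ⟦ x ⟧ ⟦ y ⟧
    where
    open RawRing 𝓡
    open _-Raw-AlmostCommutative⟶_ h

  -- The solver compares coefficients, so these are taken in ℤ, where equality is decidable;
  -- equality in the carrier need not be.
  module RingSolver {c ℓ} (R : CommutativeRing c ℓ)
    (ι : ℤ.+-*-rawRing -Raw-AlmostCommutative⟶ fromCommutativeRing R) =
    Algebra.Solver.Ring ℤ.+-*-rawRing (fromCommutativeRing R) ι
      (λ i j → Maybe.map (λ i≡j → CommutativeRing.reflexive R (≡.cong (_-Raw-AlmostCommutative⟶_.⟦_⟧ ι) i≡j))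
          (dec⇒maybe (i ℤ.≟ j)))

  module Coefficients {c ℓ} (𝓡 : RawRing c ℓ) (isR : IsCR 𝓡) where
    open CommutativeRing (bundle 𝓡 isR)
    open Polynomials 𝓡
    open Algebra.Properties.Ring ring using (-0#≈0#)
    open Relation.Binary.Reasoning.Setoid setoid

    coeff-+ : ∀ p q k → coeff (p +ₚ q) k ≈ coeff p k + coeff q k
    coeff-+ []      q       k       = sym (+-identityˡ _)
    coeff-+ (x ∷ p) []      k       = sym (+-identityʳ _)
    coeff-+ (x ∷ p) (y ∷ q) zero    = refl
    coeff-+ (x ∷ p) (y ∷ q) (suc k) = coeff-+ p q k

    coeff-· : ∀ x p k → coeff (x ·ₚ p) k ≈ x * coeff p k
    coeff-· x []      k       = sym (zeroʳ x)
    coeff-· x (y ∷ p) zero    = refl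
    coeff-· x (y ∷ p) (suc k) = coeff-· x p k

    coeff-neg : ∀ p k → coeff (map -_ p) k ≈ - coeff p k
    coeff-neg []      k       = sym -0#≈0#
    coeff-neg (x ∷ p) zero    = refl
    coeff-neg (x ∷ p) (suc k) = coeff-neg p k

    coeff-- : ∀ p q k → coeff (p -ₚ q) k ≈ coeff p k - coeff q k
    coeff-- p q k = trans (coeff-+ p (map -_ q) k) (+-congˡ (coeff-neg q k))

    coeff-linear*-zero : ∀ a b p → coeff ((a ∷ b ∷ []) *ₚ p) 0 ≈ a * coeff p 0
    coeff-linear*-zero a b p = trans (coeff-+ (a ·ₚ p) _ 0) (trans (+-identityʳ _) (coeff-· a p 0))

    coeff-linear*-suc : ∀ a b p k → coeff ((a ∷ b ∷ []) *ₚ p) (suc k) ≈ a * coeff p (suc k) + b * coeff p k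
    coeff-linear*-suc a b p k = begin
      coeff ((a ∷ b ∷ []) *ₚ p) (suc k)                     ≈⟨ coeff-+ (a ·ₚ p) _ (suc k) ⟩
      coeff (a ·ₚ p) (suc k) + coeff (b ·ₚ p +ₚ (0# ∷ [])) k
          ≈⟨ +-cong (coeff-· a p (suc k)) (coeff-+ (b ·ₚ p) (0# ∷ []) k) ⟩
      a * coeff p (suc k) + (coeff (b ·ₚ p) k + coeff (0# ∷ []) k)
          ≈⟨ +-congˡ (+-cong (coeff-· b p k) (coeff-0∷[] k)) ⟩
      a * coeff p (suc k) + (b * coeff p k + 0#)            ≈⟨ +-congˡ (+-identityʳ _) ⟩
      a * coeff p (suc k) + b * coeff p k                   ∎
      where
      coeff-0∷[] : ∀ k → coeff (0# ∷ []) k ≈ 0#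
      coeff-0∷[] zero    = refl
      coeff-0∷[] (suc k) = refl

    linear*-congʳ : ∀ a b p q → p ≈ₚ q → (a ∷ b ∷ []) *ₚ p ≈ₚ (a ∷ b ∷ []) *ₚ q
    linear*-congʳ a b p q p≈q zero = trans (coeff-linear*-zero a b p)
      (trans (*-congˡ (p≈q 0)) (sym (coeff-linear*-zero a b q)))
    linear*-congʳ a b p q p≈q (suc k) = trans (coeff-linear*-suc a b p k)
      (trans (+-cong (*-congˡ (p≈q (suc k))) (*-congˡ (p≈q k))) (sym (coeff-linear*-suc a b q k)))

    -- The degree is stated through coefficients because trailing zeros make the length of the list
    -- meaningless.
    Monic : ℕ → Poly → Set ℓ
    Monic n p = coeff p n ≈ 1# × (∀ k → n ℕ.< k → coeff p k ≈ 0#)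

    linearFactors : List Carrier → Poly
    linearFactors zs = ∏ₚ (map (λ z → X -ₚ const z) zs)

    ·-identity : ∀ p → p ≈ₚ 1# ·ₚ p
    ·-identity p k = sym (trans (coeff-· 1# p k) (*-identityˡ _))

    shift-linearFactors : ∀ p z zs → z ≈ 0# → p ≈ₚ linearFactors zs → (0# ∷ p) ≈ₚ linearFactors (z ∷ zs)
    shift-linearFactors p z zs z≈0 p≈ zero = sym (begin
      coeff (linearFactors (z ∷ zs)) 0            ≈⟨ coeff-linear*-zero (0# + - z) 1# (linearFactors zs) ⟩
      (0# + - z) * coeff (linearFactors zs) 0     ≈⟨ trans (*-congʳ 0-z≈0) (zeroˡ _) ⟩
      0#                                          ∎)
      where
      0-z≈0 : 0# + - z ≈ 0#
      0-z≈0 = trans (+-congˡ (-‿cong z≈0)) (-‿inverseʳ 0#)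
    shift-linearFactors p z zs z≈0 p≈ (suc k) = begin
      coeff p k                                   ≈⟨ p≈ k ⟩
      coeff (linearFactors zs) k
          ≈⟨ trans (+-cong (trans (*-congʳ 0-z≈0) (zeroˡ _)) (*-identityˡ _)) (+-identityˡ _) ⟨
      (0# + - z) * coeff (linearFactors zs) (suc k) + 1# * coeff (linearFactors zs) k
          ≈⟨ coeff-linear*-suc (0# + - z) 1# (linearFactors zs) k ⟨
      coeff (linearFactors (z ∷ zs)) (suc k)      ∎
      where
      0-z≈0 : 0# + - z ≈ 0#
      0-z≈0 = trans (+-congˡ (-‿cong z≈0)) (-‿inverseʳ 0#)

  -- Coefficients and argument may live in different rings: integer polynomials are evaluated at
  -- reals, real ones at reals and at complex numbers.
  module Evaluation {c ℓ c′ ℓ′} (𝓡 : RawRing c ℓ) (isR : IsCR 𝓡) (A : CommutativeRing c′ ℓ′)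
    (h : 𝓡 -Raw-AlmostCommutative⟶ fromCommutativeRing A)
    (h-cong : Respects 𝓡 A h)
    (ι : ℤ.+-*-rawRing -Raw-AlmostCommutative⟶ fromCommutativeRing A) where

    private module R = CommutativeRing (bundle 𝓡 isR)
    open Polynomials 𝓡
    open CommutativeRing A
    open _-Raw-AlmostCommutative⟶_ h
    open Relation.Binary.Reasoning.Setoid setoid
    open RingSolver A ι using (solve; _:+_; _:*_; :-_; _:=_; con)
    open Algebra.Properties.Ring ring using (-0#≈0#)

    eval : Poly → Carrier → Carrier
    eval []      z = 0#
    eval (x ∷ p) z = ⟦ x ⟧ + z * eval p z

    eval-zero : ∀ p z → (∀ k → coeff p k R.≈ R.0#) → eval p z ≈ 0#
    eval-zero []      z p≈0 = refl
    eval-zero (x ∷ p) z p≈0 = begin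
      ⟦ x ⟧ + z * eval p z  ≈⟨ +-cong (trans (h-cong (p≈0 0)) 0-homo) (*-congˡ (eval-zero p z (λ k → p≈0 (suc k)))) ⟩
      0# + z * 0#           ≈⟨ trans (+-identityˡ _) (zeroʳ z) ⟩
      0#                    ∎

    eval-congˡ : ∀ p q z → p ≈ₚ q → eval p z ≈ eval q z
    eval-congˡ []      q       z p≈q = sym (eval-zero q z (λ k → R.sym (p≈q k)))
    eval-congˡ (x ∷ p) []      z p≈q = eval-zero (x ∷ p) z p≈q
    eval-congˡ (x ∷ p) (y ∷ q) z p≈q =
      +-cong (h-cong (p≈q 0)) (*-congˡ (eval-congˡ p q z (λ k → p≈q (suc k))))

    eval-congʳ : ∀ p {z w} → z ≈ w → eval p z ≈ eval p w
    eval-congʳ []      z≈w = refl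
    eval-congʳ (x ∷ p) z≈w = +-congˡ (*-cong z≈w (eval-congʳ p z≈w))

    eval-+ : ∀ p q z → eval (p +ₚ q) z ≈ eval p z + eval q z
    eval-+ []      q       z = sym (+-identityˡ _)
    eval-+ (x ∷ p) []      z = sym (+-identityʳ _)
    eval-+ (x ∷ p) (y ∷ q) z = begin
      ⟦ x R.+ y ⟧ + z * eval (p +ₚ q) z                  ≈⟨ +-cong (+-homo x y) (*-congˡ (eval-+ p q z)) ⟩
      (⟦ x ⟧ + ⟦ y ⟧) + z * (eval p z + eval q z)
          ≈⟨ solve 5 (λ x y z p q → (x :+ y) :+ z :* (p :+ q)
          := (x :+ z :* p) :+ (y :+ z :* q)) refl ⟦ x ⟧ ⟦ y ⟧ z (eval p z) (eval q z) ⟩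
      (⟦ x ⟧ + z * eval p z) + (⟦ y ⟧ + z * eval q z)    ∎

    eval-· : ∀ x p z → eval (x ·ₚ p) z ≈ ⟦ x ⟧ * eval p z
    eval-· x []      z = sym (zeroʳ _)
    eval-· x (y ∷ p) z = begin
      ⟦ x R.* y ⟧ + z * eval (x ·ₚ p) z          ≈⟨ +-cong (*-homo x y) (*-congˡ (eval-· x p z)) ⟩
      ⟦ x ⟧ * ⟦ y ⟧ + z * (⟦ x ⟧ * eval p z)
          ≈⟨ solve 4 (λ x y z p → x :* y :+ z :* (x :* p) := x :* (y :+ z :* p)) refl ⟦ x ⟧ ⟦ y ⟧ z (eval p z) ⟩
      ⟦ x ⟧ * (⟦ y ⟧ + z * eval p z)              ∎

    eval-neg : ∀ p z → eval (map R.-_ p) z ≈ - eval p z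
    eval-neg []      z = sym -0#≈0#
    eval-neg (x ∷ p) z = begin
      ⟦ R.- x ⟧ + z * eval (map R.-_ p) z        ≈⟨ +-cong (-‿homo x) (*-congˡ (eval-neg p z)) ⟩
      - ⟦ x ⟧ + z * - eval p z
          ≈⟨ solve 3 (λ x z p → :- x :+ z :* :- p := :- (x :+ z :* p)) refl ⟦ x ⟧ z (eval p z) ⟩
      - (⟦ x ⟧ + z * eval p z)                   ∎

    eval-- : ∀ p q z → eval (p -ₚ q) z ≈ eval p z - eval q z
    eval-- p q z = trans (eval-+ p _ z) (+-congˡ (eval-neg q z))

    eval-linear* : ∀ a b p z → eval ((a ∷ b ∷ []) *ₚ p) z ≈ (⟦ a ⟧ + z * ⟦ b ⟧) * eval p z
    eval-linear* a b p z = begin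
      eval ((a ∷ b ∷ []) *ₚ p) z
        ≈⟨ eval-+ (a ·ₚ p) _ z ⟩
      eval (a ·ₚ p) z + (⟦ R.0# ⟧ + z * eval (b ·ₚ p +ₚ (R.0# ∷ [])) z)
        ≈⟨ +-cong (eval-· a p z) (+-cong 0-homo (*-congˡ (trans (eval-+ (b ·ₚ p) _ z) (+-cong (eval-· b p z)
            (+-congʳ 0-homo))))) ⟩
      ⟦ a ⟧ * eval p z + (0# + z * (⟦ b ⟧ * eval p z + (0# + z * 0#)))
        ≈⟨ +-congˡ (trans (+-identityˡ _) (*-congˡ (trans (+-congˡ (trans (+-identityˡ _) (zeroʳ z)))
            (+-identityʳ _)))) ⟩
      ⟦ a ⟧ * eval p z + z * (⟦ b ⟧ * eval p z)
        ≈⟨ solve 4 (λ a b z p → a :* p :+ z :* (b :* p) := (a :+ z :* b) :* p) refl ⟦ a ⟧ ⟦ b ⟧ z (eval p z) ⟩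
      (⟦ a ⟧ + z * ⟦ b ⟧) * eval p z ∎

    eval-X-const* : ∀ a p z → eval ((X -ₚ const a) *ₚ p) z ≈ (z - ⟦ a ⟧) * eval p z
    eval-X-const* a p z = trans (eval-linear* (R.0# R.+ R.- a) R.1# p z) (*-congʳ (begin
      ⟦ R.0# R.+ R.- a ⟧ + z * ⟦ R.1# ⟧   ≈⟨ +-cong (trans (h-cong (R.+-identityˡ _)) (-‿homo a)) (*-congˡ 1-homo) ⟩
      - ⟦ a ⟧ + z * 1#                    ≈⟨ trans (+-congˡ (*-identityʳ z)) (+-comm _ _) ⟩
      z - ⟦ a ⟧                           ∎))

  module Factorization {c ℓ} (𝓡 : RawRing c ℓ) (isR : IsCR 𝓡)
    (ι : ℤ.+-*-rawRing -Raw-AlmostCommutative⟶ fromCommutativeRing (bundle 𝓡 isR)) where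

    open CommutativeRing (bundle 𝓡 isR)
    open Polynomials 𝓡
    open Coefficients 𝓡 isR
    open Relation.Binary.Reasoning.Setoid setoid
    open RingSolver (bundle 𝓡 isR) ι using (solve; _:+_; _:*_; :-_; _:-_; _:=_; con)

    identity-homomorphism : 𝓡 -Raw-AlmostCommutative⟶ fromCommutativeRing (bundle 𝓡 isR)
    identity-homomorphism = record
      { ⟦_⟧ = id ; +-homo = λ _ _ → refl ; *-homo = λ _ _ → refl ; -‿homo = λ _ → refl ; 0-homo = refl ; 1-homo =
          refl }

    open Evaluation 𝓡 isR (bundle 𝓡 isR) identity-homomorphism id ι

    -- Horner's scheme: coefficient k of the quotient by `X - r` is the value at `r` of the list `p`
    -- with its first k + 1 entries removed. The list keeps the length of `p`, so for nonempty `p`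
    -- its last entry is a trailing zero.
    quotient : Carrier → Poly → Poly
    quotient r []      = []
    quotient r (x ∷ p) = eval p r ∷ quotient r p

    eval-quotient : ∀ r p s → eval p s ≈ (s - r) * eval (quotient r p) s + eval p r
    eval-quotient r []      s = sym (trans (+-identityʳ _) (zeroʳ _))
    eval-quotient r (x ∷ p) s = begin
      x + s * eval p s
        ≈⟨ +-congˡ (*-congˡ (eval-quotient r p s)) ⟩
      x + s * ((s - r) * eval (quotient r p) s + eval p r)
        ≈⟨ solve 5 (λ x s r q p → x :+ s :* ((s :- r) :* q :+ p)
            := (s :- r) :* (p :+ s :* q) :+ (x :+ r :* p)) refl x s r (eval (quotient r p) s) (eval p r) ⟩
      (s - r) * (eval p r + s * eval (quotient r p) s) + (x + r * eval p r) ∎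

    coeff-quotient-zero : ∀ r p → coeff p 0 ≈ - r * coeff (quotient r p) 0 + eval p r
    coeff-quotient-zero r []      = sym (trans (+-identityʳ _) (zeroʳ _))
    coeff-quotient-zero r (x ∷ p) = solve 3 (λ r x p → x := :- r :* p :+ (x :+ r :* p)) refl r x (eval p r)

    coeff-quotient-suc : ∀ r p k → coeff p (suc k) ≈ - r * coeff (quotient r p) (suc k) + coeff (quotient r p) k
    coeff-quotient-suc r []      k       = sym (trans (+-identityʳ _) (zeroʳ _))
    coeff-quotient-suc r (x ∷ p) zero    = coeff-quotient-zero r p
    coeff-quotient-suc r (x ∷ p) (suc k) = coeff-quotient-suc r p k

    quotient-constant : ∀ r p → (∀ k → coeff p (suc k) ≈ 0#) → ∀ k → coeff (quotient r p) k ≈ 0#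
    quotient-constant r []          p≈ k       = refl
    quotient-constant r (x ∷ p)     p≈ zero    = eval-zero p r p≈
    quotient-constant r (x ∷ [])    p≈ (suc k) = refl
    quotient-constant r (x ∷ y ∷ p) p≈ (suc k) = quotient-constant r (y ∷ p) (λ k → p≈ (suc k)) k

    quotient-monic : ∀ r n p → Monic (suc n) p → Monic n (quotient r p)
    -- The empty list is monic only if 0 ≈ 1; `lead` is exactly that equation, and it is also the
    -- goal.
    quotient-monic r n []      (lead , _) = lead , λ _ _ → refl
    quotient-monic r zero (x ∷ p) (lead , high) = (begin
        eval p r                       ≈⟨ eval-congˡ p 1ₚ r p≈1 ⟩
        1# + r * 0#                    ≈⟨ trans (+-congˡ (zeroʳ r)) (+-identityʳ 1#) ⟩
        1#                             ∎)
      , λ { (suc k) _ → quotient-constant r p (λ k → high (suc (suc k)) (s≤s (s≤s z≤n))) k }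
      where
      p≈1 : p ≈ₚ 1ₚ
      p≈1 zero    = lead
      p≈1 (suc k) = high (suc (suc k)) (s≤s (s≤s z≤n))
    quotient-monic r (suc n) (x ∷ p) (lead , high) with quotient-monic r n p (lead , λ k l → high (suc k) (s≤s l))
    ... | lead′ , high′ = lead′ , λ { (suc k) (s≤s l) → high′ k l }

    factor : ∀ r p → eval p r ≈ 0# → p ≈ₚ (X -ₚ const r) *ₚ quotient r p
    factor r p pr≈0 zero = begin
      coeff p 0                                               ≈⟨ coeff-quotient-zero r p ⟩
      - r * coeff (quotient r p) 0 + eval p r                 ≈⟨ trans (+-congˡ pr≈0) (+-identityʳ _) ⟩
      - r * coeff (quotient r p) 0                            ≈⟨ *-congʳ (+-identityˡ _) ⟨
      (0# + - r) * coeff (quotient r p) 0                     ≈⟨ coeff-linear*-zero (0# + - r) 1# (quotient r p) ⟨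
      coeff ((X -ₚ const r) *ₚ quotient r p) 0                ∎
    factor r p pr≈0 (suc k) = begin
      coeff p (suc k)                                                             ≈⟨ coeff-quotient-suc r p k ⟩
      - r * coeff (quotient r p) (suc k) + coeff (quotient r p) k
          ≈⟨ +-cong (*-congʳ (+-identityˡ _)) (*-identityˡ _) ⟨
      (0# + - r) * coeff (quotient r p) (suc k) + 1# * coeff (quotient r p) k
          ≈⟨ coeff-linear*-suc (0# + - r) 1# (quotient r p) k ⟨
      coeff ((X -ₚ const r) *ₚ quotient r p) (suc k)                              ∎

    -- The relation stands for apartness of roots: all that is asked of it is that the difference of
    -- two related roots can be cancelled, which needs neither inverses nor decidable equality.
    module _ {a} (_⊳_ : Carrier → Carrier → Set a)
      (cancel : ∀ {r s x} → r ⊳ s → (s - r) * x ≈ 0# → x ≈ 0#) where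

      -- Once `X - r` is divided off, each later root s still annihilates the quotient, because
      -- `s - r` cancels. Monicity forces the constant left at the end to be 1.
      factorize : ∀ rs p → Monic (length rs) p → All (λ r → eval p r ≈ 0#) rs → AllPairs _⊳_ rs →
                  p ≈ₚ linearFactors rs
      factorize [] p (lead , high) _ _ zero    = lead
      factorize [] p (lead , high) _ _ (suc k) = high (suc k) (s≤s z≤n)
      factorize (r ∷ rs) p monic (root ∷ roots) (apart ∷ aparts) k =
        trans (factor r p root k)
          (linear*-congʳ (0# + - r) 1# (quotient r p) (linearFactors rs)
            (factorize rs (quotient r p) (quotient-monic r (length rs) p monic)
              (All.zipWith quotient-root (apart , roots)) aparts) k)
        where
        quotient-root : ∀ {s} → r ⊳ s × eval p s ≈ 0# → eval (quotient r p) s ≈ 0#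
        quotient-root {s} (r⊳s , ps≈0) = cancel r⊳s (begin
          (s - r) * eval (quotient r p) s               ≈⟨ +-identityʳ _ ⟨
          (s - r) * eval (quotient r p) s + 0#          ≈⟨ +-congˡ root ⟨
          (s - r) * eval (quotient r p) s + eval p r    ≈⟨ eval-quotient r p s ⟨
          eval p s                                      ≈⟨ ps≈0 ⟩
          0#                                            ∎)

  module FactoredZeros {c ℓ c′ ℓ′} (𝓡 : RawRing c ℓ) (isR : IsCR 𝓡) (A : CommutativeRing c′ ℓ′)
    (ι : ℤ.+-*-rawRing -Raw-AlmostCommutative⟶ fromCommutativeRing (bundle 𝓡 isR))
    (ιᴬ : ℤ.+-*-rawRing -Raw-AlmostCommutative⟶ fromCommutativeRing A)
    (h : 𝓡 -Raw-AlmostCommutative⟶ fromCommutativeRing A)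
    (h-cong : Respects 𝓡 A h)
    where

    private module A = CommutativeRing A
    open CommutativeRing (bundle 𝓡 isR)
    open Polynomials 𝓡
    open Coefficients 𝓡 isR
    open _-Raw-AlmostCommutative⟶_ h
    open Evaluation 𝓡 isR A h h-cong ιᴬ
    open RingSolver (bundle 𝓡 isR) ι using (solve; _:+_; _:*_; _:=_; con)
    open Relation.Binary.Reasoning.Setoid setoid

    power : Carrier → ℕ → Carrier
    power x zero    = 1#
    power x (suc k) = x * power x k

    module _ (reduced : ∀ {x} → x * x ≈ 0# → x ≈ 0#) where

      -- If `x^(k+2)` vanishes, so does the square of `x^(k+1)`, since it is a multiple of
      -- `x^(k+2)`; reducedness then lowers the exponent by one.
      power≈0⇒≈0 : ∀ x k → power x k ≈ 0# → x ≈ 0#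
      power≈0⇒≈0 x zero 1≈0 = begin
        x        ≈⟨ *-identityʳ x ⟨
        x * 1#   ≈⟨ *-congˡ 1≈0 ⟩
        x * 0#   ≈⟨ zeroʳ x ⟩
        0#       ∎
      power≈0⇒≈0 x (suc zero)    eq = trans (sym (*-identityʳ x)) eq
      power≈0⇒≈0 x (suc (suc k)) eq = power≈0⇒≈0 x (suc k) (reduced (begin
        x * power x k * (x * power x k)
            ≈⟨ solve 2 (λ x z → (x :* z) :* (x :* z) := x :* (x :* z) :* z) refl x (power x k) ⟩
        x * (x * power x k) * power x k      ≈⟨ *-congʳ eq ⟩
        0# * power x k                       ≈⟨ zeroˡ _ ⟩
        0#                                   ∎))

      -- Over ℂ, `norm z` is `|z|²` and `y z` is `(im z)²`. The hypothesis `shrink` is the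
      -- inequality `(im z)² ≤ |z - r|²` in the form in which it is used: one factor of a vanishing
      -- product is replaced by a smaller one. The coefficient c collects the factors already
      -- replaced.
      module _ (norm y : A.Carrier → Carrier)
        (norm-cong : ∀ {w z} → w A.≈ z → norm w ≈ norm z)
        (norm-* : ∀ w z → norm (w A.* z) ≈ norm w * norm z)
        (norm-1 : norm A.1# ≈ 1#)
        {p} (NonNeg : Carrier → Set p)
        (nonNeg-* : ∀ c z → NonNeg c → NonNeg (c * y z))
        (shrink : ∀ c z r w → NonNeg c → c * (norm (z A.- ⟦ r ⟧) * norm w) ≈ 0# → c * y z * norm w ≈ 0#) where

        -- Each factor satisfies |z - r|² ≥ y z, whence |∏(z - r)|² ≥ (y z)ᵏ.
        norm-bound : ∀ rs z c → NonNeg c → c * norm (eval (linearFactors rs) z) ≈ 0# → c * power (y z)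
            (length rs) ≈ 0#
        norm-bound [] z c 0≤c eq = begin
          c * 1#                  ≈⟨ *-congˡ norm-1 ⟨
          c * norm A.1#           ≈⟨ *-congˡ (norm-cong (A.trans (A.+-cong 1-homo (A.zeroʳ z))
              (A.+-identityʳ A.1#))) ⟨
          c * norm (eval 1ₚ z)    ≈⟨ eq ⟩
          0#                      ∎
        norm-bound (r ∷ rs) z c 0≤c eq = begin
          c * (y z * power (y z) (length rs))    ≈⟨ *-assoc c (y z) _ ⟨
          c * y z * power (y z) (length rs)
              ≈⟨ norm-bound rs z (c * y z) (nonNeg-* c z 0≤c) (shrink c z r w 0≤c (begin
            c * (norm (z A.- ⟦ r ⟧) * norm w)       ≈⟨ *-congˡ (norm-* (z A.- ⟦ r ⟧) w) ⟨
            c * norm ((z A.- ⟦ r ⟧) A.* w)          ≈⟨ *-congˡ (norm-cong (eval-X-const* r (linearFactors rs) z)) ⟨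
            c * norm (eval (linearFactors (r ∷ rs)) z) ≈⟨ eq ⟩
            0#                                      ∎)) ⟩
          0#                                     ∎
          where
          w : A.Carrier
          w = eval (linearFactors rs) z

        factored-zero : NonNeg 1# → norm A.0# ≈ 0# → ∀ f rs z → f ≈ₚ linearFactors rs → eval f z A.≈ A.0# → y z ≈ 0#
        factored-zero 0≤1 norm-0 f rs z f≈ fz≈0 = power≈0⇒≈0 (y z) (length rs) (begin
          power (y z) (length rs)             ≈⟨ *-identityˡ _ ⟨
          1# * power (y z) (length rs)        ≈⟨ norm-bound rs z 1# 0≤1 (begin
            1# * norm (eval (linearFactors rs) z)    ≈⟨ *-identityˡ _ ⟩
            norm (eval (linearFactors rs) z)
                ≈⟨ norm-cong (A.trans (A.sym (eval-congˡ f (linearFactors rs) z f≈)) fz≈0) ⟩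
            norm A.0#                                ≈⟨ norm-0 ⟩
            0#                                       ∎) ⟩
          0#                                  ∎)

-- Sign changes and strict interlacing for the sequence Q(m).

module SturmSequence where

  open import Algebra.Bundles using (CommutativeRing; RawRing)
  import Algebra.Properties.Ring
  open import Algebra.Solver.Ring.AlmostCommutativeRing using (fromCommutativeRing; _-Raw-AlmostCommutative⟶_)
  open import Data.Integer.Base as ℤ using (ℤ; +_; -[1+_])
  import Data.Integer.Properties as ℤ
  open import Data.List.Base using (List; []; _∷_; length; map)
  open import Data.List.Relation.Unary.All as All using (All; []; _∷_)
  open import Data.List.Relation.Unary.AllPairs using (AllPairs; []; _∷_)
  open import Data.Nat.Base as ℕ using (ℕ; zero; suc; s≤s)
  import Data.Nat.Properties as ℕ
  open import Data.Product.Base using (∃-syntax; _×_; _,_; proj₁; proj₂)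
  open import Defs using (module Polynomials; module ℤ[t])
  open import Function.Base using (id)
  open import Level using (0ℓ; _⊔_) renaming (suc to lsuc)
  open import Relation.Binary.PropositionalEquality as ≡ using (_≡_)
  import Relation.Binary.Reasoning.Setoid
  open PolynomialRings

  module ℤ-Coefficients = Coefficients ℤ.+-*-rawRing ℤ.+-*-isCommutativeRing

  -- Peakᶜ (m + 2) = t Q(m).
  Q : ℕ → ℤ[t].Poly
  Q zero          = + 1 ∷ []
  Q (suc zero)    = + 1 ∷ + 1 ∷ []
  Q (suc (suc m)) = (ℤ[t].X ℤ[t].+ₚ ℤ[t].const (+ 2)) ℤ[t].*ₚ Q (suc m) ℤ[t].-ₚ Q m

  coeff-step-suc : ∀ p q k →
    ℤ[t].coeff ((ℤ[t].X ℤ[t].+ₚ ℤ[t].const (+ 2)) ℤ[t].*ₚ p ℤ[t].-ₚ q) (suc k) ≡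
    + 2 ℤ.* ℤ[t].coeff p (suc k) ℤ.+ + 1 ℤ.* ℤ[t].coeff p k ℤ.- ℤ[t].coeff q (suc k)
  coeff-step-suc p q k = ≡.trans (ℤ-Coefficients.coeff-- ((+ 2 ∷ + 1 ∷ []) ℤ[t].*ₚ p) q (suc k))
    (≡.cong (ℤ._- ℤ[t].coeff q (suc k)) (ℤ-Coefficients.coeff-linear*-suc (+ 2) (+ 1) p k))

  coeff-step-zero : ∀ p q →
    ℤ[t].coeff ((ℤ[t].X ℤ[t].+ₚ ℤ[t].const (+ 2)) ℤ[t].*ₚ p ℤ[t].-ₚ q) 0 ≡
    + 2 ℤ.* ℤ[t].coeff p 0 ℤ.- ℤ[t].coeff q 0
  coeff-step-zero p q = ≡.trans (ℤ-Coefficients.coeff-- ((+ 2 ∷ + 1 ∷ []) ℤ[t].*ₚ p) q 0)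
    (≡.cong (ℤ._- ℤ[t].coeff q 0) (ℤ-Coefficients.coeff-linear*-zero (+ 2) (+ 1) p))

  Q-monic : ∀ m → ℤ-Coefficients.Monic m (Q m)
  Q-monic zero       = ≡.refl , λ { (suc k) _ → ≡.refl }
  Q-monic (suc zero) = ≡.refl , λ { (suc (suc k)) _ → ≡.refl ; (suc zero) (s≤s ()) }
  Q-monic (suc (suc m)) with Q-monic m | Q-monic (suc m)
  ... | _ , high₀ | lead₁ , high₁ = lead , high
    where
    coeff-suc : ∀ k {x y z} → ℤ[t].coeff (Q (suc m)) (suc k) ≡ x → ℤ[t].coeff (Q (suc m)) k ≡ y →
                ℤ[t].coeff (Q m) (suc k) ≡ z → ℤ[t].coeff (Q (suc (suc m))) (suc k) ≡ + 2 ℤ.* x ℤ.+ + 1 ℤ.* y ℤ.- z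
    coeff-suc k ≡.refl ≡.refl ≡.refl = coeff-step-suc (Q (suc m)) (Q m) k

    lead : ℤ[t].coeff (Q (suc (suc m))) (suc (suc m)) ≡ + 1
    lead = coeff-suc (suc m) (high₁ (suc (suc m)) ℕ.≤-refl) lead₁ (high₀ (suc (suc m)) (ℕ.n≤1+n (suc m)))

    high : ∀ k → suc (suc m) ℕ.< k → ℤ[t].coeff (Q (suc (suc m))) k ≡ + 0
    high (suc k) (s≤s l) = coeff-suc k (high₁ (suc k) (ℕ.m≤n⇒m≤1+n l)) (high₁ k l)
      (high₀ (suc k) (ℕ.m≤n⇒m≤1+n (ℕ.<⇒≤ l)))

  -- Strict positivity is the only order used in the sign argument. Trichotomy is not among the
  -- axioms, because it cannot be decided for Cauchy reals; `pos-cancel` recovers a sign from a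
  -- product instead.
  record Positivity {c ℓ} (𝓡 : RawRing c ℓ) : Set (lsuc 0ℓ ⊔ c ⊔ ℓ) where
    open RawRing 𝓡
    field
      Pos          : Carrier → Set
      pos-resp     : ∀ {x y} → x ≈ y → Pos x → Pos y
      pos-1        : Pos 1#
      pos-+        : ∀ {x y} → Pos x → Pos y → Pos (x + y)
      pos-*        : ∀ {x y} → Pos x → Pos y → Pos (x * y)
      pos-cancel-≈ : ∀ {x y} → Pos x → x * y ≈ 0# → y ≈ 0#
      pos-cancel   : ∀ {x y} → Pos x → Pos (x * y) → Pos y

    _≺_ : Carrier → Carrier → Set
    x ≺ y = Pos (y + - x)

  module Sturm {c ℓ} (𝓡 : RawRing c ℓ) (isR : IsCR 𝓡) (positivity : Positivity 𝓡)
    (ι : ℤ.+-*-rawRing -Raw-AlmostCommutative⟶ fromCommutativeRing (bundle 𝓡 isR)) where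

    open CommutativeRing (bundle 𝓡 isR)
    open Positivity positivity
    open Relation.Binary.Reasoning.Setoid setoid
    open Polynomials 𝓡
    open Coefficients 𝓡 isR
    open Factorization 𝓡 isR ι
    open RingSolver (bundle 𝓡 isR) ι using (solve; _:+_; _:*_; :-_; _:-_; _:=_; con)
    open _-Raw-AlmostCommutative⟶_ ι renaming (⟦_⟧ to ⟦_⟧ᵢ)
    private
      module Evᵣ = Evaluation 𝓡 isR (bundle 𝓡 isR) identity-homomorphism id ι
      module Evᵢ = Evaluation ℤ.+-*-rawRing ℤ.+-*-isCommutativeRing (bundle 𝓡 isR) ι (λ eq → reflexive
          (≡.cong ⟦_⟧ᵢ eq)) ι
    open Evᵢ using (eval)

    ≺-trans : ∀ {x y z} → x ≺ y → y ≺ z → x ≺ z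
    ≺-trans {x} {y} {z} p q = pos-resp (solve 3 (λ x y z → (y :- x) :+ (z :- y) := z :- x) refl x y z) (pos-+ p q)

    ≺-cancel : ∀ {r s x} → s ≺ r → (s - r) * x ≈ 0# → x ≈ 0#
    ≺-cancel {r} {s} {x} s≺r eq = pos-cancel-≈ s≺r (begin
      (r - s) * x      ≈⟨ solve 3 (λ r s x → (r :- s) :* x := :- ((s :- r) :* x)) refl r s x ⟩
      - ((s - r) * x)  ≈⟨ -‿cong eq ⟩
      - 0#             ≈⟨ -0#≈0# ⟩
      0#               ∎)
      where open Algebra.Properties.Ring ring using (-0#≈0#)

    toR : ℤ[t].Poly → Poly
    toR = map ⟦_⟧ᵢ

    coeff-toR : ∀ p k → coeff (toR p) k ≈ ⟦ ℤ[t].coeff p k ⟧ᵢ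
    coeff-toR []      k       = sym 0-homo
    coeff-toR (x ∷ p) zero    = refl
    coeff-toR (x ∷ p) (suc k) = coeff-toR p k

    eval-toR : ∀ p z → Evᵣ.eval (toR p) z ≡ eval p z
    eval-toR []      z = ≡.refl
    eval-toR (x ∷ p) z = ≡.cong (λ y → ⟦ x ⟧ᵢ + z * y) (eval-toR p z)

    Q-monicᵣ : ∀ m → Monic m (toR (Q m))
    Q-monicᵣ m with Q-monic m
    ... | lead , high = trans (coeff-toR (Q m) m) (trans (reflexive (≡.cong ⟦_⟧ᵢ lead)) 1-homo)
      , λ k m<k → trans (coeff-toR (Q m) k) (trans (reflexive (≡.cong ⟦_⟧ᵢ (high k m<k))) 0-homo)

    module _ (p : ℤ[t].Poly) (m : ℕ) (p≈ : p ℤ[t].≈ₚ + 0 ∷ Q m)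
      (f : Poly) (f≈ : ∀ k → coeff f k ≈ ⟦ ℤ[t].coeff p k ⟧ᵢ) where

      private
        f≈toR : f ≈ₚ ⟦ + 0 ⟧ᵢ ∷ toR (Q m)
        f≈toR k = trans (f≈ k) (trans (reflexive (≡.cong ⟦_⟧ᵢ (p≈ k))) (sym (coeff-toR (+ 0 ∷ Q m) k)))

      shifted-factors : ∀ z zs → z ≈ 0# → toR (Q m) ≈ₚ linearFactors zs → f ≈ₚ linearFactors (z ∷ zs)
      shifted-factors z zs z≈0 factors k = trans (f≈toR k) (trans (zero-head k) (shift-linearFactors (toR
          (Q m)) z zs z≈0 factors k))
        where
        zero-head : ∀ k → coeff (⟦ + 0 ⟧ᵢ ∷ toR (Q m)) k ≈ coeff (0# ∷ toR (Q m)) k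
        zero-head zero    = 0-homo
        zero-head (suc k) = refl

      shifted-leading : Pos (coeff f (suc m)) × (∀ k → suc m ℕ.< k → coeff f k ≈ 0#)
      shifted-leading =
          pos-resp (sym (trans (f≈toR (suc m)) (proj₁ (Q-monicᵣ m)))) pos-1
        , λ { (suc k) (s≤s l) → trans (f≈toR (suc k)) (proj₂ (Q-monicᵣ m) k l) }

    eval-Q : ∀ m z → eval (Q (suc (suc m))) z ≈ (⟦ + 2 ⟧ᵢ + z) * eval (Q (suc m)) z - eval (Q m) z
    eval-Q m z = trans (Evᵢ.eval-- ((+ 2 ∷ + 1 ∷ []) ℤ[t].*ₚ Q (suc m)) (Q m) z) (+-congʳ (trans (Evᵢ.eval-linear*
        (+ 2) (+ 1) (Q (suc m)) z)
      (*-congʳ (+-congˡ (trans (*-congˡ 1-homo) (*-identityʳ z))))))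

    -- The factored form is kept because its sign at a point can be read off from the position of
    -- that point among the roots.
    prod : List Carrier → Carrier → Carrier
    prod []       x = 1#
    prod (z ∷ zs) x = (x - z) * prod zs x

    eval-linearFactors : ∀ zs x → Evᵣ.eval (linearFactors zs) x ≈ prod zs x
    eval-linearFactors []       x = trans (+-congˡ (zeroʳ x)) (+-identityʳ 1#)
    eval-linearFactors (z ∷ zs) x = trans (Evᵣ.eval-X-const* z (linearFactors zs) x) (*-congˡ
        (eval-linearFactors zs x))

    bottom : Carrier
    bottom = ⟦ -[1+ 3 ] ⟧ᵢ

    -- u > r₁ > s₁ > r₂ > s₂ > … > rₘ > -4
    data Chain : Carrier → List Carrier → List Carrier → Set c where
      last : ∀ {u r} → r ≺ u → bottom ≺ r → Chain u (r ∷ []) []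
      link : ∀ {u r s rs ss} → r ≺ u → s ≺ r → Chain s rs ss → Chain u (r ∷ rs) (s ∷ ss)

    chain-length : ∀ {u rs ss} → Chain u rs ss → length rs ≡ suc (length ss)
    chain-length (last _ _)   = ≡.refl
    chain-length (link _ _ c) = ≡.cong suc (chain-length c)

    chain-below : ∀ {u v rs ss} → Chain u rs ss → u ≺ v → All (_≺ v) rs
    chain-below (last r≺u _)       u≺v = ≺-trans r≺u u≺v ∷ []
    chain-below (link r≺u s≺r c) u≺v = ≺-trans r≺u u≺v ∷ chain-below c (≺-trans s≺r (≺-trans r≺u u≺v))

    chain-descending : ∀ {u rs ss} → Chain u rs ss → AllPairs (λ r s → s ≺ r) rs
    chain-descending (last _ _)     = [] ∷ []
    chain-descending (link _ s≺r c) = chain-below c s≺r ∷ chain-descending c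

    prod-above : ∀ {u v rs ss} → Chain u rs ss → u ≺ v → Pos (prod ss v)
    prod-above (last _ _)       u≺v = pos-1
    prod-above (link r≺u s≺r c) u≺v = pos-* s≺v (prod-above c s≺v)
      where s≺v = ≺-trans s≺r (≺-trans r≺u u≺v)

    -- For u > r₁ > … > rₘ > -4: φ changes sign between consecutive points, except
    -- that P decides the last pair.
    data Alternating (P : Carrier → Set) (φ : Carrier → Carrier) : Carrier → List Carrier → Set c where
      end  : ∀ {u} → bottom ≺ u → P (φ u * φ bottom) → Alternating P φ u []
      step : ∀ {u r rs} → r ≺ u → Pos (- (φ u * φ r)) → Alternating P φ r rs → Alternating P φ u (r ∷ rs)

    Neg : Carrier → Set
    Neg x = Pos (- x)

    -- All points of the pattern, -4 included, lie below s, so the new factor is negative at each of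
    -- them and the sign of a product of two consecutive values is unchanged.
    alternating-* : ∀ {φ s u rs} → u ≺ s → Alternating Pos φ u rs → Alternating Pos (λ x → (x - s) * φ x) u rs
    alternating-* {φ} {s} {u} u≺s (end b≺u p) = end b≺u (pos-resp
      (solve 5 (λ s u b p q → (s :- u) :* (s :- b) :* (p :* q)
          := ((u :- s) :* p) :* ((b :- s) :* q)) refl s u bottom (φ u) (φ bottom))
      (pos-* (pos-* u≺s (≺-trans b≺u u≺s)) p))
    alternating-* {φ} {s} {u} u≺s (step {r = r} r≺u p a) = step r≺u (pos-resp
      (solve 5 (λ s u b p q → (s :- u) :* (s :- b) :* (:- (p :* q))
          := :- (((u :- s) :* p) :* ((b :- s) :* q))) refl s u r (φ u) (φ r))
      (pos-* (pos-* u≺s (≺-trans r≺u u≺s)) p)) (alternating-* (≺-trans r≺u u≺s) a)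

    -- Exactly one s lies between consecutive r, and none between the last r and -4, which is why
    -- the last pair has equal signs. In the induction the new factor `x - s` is positive at the
    -- first r and negative at all later points.
    prod-alternating : ∀ {u r rs ss} → Chain u (r ∷ rs) ss → Alternating Pos (prod ss) r rs × Pos (prod ss r)
    prod-alternating (last _ b≺r) = end b≺r (pos-* pos-1 pos-1) , pos-1
    prod-alternating {r = r} (link {s = s} {ss = ss} _ s≺r c) = extend c
      where
      multiply : ∀ {r′ rs} → Chain s (r′ ∷ rs) ss → r′ ≺ s → Alternating Pos (prod (s ∷ ss)) r (r′ ∷ rs) × Pos (prod
          (s ∷ ss) r)
      multiply {r′} c r′≺s with prod-alternating c
      ... | a , p = step (≺-trans r′≺s s≺r) (pos-resp
          (solve 5 (λ s r r′ p q → (r :- s) :* (s :- r′) :* (p :* q)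
              := :- (((r :- s) :* p) :* ((r′ :- s) :* q))) refl s r r′ (prod ss r) (prod ss r′))
          (pos-* (pos-* s≺r r′≺s) (pos-* (prod-above c s≺r) p))) (alternating-* r′≺s a)
        , pos-* s≺r (prod-above c s≺r)
      extend : ∀ {rs} → Chain s rs ss → Alternating Pos (prod (s ∷ ss)) r rs × Pos (prod (s ∷ ss) r)
      extend c@(last r′≺s _)   = multiply c r′≺s
      extend c@(link r′≺s _ _) = multiply c r′≺s

    module _ {φ ψ : Carrier → Carrier} {a b} (0<a : Pos a) (0<b : Pos b)
      (at-bottom : a * ψ bottom ≈ b * φ bottom) where

      -- Negating the values at all the listed points leaves products of neighbours unchanged. At -4
      -- the sign is not negated, since `ψ` is there a positive multiple of `φ`, so the last pair
      -- turns from equal into opposite signs. This accounts for the additional zero near -4.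
      alternating-flip : ∀ {u rs} → All (λ r → ψ r ≈ - φ r) (u ∷ rs) → Alternating Pos φ u rs → Alternating Neg ψ u rs
      alternating-flip {u} (eq ∷ []) (end b≺u p) = end b≺u (pos-cancel 0<a (pos-resp (begin
        b * (φ u * φ bottom)         ≈⟨ solve 3 (λ b p q → b :* (p :* q) := p :* (b :* q)) refl b (φ u) (φ bottom) ⟩
        φ u * (b * φ bottom)         ≈⟨ *-congˡ at-bottom ⟨
        φ u * (a * ψ bottom)
            ≈⟨ solve 3 (λ a p q → p :* (a :* q) := a :* (:- ((:- p) :* q))) refl a (φ u) (ψ bottom) ⟩
        a * - (- φ u * ψ bottom)     ≈⟨ *-congˡ (-‿cong (*-congʳ eq)) ⟨
        a * - (ψ u * ψ bottom)       ∎) (pos-* 0<b p)))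
      alternating-flip {u} (eq ∷ eqs@(eq′ ∷ _)) (step {r = r} r≺u p a) = step r≺u (pos-resp (begin
        - (φ u * φ r)                ≈⟨ solve 2 (λ p q → :- (p :* q) := :- ((:- p) :* (:- q))) refl (φ u) (φ r) ⟩
        - (- φ u * - φ r)            ≈⟨ -‿cong (*-cong eq eq′) ⟨
        - (ψ u * ψ r)                ∎) p) (alternating-flip eqs a)

    eval-Q₀ : ∀ z → eval (Q 0) z ≈ ⟦ + 1 ⟧ᵢ
    eval-Q₀ z = trans (+-congˡ (zeroʳ z)) (+-identityʳ _)

    eval-Q₁ : ∀ z → eval (Q 1) z ≈ ⟦ + 1 ⟧ᵢ + z * ⟦ + 1 ⟧ᵢ
    eval-Q₁ z = +-congˡ (*-congˡ (eval-Q₀ z))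

    top : Carrier
    top = ⟦ + 0 ⟧ᵢ

    eval-Q-top : ∀ m → eval (Q m) top ≈ ⟦ + 1 ⟧ᵢ
    eval-Q-top zero          = eval-Q₀ top
    eval-Q-top (suc zero)    = trans (eval-Q₁ top) (solve 0 (con (+ 1) :+ con (+ 0) :* con (+ 1) := con (+ 1)) refl)
    eval-Q-top (suc (suc m)) = begin
      eval (Q (suc (suc m))) top                                           ≈⟨ eval-Q m top ⟩
      (⟦ + 2 ⟧ᵢ + top) * eval (Q (suc m)) top - eval (Q m) top
          ≈⟨ +-cong (*-congˡ (eval-Q-top (suc m))) (-‿cong (eval-Q-top m)) ⟩
      (⟦ + 2 ⟧ᵢ + top) * ⟦ + 1 ⟧ᵢ - ⟦ + 1 ⟧ᵢ
          ≈⟨ solve 0 ((con (+ 2) :+ con (+ 0)) :* con (+ 1) :- con (+ 1) := con (+ 1)) refl ⟩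
      ⟦ + 1 ⟧ᵢ                                                             ∎

    odd : ℕ → Carrier
    odd zero    = ⟦ + 1 ⟧ᵢ
    odd (suc m) = odd m + ⟦ + 2 ⟧ᵢ

    pos-ι1 : Pos ⟦ + 1 ⟧ᵢ
    pos-ι1 = pos-resp (sym 1-homo) pos-1

    pos-odd : ∀ m → Pos (odd m)
    pos-odd zero    = pos-ι1
    pos-odd (suc m) = pos-+ (pos-odd m) (pos-resp (solve 0 (con (+ 1) :+ con (+ 1)
        := con (+ 2)) refl) (pos-+ pos-ι1 pos-ι1))

    -- Here σ = (-1)ᵐ and odd m = 2m + 1.
    eval-Q-bottom : ∀ m → ∃[ σ ] eval (Q m) bottom ≈ σ * odd m × eval (Q (suc m)) bottom ≈ - (σ * odd (suc m))
    eval-Q-bottom zero = ⟦ + 1 ⟧ᵢ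
      , trans (eval-Q₀ bottom) (solve 0 (con (+ 1) := con (+ 1) :* con (+ 1)) refl)
      , trans (eval-Q₁ bottom) (solve 0 (con (+ 1) :+ con -[1+ 3 ] :* con (+ 1)
          := :- (con (+ 1) :* (con (+ 1) :+ con (+ 2)))) refl)
    eval-Q-bottom (suc m) with eval-Q-bottom m
    ... | σ , eq , eq′ = - σ
      , trans eq′ (solve 2 (λ s n → :- (s :* n) := :- s :* n) refl σ (odd (suc m)))
      , (begin
        eval (Q (suc (suc m))) bottom                                       ≈⟨ eval-Q m bottom ⟩
        (⟦ + 2 ⟧ᵢ + bottom) * eval (Q (suc m)) bottom - eval (Q m) bottom   ≈⟨ +-cong (*-congˡ eq′) (-‿cong eq) ⟩
        (⟦ + 2 ⟧ᵢ + bottom) * - (σ * odd (suc m)) - σ * odd m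
            ≈⟨ solve 2 (λ s n → (con (+ 2) :+ con -[1+ 3 ]) :* :- (s :* (n :+ con (+ 2))) :- s :* n
            := :- (:- s :* ((n :+ con (+ 2)) :+ con (+ 2)))) refl σ (odd m) ⟩
        - (- σ * odd (suc (suc m)))                                         ∎)

    -- Cross-multiplying by the positive odd numbers eliminates the sign σ, so Q(m + 2) and Q(m) are
    -- compared at -4 without a case distinction on the parity of m.
    eval-Q-bottom-ratio : ∀ m → odd m * eval (Q (suc (suc m))) bottom ≈ odd (suc (suc m)) * eval (Q m) bottom
    eval-Q-bottom-ratio m with eval-Q-bottom m | eval-Q-bottom (suc m)
    ... | σ , eq , eq′ | _ = begin
      odd m * eval (Q (suc (suc m))) bottom                                           ≈⟨ *-congˡ (eval-Q m bottom) ⟩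
      odd m * ((⟦ + 2 ⟧ᵢ + bottom) * eval (Q (suc m)) bottom - eval (Q m) bottom)
          ≈⟨ *-congˡ (+-cong (*-congˡ eq′) (-‿cong eq)) ⟩
      odd m * ((⟦ + 2 ⟧ᵢ + bottom) * - (σ * odd (suc m)) - σ * odd m)
          ≈⟨ solve 2 (λ s n → n :* ((con (+ 2) :+ con -[1+ 3 ]) :* :- (s :* (n :+ con (+ 2))) :- s :* n)
          := ((n :+ con (+ 2)) :+ con (+ 2)) :* (s :* n)) refl σ (odd m) ⟩
      odd (suc (suc m)) * (σ * odd m)                                                 ≈⟨ *-congˡ eq ⟨
      odd (suc (suc m)) * eval (Q m) bottom                                           ∎

    -- Only integer polynomials are required here: their values at rational points are rational, so
    -- bisection can decide signs.
    module _ (root-between : ∀ p {a b} → a ≺ b → Neg (eval p a * eval p b) →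
                             ∃[ r ] eval p r ≈ 0# × a ≺ r × r ≺ b) where

      -- Each sign change contributes one zero, and the points that separate the sign changes become
      -- the inner list of the new chain; strict betweenness is exactly what `Chain` asks for.
      roots : ∀ p {u rs} → Alternating Neg (eval p) u rs → ∃[ ts ] Chain u ts rs × All (λ t → eval p t ≈ 0#) ts
      roots p {u} (end b≺u neg) with root-between p b≺u (pos-resp (-‿cong (*-comm _ _)) neg)
      ... | t , pt≈0 , b≺t , t≺u = t ∷ [] , last t≺u b≺t , pt≈0 ∷ []
      roots p {u} (step r≺u neg a) with root-between p r≺u (pos-resp (-‿cong (*-comm _ _)) neg) | roots p a
      ... | t , pt≈0 , r≺t , t≺u | ts , chain , zeros = t ∷ ts , link t≺u r≺t chain , pt≈0 ∷ zeros

      -- The factorization of Q(m) is carried along because the next step needs its signs at the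
      -- zeros of Q(m + 1), which are irrational in general and accessible only through the factors.
      record Interlacing (m : ℕ) : Set (c ⊔ ℓ) where
        field
          rs ss   : List Carrier
          chain   : Chain top rs ss
          length≡ : length rs ≡ suc m
          zeros   : All (λ r → eval (Q (suc m)) r ≈ 0#) rs
          factors-rs : toR (Q (suc m)) ≈ₚ linearFactors rs
          factors-ss : toR (Q m) ≈ₚ linearFactors ss

      factorize-Q : ∀ m {rs ss} → Chain top rs ss → length rs ≡ suc m → All (λ r → eval (Q (suc m)) r ≈ 0#) rs →
                    toR (Q (suc m)) ≈ₚ linearFactors rs
      factorize-Q m {rs} chain len zeros = factorize (λ r s → s ≺ r) ≺-cancel rs (toR (Q (suc m)))
        (≡.subst (λ n → Monic n (toR (Q (suc m)))) (≡.sym len) (Q-monicᵣ (suc m)))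
        (All.map (λ {r} → trans (reflexive (eval-toR (Q (suc m)) r))) zeros)
        (chain-descending chain)

      -- At a zero of Q(m + 1) the recurrence leaves -Q(m), whose sign is known from the factors.
      -- The top interval is separate, since 0 is not such a zero: there Q(m + 2) equals 1 at 0 and
      -- is negative at the first r, to the right of all s.
      alternating-next : ∀ m {rs ss} → Chain top rs ss → All (λ r → eval (Q (suc m)) r ≈ 0#) rs → toR
          (Q m) ≈ₚ linearFactors ss →
                         Alternating Neg (eval (Q (suc (suc m)))) top rs
      alternating-next m {rs} {ss} chain zeros factors = alternates chain zeros
        where
        f = eval (Q (suc (suc m)))

        g≈prod : ∀ x → eval (Q m) x ≈ prod ss x
        g≈prod x = trans (reflexive (≡.sym (eval-toR (Q m) x)))
          (trans (Evᵣ.eval-congˡ (toR (Q m)) (linearFactors ss) x factors) (eval-linearFactors ss x))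

        f≈-prod : ∀ {r} → eval (Q (suc m)) r ≈ 0# → f r ≈ - prod ss r
        f≈-prod {r} zero-r = begin
          f r                                                       ≈⟨ eval-Q m r ⟩
          (⟦ + 2 ⟧ᵢ + r) * eval (Q (suc m)) r - eval (Q m) r
              ≈⟨ +-cong (trans (*-congˡ zero-r) (zeroʳ _)) (-‿cong (g≈prod r)) ⟩
          0# - prod ss r                                            ≈⟨ +-identityˡ _ ⟩
          - prod ss r                                               ∎

        at-bottom : odd m * f bottom ≈ odd (suc (suc m)) * prod ss bottom
        at-bottom = trans (eval-Q-bottom-ratio m) (*-congˡ (g≈prod bottom))

        from-first : ∀ {r rs} → r ≺ top → Chain top (r ∷ rs) ss → All (λ r → eval (Q (suc m)) r ≈ 0#) (r ∷ rs) →
                   Alternating Neg f top (r ∷ rs)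
        from-first {r} r≺0 chain zs@(z ∷ _) with prod-alternating chain
        ... | a , p = step r≺0 (pos-resp (begin
            ⟦ + 1 ⟧ᵢ * prod ss r           ≈⟨ solve 2 (λ x y → x :* y := :- (x :* :- y)) refl ⟦ + 1 ⟧ᵢ (prod ss r) ⟩
            - (⟦ + 1 ⟧ᵢ * - prod ss r)     ≈⟨ -‿cong (*-cong (eval-Q-top (suc (suc m))) (f≈-prod z)) ⟨
            - (f top * f r)                ∎) (pos-* pos-ι1 p))
          (alternating-flip (pos-odd m) (pos-odd (suc (suc m))) at-bottom (All.map f≈-prod zs) a)

        alternates : ∀ {rs} → Chain top rs ss → All (λ r → eval (Q (suc m)) r ≈ 0#) rs → Alternating Neg f top rs
        alternates c@(last r≺0 _)   = from-first r≺0 c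
        alternates c@(link r≺0 _ _) = from-first r≺0 c

      interlacing : ∀ m → Interlacing m
      interlacing zero = record
        { rs = ⟦ -[1+ 0 ] ⟧ᵢ ∷ [] ; ss = [] ; chain = chain ; length≡ = ≡.refl ; zeros = zeros
        ; factors-rs = factorize-Q 0 chain ≡.refl zeros
        ; factors-ss = λ { zero → 1-homo ; (suc k) → refl } }
        where
        chain : Chain top (⟦ -[1+ 0 ] ⟧ᵢ ∷ []) []
        chain = last
          (pos-resp (solve 0 (con (+ 1) := con (+ 0) :- con -[1+ 0 ]) refl) pos-ι1)
          -- The distance from -4 to -1 is 3, which is `odd 1` and hence already known to be
          -- positive.
          (pos-resp (solve 0 (con (+ 1) :+ con (+ 2) := con -[1+ 0 ] :- con -[1+ 3 ]) refl) (pos-odd 1))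
        zeros : All (λ r → eval (Q 1) r ≈ 0#) (⟦ -[1+ 0 ] ⟧ᵢ ∷ [])
        zeros = trans (eval-Q₁ _) (trans (solve 0 (con (+ 1) :+ con -[1+ 0 ] :* con (+ 1)
            := con (+ 0)) refl) 0-homo) ∷ []
      interlacing (suc m) with interlacing m
      ... | I with roots (Q (suc (suc m))) (alternating-next m (Interlacing.chain I) (Interlacing.zeros I)
          (Interlacing.factors-ss I))
      ... | ts , chain , zeros = record
        { rs = ts ; ss = Interlacing.rs I ; chain = chain ; length≡ = len ; zeros = zeros
        ; factors-rs = factorize-Q (suc m) chain len zeros
        ; factors-ss = Interlacing.factors-rs I }
        where
        len : length ts ≡ suc (suc m)
        len = ≡.trans (chain-length chain) (≡.cong suc (Interlacing.length≡ I))

-- Instantiation at ℝ and ℂ: real-rootedness and the generalized Sturm property.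

module RealRootedness where

  open import Algebra.Bundles using (CommutativeRing)
  open import Algebra.Solver.Ring.AlmostCommutativeRing using (fromCommutativeRing; _-Raw-AlmostCommutative⟶_)
  open import Data.Integer.Base as ℤ using (ℤ; +_)
  import Data.Integer.Properties as ℤ
  open import Data.List.Base using ([]; _∷_; length)
  open import Data.List.Relation.Unary.Linked using (Linked; []; [-]; _∷_)
  open import Data.Nat.Base as ℕ using (ℕ; zero; suc; s≤s)
  import Data.Nat.Properties as ℕ
  open import Data.Product.Base using (∃-syntax; _×_; _,_; proj₁; proj₂)
  open import Data.Rational.Base as ℚ using (ℚ; 0ℚ; 1ℚ; toℚᵘ)
  import Data.Rational.Properties as ℚ
  open import Data.Rational.Solver using (module +-*-Solver)
  open import Data.Rational.Unnormalised.Base as ℚᵘ using (mkℚᵘ)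
  import Data.Rational.Unnormalised.Properties as ℚᵘ
  open import Data.Sum.Base using (_⊎_; inj₁; inj₂)
  open import Defs
  open import Level using (0ℓ)
  open import Relation.Binary.PropositionalEquality
  open RealNumbers
  open PolynomialRings
  open SturmSequence

  /1-homo-+ : ∀ i j → (i ℤ.+ j) ℚ./ 1 ≡ i ℚ./ 1 ℚ.+ j ℚ./ 1
  /1-homo-+ i j = ℚ.toℚᵘ-injective (begin
    toℚᵘ ((i ℤ.+ j) ℚ./ 1)                    ≈⟨ ℚ.toℚᵘ-fromℚᵘ (mkℚᵘ (i ℤ.+ j) 0) ⟩
    mkℚᵘ (i ℤ.+ j) 0
        ≈⟨ ℚᵘ.*≡* (cong (ℤ._* + 1) (cong₂ ℤ._+_ (sym (ℤ.*-identityʳ i)) (sym (ℤ.*-identityʳ j)))) ⟩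
    mkℚᵘ i 0 ℚᵘ.+ mkℚᵘ j 0                    ≈⟨ ℚᵘ.+-cong (ℚ.toℚᵘ-fromℚᵘ (mkℚᵘ i 0)) (ℚ.toℚᵘ-fromℚᵘ (mkℚᵘ j 0)) ⟨
    toℚᵘ (i ℚ./ 1) ℚᵘ.+ toℚᵘ (j ℚ./ 1)        ≈⟨ ℚ.toℚᵘ-homo-+ (i ℚ./ 1) (j ℚ./ 1) ⟨
    toℚᵘ (i ℚ./ 1 ℚ.+ j ℚ./ 1)                ∎)
    where open import Relation.Binary.Reasoning.Setoid ℚᵘ.≃-setoid

  /1-homo-* : ∀ i j → (i ℤ.* j) ℚ./ 1 ≡ (i ℚ./ 1) ℚ.* (j ℚ./ 1)
  /1-homo-* i j = ℚ.toℚᵘ-injective (begin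
    toℚᵘ ((i ℤ.* j) ℚ./ 1)                    ≈⟨ ℚ.toℚᵘ-fromℚᵘ (mkℚᵘ (i ℤ.* j) 0) ⟩
    mkℚᵘ i 0 ℚᵘ.* mkℚᵘ j 0                    ≈⟨ ℚᵘ.*-cong (ℚ.toℚᵘ-fromℚᵘ (mkℚᵘ i 0)) (ℚ.toℚᵘ-fromℚᵘ (mkℚᵘ j 0)) ⟨
    toℚᵘ (i ℚ./ 1) ℚᵘ.* toℚᵘ (j ℚ./ 1)        ≈⟨ ℚ.toℚᵘ-homo-* (i ℚ./ 1) (j ℚ./ 1) ⟨
    toℚᵘ ((i ℚ./ 1) ℚ.* (j ℚ./ 1))            ∎)
    where open import Relation.Binary.Reasoning.Setoid ℚᵘ.≃-setoid

  /1-homo-neg : ∀ i → (ℤ.- i) ℚ./ 1 ≡ ℚ.- (i ℚ./ 1)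
  /1-homo-neg i = ℚ.toℚᵘ-injective (begin
    toℚᵘ ((ℤ.- i) ℚ./ 1)                      ≈⟨ ℚ.toℚᵘ-fromℚᵘ (mkℚᵘ (ℤ.- i) 0) ⟩
    ℚᵘ.- mkℚᵘ i 0                             ≈⟨ ℚᵘ.-‿cong (ℚ.toℚᵘ-fromℚᵘ (mkℚᵘ i 0)) ⟨
    ℚᵘ.- toℚᵘ (i ℚ./ 1)                       ≈⟨ ℚ.toℚᵘ-homo‿- (i ℚ./ 1) ⟨
    toℚᵘ (ℚ.- (i ℚ./ 1))                      ∎)
    where open import Relation.Binary.Reasoning.Setoid ℚᵘ.≃-setoid

  fromℤ-homomorphism : ℤ.+-*-rawRing -Raw-AlmostCommutative⟶ fromCommutativeRing
      (bundle ℝ-rawRing ℝ-isCommutativeRing)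
  fromℤ-homomorphism = record
    { ⟦_⟧    = fromℤ
    ; +-homo = λ i j → pointwise λ _ → /1-homo-+ i j
    ; *-homo = λ i j → pointwise λ _ → /1-homo-* i j
    ; -‿homo = λ i → pointwise λ _ → /1-homo-neg i
    ; 0-homo = pointwise λ _ → refl
    ; 1-homo = pointwise λ _ → refl }

  0<x+y : ∀ {x y} → 0ᵣ <ᵣ x → 0ᵣ <ᵣ y → 0ᵣ <ᵣ x +ᵣ y
  0<x+y {x} {y} (mk< g 0<g ev) (mk< h 0<h ev′) = mk< (g ℚ.+ h) (ℚ.+-mono-< 0<g 0<h)
    (eventually-zip (λ n l m → subst (ℚ._≤ seq x n ℚ.+ seq y n)
      (solve 2 (λ g h → (con 0ℚ :+ g) :+ (con 0ℚ :+ h) := con 0ℚ :+ (g :+ h)) refl g h) (ℚ.+-mono-≤ l m)) ev ev′)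
    where open +-*-Solver

  -- If `x` is eventually bounded by B and `x y` is eventually at least h, then `y` is eventually at
  -- least h/B; that quotient is the new gap.
  pos-cancelˡ : ∀ {x y} → 0ᵣ <ᵣ x → 0ᵣ <ᵣ x *ᵣ y → 0ᵣ <ᵣ y
  pos-cancelˡ {x} {y} (mk< g 0<g ev) (mk< h 0<h ev′) = go (eventuallyBounded (seq x) (cauchy x))
    where
    step : ∀ {B d} p q → ℚ.∣ p ∣ ℚ.≤ B → 0ℚ ℚ.< d → B ℚ.* d ≡ h →
           0ℚ ℚ.+ g ℚ.≤ p → 0ℚ ℚ.+ h ℚ.≤ p ℚ.* q → 0ℚ ℚ.+ d ℚ.≤ q
    step {B} {d} p q p≤B 0<d refl l m rewrite ℚ.+-identityˡ g | ℚ.+-identityˡ (B ℚ.* d) | ℚ.+-identityˡ d =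
      ℚ.≮⇒≥ λ q<d → ℚ.<-irrefl refl (begin-strict
        p ℚ.* q     <⟨ ℚ.*-monoʳ-<-pos p {{ℚ.positive (ℚ.<-≤-trans 0<g l)}} q<d ⟩
        p ℚ.* d     ≤⟨ ℚ.*-monoʳ-≤-nonNeg d {{ℚ.nonNegative (ℚ.<⇒≤ 0<d)}} (ℚ.≤-trans (p≤∣p∣ p) p≤B) ⟩
        B ℚ.* d     ≤⟨ m ⟩
        p ℚ.* q     ∎)
      where open ℚ.≤-Reasoning

    go : ∃[ B ] 0ℚ ℚ.< B × Eventually (λ n → ℚ.∣ seq x n ∣ ℚ.≤ B) → 0ᵣ <ᵣ y
    go (B , 0<B , bounded) with divide 0<B 0<h
    ... | d , 0<d , eq = mk< d 0<d (eventually-zip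
      (λ n p≤B (l , m) → step (seq x n) (seq y n) p≤B 0<d eq l m) bounded (eventually-zip (λ _ → _,_) ev ev′))

  ℝ-positivity : Positivity ℝ-rawRing
  ℝ-positivity = record
    { Pos          = 0ᵣ <ᵣ_
    ; pos-resp     = λ {x} {y} → <ᵣ-resp-≈ {0ᵣ} {x} {0ᵣ} {y} (≈-refl {0ᵣ})
    ; pos-1        = fromℚ-mono-< 0<1
    ; pos-+        = λ {x} {y} → 0<x+y {x} {y}
    ; pos-*        = λ {x} {y} → *ᵣ-pos {x} {y}
    ; pos-cancel-≈ = λ {x} {y} → *ᵣ-cancelˡ-pos {x} {y}
    ; pos-cancel   = λ {x} {y} → pos-cancelˡ {x} {y} }

  open Sturm ℝ-rawRing ℝ-isCommutativeRing ℝ-positivity fromℤ-homomorphism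
  open Positivity ℝ-positivity using (_≺_)

  0<y-x⇒x<y : ∀ {x y} → x ≺ y → x <ᵣ y
  0<y-x⇒x<y {x} {y} (mk< g 0<g ev) = mk< g 0<g (eventually-map (λ n l →
    subst₂ ℚ._≤_
      (solve 2 (λ a g → a :+ (con 0ℚ :+ g) := a :+ g) refl (seq x n) g)
      (solve 2 (λ a b → a :+ (b :- a) := b) refl (seq x n) (seq y n))
      (ℚ.+-monoʳ-≤ (seq x n) l)) ev)
    where open +-*-Solver

  module ℤ→ℝ = Evaluation ℤ.+-*-rawRing ℤ.+-*-isCommutativeRing
      (bundle ℝ-rawRing ℝ-isCommutativeRing) fromℤ-homomorphism
    (λ eq → CommutativeRing.reflexive (bundle ℝ-rawRing ℝ-isCommutativeRing) (cong fromℤ eq)) fromℤ-homomorphism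

  evalℚ : ℤ[t].Poly → ℚ → ℚ
  evalℚ []      q = 0ℚ
  evalℚ (x ∷ p) q = x ℚ./ 1 ℚ.+ q ℚ.* evalℚ p q

  -- Provides the pair of rational and real functions on which the intermediate value theorem
  -- operates.
  seq-eval : ∀ p x n → seq (ℤ→ℝ.eval p x) n ≡ evalℚ p (seq x n)
  seq-eval []      x n = refl
  seq-eval (y ∷ p) x n = cong (λ z → y ℚ./ 1 ℚ.+ seq x n ℚ.* z) (seq-eval p x n)

  root-between-ℝ : ∀ p {a b} → a ≺ b → 0ᵣ <ᵣ -ᵣ (ℤ→ℝ.eval p a *ᵣ ℤ→ℝ.eval p b) →
                   ∃[ r ] ℤ→ℝ.eval p r ≈ᵣ 0ᵣ × a ≺ r × r ≺ b
  root-between-ℝ p {a} {b} a≺b neg =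
    go (IntermediateValue.root-between (evalℚ p) (ℤ→ℝ.eval p) (ℤ→ℝ.eval-congʳ p) (seq-eval p)
      (0<y-x⇒x<y {a} {b} a≺b) negative)
    where
    negate : ∀ {x} → 0ᵣ <ᵣ -ᵣ x → x <ᵣ 0ᵣ
    negate {x} 0<-x = <ᵣ-resp-≈ { -ᵣ (-ᵣ x)} { -ᵣ 0ᵣ} {x} {0ᵣ}
      (pointwise λ n → solve 1 (λ p → :- (:- p) := p) refl (seq x n)) (pointwise λ _ → refl) (neg-mono-< 0<-x)
      where open +-*-Solver

    negative : ℤ→ℝ.eval p a *ᵣ ℤ→ℝ.eval p b <ᵣ 0ᵣ
    negative = negate {ℤ→ℝ.eval p a *ᵣ ℤ→ℝ.eval p b} neg

    go : ∃[ r ] ℤ→ℝ.eval p r ≈ᵣ 0ᵣ × a <ᵣ r × r <ᵣ b → ∃[ r ] ℤ→ℝ.eval p r ≈ᵣ 0ᵣ × a ≺ r × r ≺ b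
    go (r , pr≈0 , a<r , r<b) = r , pr≈0 , x<y⇒0<y-x {a} {r} a<r , x<y⇒0<y-x {r} {b} r<b

  abstract
    -- The zeros are used only through the fields of `Interlacing`; opacity keeps the bisection from
    -- being unfolded when types mentioning them are compared.
    interlacing-ℝ : ∀ m → Interlacing root-between-ℝ m
    interlacing-ℝ = interlacing root-between-ℝ

  -ᶜ_ : ℂ → ℂ
  -ᶜ z = (-ᵣ re z) +i (-ᵣ im z)

  0ᶜ 1ᶜ : ℂ
  0ᶜ = fromℝ 0ᵣ
  1ᶜ = fromℝ 1ᵣ

  ℂ-commutativeRing : CommutativeRing 0ℓ 0ℓ
  ℂ-commutativeRing = record
    { Carrier = ℂ ; _≈_ = _≈ᶜ_ ; _+_ = _+ᶜ_ ; _*_ = _*ᶜ_ ; -_ = -ᶜ_ ; 0# = 0ᶜ ; 1# = 1ᶜ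
    ; isCommutativeRing = record
      { isRing = record
        { +-isAbelianGroup = record
          { isGroup = record
            { isMonoid = record
              { isSemigroup = record
                { isMagma = record
                  { isEquivalence = record
                    { refl = ≈-refl , ≈-refl
                    ; sym = λ (p , q) → ≈-sym p , ≈-sym q
                    ; trans = λ (p , q) (p′ , q′) → ≈-trans p p′ , ≈-trans q q′ }
                  ; ∙-cong = λ (p , q) (p′ , q′) → +ᵣ-cong p p′ , +ᵣ-cong q q′ }
                ; assoc = λ (a +i b) (c +i d) (e +i f) → R.+-assoc a c e , R.+-assoc b d f }
              ; identity = (λ (a +i b) → R.+-identityˡ a , R.+-identityˡ b)
                         , (λ (a +i b) → R.+-identityʳ a , R.+-identityʳ b) }
            ; inverse = (λ (a +i b) → R.-‿inverseˡ a , R.-‿inverseˡ b)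
                      , (λ (a +i b) → R.-‿inverseʳ a , R.-‿inverseʳ b)
            ; ⁻¹-cong = λ (p , q) → -ᵣ-cong p , -ᵣ-cong q }
          ; comm = λ (a +i b) (c +i d) → R.+-comm a c , R.+-comm b d }
        ; *-cong = *ᶜ-cong
        ; *-assoc = *ᶜ-assoc
        ; *-identity = *ᶜ-identityˡ , *ᶜ-identityʳ
        ; distrib = *ᶜ-distribˡ , *ᶜ-distribʳ }
      ; *-comm = *ᶜ-comm } }
    where
    module R = CommutativeRing (bundle ℝ-rawRing ℝ-isCommutativeRing)
    open +-*-Solver

    *ᶜ-cong : ∀ {w w′ z z′} → w ≈ᶜ w′ → z ≈ᶜ z′ → w *ᶜ z ≈ᶜ w′ *ᶜ z′
    *ᶜ-cong {a +i b} {a′ +i b′} {c +i d} {c′ +i d′} (p , q) (p′ , q′) =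
        +ᵣ-cong {a *ᵣ c} {a′ *ᵣ c′} { -ᵣ (b *ᵣ d)} { -ᵣ (b′ *ᵣ d′)}
          (*ᵣ-cong {a} {a′} {c} {c′} p p′) (-ᵣ-cong {b *ᵣ d} {b′ *ᵣ d′} (*ᵣ-cong {b} {b′} {d} {d′} q q′))
      , +ᵣ-cong {a *ᵣ d} {a′ *ᵣ d′} {b *ᵣ c} {b′ *ᵣ c′}
          (*ᵣ-cong {a} {a′} {d} {d′} p q′) (*ᵣ-cong {b} {b′} {c} {c′} q p′)

    *ᶜ-assoc : ∀ u v w → (u *ᶜ v) *ᶜ w ≈ᶜ u *ᶜ (v *ᶜ w)
    *ᶜ-assoc (a +i b) (c +i d) (e +i f) =
        (pointwise λ n → solve 6 (λ a b c d e f → (a :* c :+ :- (b :* d)) :* e :+ :- ((a :* d :+ b :* c) :* f)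
          := a :* (c :* e :+ :- (d :* f)) :+ :- (b :* (c :* f :+ d :* e)))
              refl (seq a n) (seq b n) (seq c n) (seq d n) (seq e n) (seq f n))
      , (pointwise λ n → solve 6 (λ a b c d e f → (a :* c :+ :- (b :* d)) :* f :+ (a :* d :+ b :* c) :* e
          := a :* (c :* f :+ d :* e) :+ b :* (c :* e :+ :- (d :* f)))
              refl (seq a n) (seq b n) (seq c n) (seq d n) (seq e n) (seq f n))

    *ᶜ-comm : ∀ w z → w *ᶜ z ≈ᶜ z *ᶜ w
    *ᶜ-comm (a +i b) (c +i d) =
        (pointwise λ n → solve 4 (λ a b c d → a :* c :+ :- (b :* d)
            := c :* a :+ :- (d :* b)) refl (seq a n) (seq b n) (seq c n) (seq d n))
      , (pointwise λ n → solve 4 (λ a b c d → a :* d :+ b :* c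
          := c :* b :+ d :* a) refl (seq a n) (seq b n) (seq c n) (seq d n))

    *ᶜ-identityˡ : ∀ z → 1ᶜ *ᶜ z ≈ᶜ z
    *ᶜ-identityˡ (a +i b) =
        (pointwise λ n → solve 2 (λ a b → con 1ℚ :* a :+ :- (con 0ℚ :* b) := a) refl (seq a n) (seq b n))
      , (pointwise λ n → solve 2 (λ a b → con 1ℚ :* b :+ con 0ℚ :* a := b) refl (seq a n) (seq b n))

    *ᶜ-identityʳ : ∀ z → z *ᶜ 1ᶜ ≈ᶜ z
    *ᶜ-identityʳ (a +i b) =
        (pointwise λ n → solve 2 (λ a b → a :* con 1ℚ :+ :- (b :* con 0ℚ) := a) refl (seq a n) (seq b n))
      , (pointwise λ n → solve 2 (λ a b → a :* con 0ℚ :+ b :* con 1ℚ := b) refl (seq a n) (seq b n))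

    *ᶜ-distribˡ : ∀ u v w → u *ᶜ (v +ᶜ w) ≈ᶜ u *ᶜ v +ᶜ u *ᶜ w
    *ᶜ-distribˡ (a +i b) (c +i d) (e +i f) =
        (pointwise λ n → solve 6 (λ a b c d e f → a :* (c :+ e) :+ :- (b :* (d :+ f))
          := (a :* c :+ :- (b :* d)) :+ (a :* e :+ :- (b :* f)))
              refl (seq a n) (seq b n) (seq c n) (seq d n) (seq e n) (seq f n))
      , (pointwise λ n → solve 6 (λ a b c d e f → a :* (d :+ f) :+ b :* (c :+ e)
          := (a :* d :+ b :* c) :+ (a :* f :+ b :* e))
              refl (seq a n) (seq b n) (seq c n) (seq d n) (seq e n) (seq f n))

    *ᶜ-distribʳ : ∀ u v w → (v +ᶜ w) *ᶜ u ≈ᶜ v *ᶜ u +ᶜ w *ᶜ u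
    *ᶜ-distribʳ (a +i b) (c +i d) (e +i f) =
        (pointwise λ n → solve 6 (λ a b c d e f → (c :+ e) :* a :+ :- ((d :+ f) :* b)
          := (c :* a :+ :- (d :* b)) :+ (e :* a :+ :- (f :* b)))
              refl (seq a n) (seq b n) (seq c n) (seq d n) (seq e n) (seq f n))
      , (pointwise λ n → solve 6 (λ a b c d e f → (c :+ e) :* b :+ (d :+ f) :* a
          := (c :* b :+ d :* a) :+ (e :* b :+ f :* a))
              refl (seq a n) (seq b n) (seq c n) (seq d n) (seq e n) (seq f n))

  fromℝ-homomorphism : ℝ-rawRing -Raw-AlmostCommutative⟶ fromCommutativeRing ℂ-commutativeRing
  fromℝ-homomorphism = record
    { ⟦_⟧    = fromℝ
    ; +-homo = λ x y → ≈-refl {x +ᵣ y} , pointwise λ _ → refl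
    ; *-homo = λ x y →
        (pointwise λ n → solve 2 (λ a b → a :* b := a :* b :+ :- (con 0ℚ :* con 0ℚ)) refl (seq x n) (seq y n))
      , (pointwise λ n → solve 2 (λ a b → con 0ℚ := a :* con 0ℚ :+ con 0ℚ :* b) refl (seq x n) (seq y n))
    ; -‿homo = λ x → ≈-refl { -ᵣ x} , pointwise λ _ → refl
    ; 0-homo = ≈-refl {0ᵣ} , ≈-refl {0ᵣ}
    ; 1-homo = ≈-refl {1ᵣ} , ≈-refl {0ᵣ} }
    where open +-*-Solver

  fromℤ-homomorphismᶜ : ℤ.+-*-rawRing -Raw-AlmostCommutative⟶ fromCommutativeRing ℂ-commutativeRing
  fromℤ-homomorphismᶜ = record
    { ⟦_⟧    = λ i → fromℝ (fromℤ i)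
    ; +-homo = λ i j → (pointwise λ _ → /1-homo-+ i j) , pointwise λ _ → refl
    ; *-homo = λ i j →
        (pointwise λ _ → trans (/1-homo-* i j)
          (solve 2 (λ a b → a :* b := a :* b :+ :- (con 0ℚ :* con 0ℚ)) refl (i ℚ./ 1) (j ℚ./ 1)))
      , (pointwise λ _ → solve 2 (λ a b → con 0ℚ := a :* con 0ℚ :+ con 0ℚ :* b) refl (i ℚ./ 1) (j ℚ./ 1))
    ; -‿homo = λ i → (pointwise λ _ → /1-homo-neg i) , pointwise λ _ → refl
    ; 0-homo = (pointwise λ _ → refl) , pointwise λ _ → refl
    ; 1-homo = (pointwise λ _ → refl) , pointwise λ _ → refl }
    where open +-*-Solver

  module ℝ→ℂ = Evaluation ℝ-rawRing ℝ-isCommutativeRing ℂ-commutativeRing fromℝ-homomorphism (λ eq → eq , ≈-refl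
      {0ᵣ}) fromℤ-homomorphismᶜ

  seq-evalᶜ : ∀ p z n → seq (re (evalᶜ p z)) n ≡ seq (re (ℝ→ℂ.eval p z)) n ×
                        seq (im (evalᶜ p z)) n ≡ seq (im (ℝ→ℂ.eval p z)) n
  seq-evalᶜ []      z n = refl , refl
  seq-evalᶜ (x ∷ p) z n =
      cong₂ (λ a b → seq x n ℚ.+ (seq (re z) n ℚ.* a ℚ.+ ℚ.- (seq (im z) n ℚ.* b))) (proj₁ (seq-evalᶜ p z n)) (proj₂
          (seq-evalᶜ p z n))
    , cong₂ (λ a b → 0ℚ ℚ.+ (seq (re z) n ℚ.* b ℚ.+ seq (im z) n ℚ.* a)) (proj₁ (seq-evalᶜ p z n)) (proj₂
        (seq-evalᶜ p z n))

  -- The squared modulus, so that multiplicativity is a polynomial identity in real and imaginary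
  -- parts and holds at each index.
  norm : ℂ → ℝ
  norm z = re z *ᵣ re z +ᵣ im z *ᵣ im z

  norm-cong : ∀ {w z} → w ≈ᶜ z → norm w ≈ᵣ norm z
  norm-cong {a +i b} {c +i d} (p , q) = +ᵣ-cong {a *ᵣ a} {c *ᵣ c} {b *ᵣ b} {d *ᵣ d}
    (*ᵣ-cong {a} {c} {a} {c} p p) (*ᵣ-cong {b} {d} {b} {d} q q)

  *-nonNeg : ∀ {p q} → 0ℚ ℚ.≤ p → 0ℚ ℚ.≤ q → 0ℚ ℚ.≤ p ℚ.* q
  *-nonNeg {p} {q} 0≤p 0≤q = ℚ.nonNegative⁻¹ _ {{ℚ.nonNeg*nonNeg⇒nonNeg p {{ℚ.nonNegative 0≤p}} q
      {{ℚ.nonNegative 0≤q}}}}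

  norm-nonNeg : ∀ z n → 0ℚ ℚ.≤ seq (norm z) n
  norm-nonNeg z n = ℚ.+-mono-≤ (square-nonNeg (seq (re z) n)) (square-nonNeg (seq (im z) n))

  open Coefficients ℝ-rawRing ℝ-isCommutativeRing using (linearFactors)

  -- From f(z) = 0 one cannot constructively extract a factor that vanishes. The bound of `|f(z)|²`
  -- below by a power of `(im z)²` avoids the choice and leaves a vanishing power, hence a vanishing
  -- square of `im z`.
  factors⇒realRooted : ∀ f rs → f ℝ[t].≈ₚ linearFactors rs → RealRooted f
  factors⇒realRooted f rs f≈ = inj₂ λ z (re≈0 , im≈0) → x²≈0⇒x≈0 {im z}
    (FactoredZeros.factored-zero ℝ-rawRing ℝ-isCommutativeRing ℂ-commutativeRing
      fromℤ-homomorphism fromℤ-homomorphismᶜ fromℝ-homomorphism (λ eq → eq , ≈-refl {0ᵣ})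
      (λ {x} → x²≈0⇒x≈0 {x}) norm (λ z → im z *ᵣ im z)
      (λ {w} {z} → norm-cong {w} {z})
      (λ w z → pointwise λ n → solve 4 (λ a b c d →
        (a :* c :+ :- (b :* d)) :* (a :* c :+ :- (b :* d)) :+ (a :* d :+ b :* c) :* (a :* d :+ b :* c)
          := (a :* a :+ b :* b) :* (c :* c :+ d :* d))
              refl (seq (re w) n) (seq (im w) n) (seq (re z) n) (seq (im z) n))
      (pointwise λ _ → refl)
      -- Nonnegativity is imposed on every term of the representing sequence rather than on the real
      -- number; it is then inherited by products term by term, as `sandwich` demands.
      (λ x → ∀ n → 0ℚ ℚ.≤ seq x n)
      (λ c z 0≤c n → *-nonNeg (0≤c n) (square-nonNeg (seq (im z) n)))
      (λ c z r w 0≤c → sandwich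
        (λ n → *-nonNeg (*-nonNeg (0≤c n) (square-nonNeg (seq (im z) n))) (norm-nonNeg w n))
        (λ n → shrink (0≤c n) (square≤norm (seq (re z) n) (seq (im z) n) (seq r n)) (norm-nonNeg w n)))
      (λ _ → ℚ.<⇒≤ 0<1) (pointwise λ _ → refl) f rs z f≈
      ( ≈-trans (pointwise λ n → sym (proj₁ (seq-evalᶜ f z n))) re≈0
      , ≈-trans (pointwise λ n → sym (proj₂ (seq-evalᶜ f z n))) im≈0))
    where
    open +-*-Solver

    square≤norm : ∀ a b r → b ℚ.* b ℚ.≤ (a ℚ.+ ℚ.- r) ℚ.* (a ℚ.+ ℚ.- r) ℚ.+ (b ℚ.+ ℚ.- 0ℚ) ℚ.* (b ℚ.+ ℚ.- 0ℚ)
    square≤norm a b r = ℚ.≤-trans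
      (ℚ.≤-reflexive (solve 1 (λ b → b :* b := con 0ℚ :+ (b :+ :- con 0ℚ) :* (b :+ :- con 0ℚ)) refl b))
      (ℚ.+-monoˡ-≤ ((b ℚ.+ ℚ.- 0ℚ) ℚ.* (b ℚ.+ ℚ.- 0ℚ)) (square-nonNeg (a ℚ.+ ℚ.- r)))

    shrink : ∀ {c u v w} → 0ℚ ℚ.≤ c → u ℚ.≤ v → 0ℚ ℚ.≤ w → c ℚ.* u ℚ.* w ℚ.≤ c ℚ.* (v ℚ.* w)
    shrink {c} {u} {v} {w} 0≤c u≤v 0≤w = ℚ.≤-trans (ℚ.≤-reflexive (ℚ.*-assoc c u w))
      (ℚ.*-monoˡ-≤-nonNeg c {{ℚ.nonNegative 0≤c}} (ℚ.*-monoʳ-≤-nonNeg w {{ℚ.nonNegative 0≤w}} u≤v))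

  ≺⇒≥ : ∀ {x y} → Positivity._≺_ ℝ-positivity x y → y ≥ᵣ x
  ≺⇒≥ {x} {y} p = <⇒≤ᵣ (0<y-x⇒x<y {x} {y} p)

  chain-alternate : ∀ {u rs ss} → Chain u rs ss → Linked _≥ᵣ_ (u ∷ alternate rs ss)
  chain-alternate {u} (last {r = r} r≺u _)               = ≺⇒≥ {r} {u} r≺u ∷ [-]
  chain-alternate {u} (link {r = r} {s = s} r≺u s≺r c) = ≺⇒≥ {r} {u} r≺u ∷ ≺⇒≥ {s} {r} s≺r ∷ chain-alternate c

  chain-left : ∀ {u rs ss} → Chain u rs ss → Linked _≥ᵣ_ (u ∷ rs)
  chain-left {u} (last {r = r} r≺u _) = ≺⇒≥ {r} {u} r≺u ∷ [-]
  chain-left {u} (link {r = r} {s = s} r≺u s≺r (last {r = r′} r′≺s _)) = ≺⇒≥ {r} {u} r≺u ∷ ≺⇒≥ {r′} {r} (≺-trans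
      {r′} {s} {r} r′≺s s≺r) ∷ [-]
  -- Skipping s by transitivity re-bases the tail of the chain at r, to which the recursion applies.
  chain-left {u} (link {r = r} {s = s} r≺u s≺r (link {r = r′} r′≺s s′≺r′ c)) =
    ≺⇒≥ {r} {u} r≺u ∷ chain-left (link (≺-trans {r′} {s} {r} r′≺s s≺r) s′≺r′ c)

  chain-right : ∀ {u rs ss} → Chain u rs ss → Linked _≥ᵣ_ (u ∷ ss)
  chain-right (last _ _)                              = [-]
  chain-right {u} (link {r = r} {s = s} r≺u s≺r c) = ≺⇒≥ {s} {u} (≺-trans {s} {r} {u} s≺r r≺u) ∷ chain-right c

  0≥0 : 0ᵣ ≥ᵣ 0ᵣ
  0≥0 = ≈⇒≤ {0ᵣ} {0ᵣ} (≈-refl {0ᵣ})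

  coeff-toℝ : ∀ p k → ℝ[t].coeff (toℝ[t] p) k ≈ᵣ fromℤ (ℤ[t].coeff p k)
  coeff-toℝ []      k       = pointwise λ _ → refl
  coeff-toℝ (x ∷ p) zero    = pointwise λ _ → refl
  coeff-toℝ (x ∷ p) (suc k) = coeff-toℝ p k

  -- Area sequences enter only through `P₊`. The truncated `n ∸ 1` covers the repeated start: P(1)
  -- and P(2) are both t Q(0), and from there on P(m + 2) is t Q(m).
  module _ (P : ℕ → ℤ[t].Poly) (P₀ : P 0 ≡ ℤ[t].0ₚ)
    (P₊ : ∀ n → P (suc n) ℤ[t].≈ₚ + 0 ∷ Q (n ℕ.∸ 1)) where

    P-factors : ∀ n zs → toR (Q (n ℕ.∸ 1)) ℝ[t].≈ₚ linearFactors zs →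
                toℝ[t] (P (suc n)) ℝ[t].≈ₚ linearFactors (0ᵣ ∷ zs)
    P-factors n zs = shifted-factors (P (suc n)) (n ℕ.∸ 1) (P₊ n) (toℝ[t] (P (suc n))) (coeff-toℝ (P (suc n)))
      0ᵣ zs (≈-refl {0ᵣ})

    P-hasZeros : ∀ n zs → Linked _≥ᵣ_ (0ᵣ ∷ zs) → toR (Q (n ℕ.∸ 1)) ℝ[t].≈ₚ linearFactors zs →
                 HasZeros (toℝ[t] (P (suc n))) (0ᵣ ∷ zs)
    P-hasZeros n zs sorted factors = sorted , 1ᵣ , inj₂ (Positivity.pos-1 ℝ-positivity)
      , λ k → ≈-trans (P-factors n zs factors k)
          (Coefficients.·-identity ℝ-rawRing ℝ-isCommutativeRing (linearFactors (0ᵣ ∷ zs)) k)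

    P-realRooted : ∀ n → RealRooted (toℝ[t] (P n))
    P-realRooted zero    = inj₁ (subst (λ p → IsConstant (toℝ[t] p)) (sym P₀) λ _ → ≈-refl {0ᵣ})
    P-realRooted (suc n) = factors⇒realRooted (toℝ[t] (P (suc n))) (0ᵣ ∷ I.ss) (P-factors n I.ss I.factors-ss)
      where module I = Interlacing (interlacing-ℝ (n ℕ.∸ 1))

    P-positive : ∀ n → toℝ[t] (P n) ℝ[t].≈ₚ ℝ[t].0ₚ ⊎ PositiveLeadingCoefficient (toℝ[t] (P n))
    P-positive zero    = inj₁ (subst (λ p → toℝ[t] p ℝ[t].≈ₚ ℝ[t].0ₚ) (sym P₀) λ _ → ≈-refl {0ᵣ})
    P-positive (suc n) = inj₂ (suc (n ℕ.∸ 1) , shifted-leading (P (suc n)) (n ℕ.∸ 1) (P₊ n) (toℝ[t] (P (suc n)))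
        (coeff-toℝ (P (suc n))))

    P-interlaces : ∀ n → toℝ[t] (P n) ≪ toℝ[t] (P (suc n))
    P-interlaces zero       = inj₁ (subst (λ p → toℝ[t] p ℝ[t].≈ₚ ℝ[t].0ₚ) (sym P₀) λ _ → ≈-refl {0ᵣ})
    -- Both polynomials are t, with the single zero 0. As `interlacing-ℝ` is opaque, `I.ss` is known
    -- to be empty only through its length.
    P-interlaces (suc zero) = inj₂ (inj₂ (0ᵣ ∷ I.ss , 0ᵣ ∷ I.ss
      , P-hasZeros 0 I.ss (chain-right I.chain) I.factors-ss
      , P-hasZeros 1 I.ss (chain-right I.chain) I.factors-ss
      , ℕ.≤-refl , ℕ.n≤1+n _ , double I.ss (ℕ.suc-injective (trans (sym (chain-length I.chain)) I.length≡))))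
      where
      module I = Interlacing (interlacing-ℝ 0)
      double : ∀ zs → length zs ≡ 0 → Linked _≥ᵣ_ (alternate (0ᵣ ∷ zs) (0ᵣ ∷ zs))
      double [] _ = 0≥0 ∷ [-]
    -- The common factor t puts 0 at the head of both lists, so the merged chain starts with 0 ≥ 0
    -- and continues with the strict chain of the zeros of Q(m + 1) and Q(m).
    P-interlaces (suc (suc m)) = inj₂ (inj₂ (0ᵣ ∷ I.ss , 0ᵣ ∷ I.rs
      , P-hasZeros (suc m) I.ss (chain-right I.chain) I.factors-ss
      , P-hasZeros (suc (suc m)) I.rs (chain-left I.chain) I.factors-rs
      , s≤s (ℕ.≤-trans (ℕ.n≤1+n _) (ℕ.≤-reflexive (sym (chain-length I.chain))))
      , s≤s (ℕ.≤-reflexive (chain-length I.chain))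
      , 0≥0 ∷ chain-alternate I.chain))
      where module I = Interlacing (interlacing-ℝ m)

    P-generalizedSturm : IsGeneralizedSturm (λ n → toℝ[t] (P n))
    P-generalizedSturm = (λ n → P-realRooted n , P-positive n) , P-interlaces

-- Walks and their correspondence with area sequences.

module Walks where

  open import Data.Empty using (⊥-elim)
  open import Data.List.Base using (List; []; _∷_; length)
  open import Data.List.Membership.Propositional using (_∈_)
  open import Data.List.Relation.Unary.All as All using (All; []; _∷_)
  open import Data.List.Relation.Unary.AllPairs using (AllPairs; []; _∷_)
  open import Data.List.Relation.Unary.Any using (here; there)
  open import Data.Nat.Base using (ℕ; zero; suc; _+_; _∸_; _≤_; _<_; z≤n; s≤s)
  open import Data.Nat.Properties
  open import Data.Nat.Solver using (module +-*-Solver)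
  open import Data.Product.Base using (∃-syntax; _×_; _,_; proj₁; proj₂)
  open import Data.Sum.Base using (_⊎_; inj₁; inj₂)
  open import Data.Vec.Base using (Vec; []; _∷_)
  open import Relation.Binary.PropositionalEquality
  open import Relation.Nullary using (yes; no; ¬_)

  -- Reading an area sequence from the left, the state is p = aⱼ together with the distance d from
  -- j back to the right end of the previous peak-clique (or to vertex 1 if there is none).
  -- The weight counts the peaks.
  data Walk : ℕ → ℕ → ∀ {s} → Vec ℕ s → ℕ → Set where
    stop : ∀ {p d} → Walk p d [] 1
    rise : ∀ {p d s} {v : Vec ℕ s} {k} → Walk (suc p) (suc d) v k → Walk p d (suc p ∷ v) k
    turn : ∀ {p d x s} {v : Vec ℕ s} {k} → 1 ≤ x → x ≤ d → Walk x 1 v k → Walk p d (x ∷ v) (suc k)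

  -- Positions count from 0; beyond the end the value is 0.
  at : ∀ {s} → Vec ℕ s → ℕ → ℕ
  at []      _       = 0
  at (x ∷ v) zero    = x
  at (x ∷ v) (suc k) = at v k

  module Rows (B : ℕ → ℕ) (n : ℕ) where

    Steps : Set
    Steps = B 0 ≡ 0 × (∀ i → suc i < n → B (suc i) ≤ suc (B i))

    Uncut : Set
    Uncut = ∀ i → suc i < n → 1 ≤ B (suc i)

    -- The position i is the right end of a peak-clique; its left end is i ∸ B i.
    Row : ℕ → Set
    Row i = i < n × (suc i < n → B (suc i) ≤ B i)

    -- No three peak-cliques meet.
    Sparse : Set
    Sparse = ∀ {i j k} → i < j → j < k → Row i → Row j → Row k → i + B k < k

    module _ (steps : Steps) where

      spread : ∀ i d → d + i < n → B (d + i) ≤ d + B i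
      spread i zero    _   = ≤-refl
      spread i (suc d) l = ≤-trans (proj₂ steps (d + i) l) (s≤s (spread i d (<⇒≤ l)))

      -- Heights grow by at most one per position, so the left end `i ∸ B i` never moves to the
      -- left. The additive form avoids truncated subtraction.
      left-mono : ∀ {i m} → i ≤ m → m < n → i + B m ≤ m + B i
      left-mono {i} {m} i≤m m<n = begin
        i + B m                ≡⟨ cong (λ k → i + B k) (m∸n+n≡m i≤m) ⟨
        i + B (m ∸ i + i)      ≤⟨ +-monoʳ-≤ i (spread i (m ∸ i) (subst (_< n) (sym (m∸n+n≡m i≤m)) m<n)) ⟩
        i + (m ∸ i + B i)      ≡⟨ +-assoc i (m ∸ i) (B i) ⟨
        i + (m ∸ i) + B i      ≡⟨ cong (_+ B i) (m+[n∸m]≡n i≤m) ⟩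
        m + B i                ∎
        where open ≤-Reasoning

      B≤ : ∀ {i} → i < n → B i ≤ i
      B≤ {i} i<n = subst (B i ≤_) (trans (cong (i +_) (proj₁ steps)) (+-identityʳ i)) (left-mono z≤n i<n)

      -- A maximal run of rises starting at i keeps the left end fixed and stops at a row. Thus the
      -- left end belonging to any position is that of a peak-clique; d counts the positions still
      -- available.
      nextRow : ∀ d i → d + suc i ≡ n → ∃[ m ] i ≤ m × Row m × i + B m ≡ m + B i
      nextRow zero    i refl = i , ≤-refl , (≤-refl , λ l → ⊥-elim (<-irrefl refl l)) , refl
      nextRow (suc d) i eq with B (suc i) ≤? B i
      ... | yes le = i , ≤-refl , (subst (suc i ≤_) eq (m≤n+m (suc i) (suc d)) , λ _ → le) , refl
      ... | no  gt with nextRow d (suc i) (trans (+-suc d (suc i)) eq)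
      ... | m , i<m , row , shifted = m , <⇒≤ i<m , row , suc-injective (trans shifted (trans (cong (m +_) rises)
          (+-suc m (B i))))
        where
        rises : B (suc i) ≡ suc (B i)
        rises = ≤-antisym (proj₂ steps i (subst (suc (suc i) ≤_) eq (s≤s (m≤n+m (suc i) d)))) (≰⇒> gt)

    Suffix : ∀ {s} → Vec ℕ s → ℕ → Set
    Suffix {s} v j = suc j + s ≡ n × (∀ k → at v k ≡ B (suc j + k))

    module _ {s x : ℕ} {v : Vec ℕ s} {j : ℕ} where

      suffix-tail : Suffix (x ∷ v) j → Suffix v (suc j)
      suffix-tail (len , eq) = trans (sym (+-suc (suc j) s)) len , λ k → trans (eq (suc k)) (cong B (+-suc (suc j) k))

      suffix-head : Suffix (x ∷ v) j → x ≡ B (suc j)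
      suffix-head (_ , eq) = trans (eq 0) (cong B (+-identityʳ (suc j)))

      suffix-next : Suffix (x ∷ v) j → suc j < n
      suffix-next (len , _) = subst (suc (suc j) ≤_) (trans (sym (+-suc (suc j) s)) len) (m≤m+n (suc (suc j)) s)

    ¬Row-rise : ∀ {j} → suc j < n → B (suc j) ≡ suc (B j) → ¬ Row j
    ¬Row-rise {j} j+1<n eq (_ , fall) = <-irrefl refl (subst (_≤ B j) eq (fall j+1<n))

    -- The invariant `d ≤ p` makes every turn a weak descent, since x ≤ d ≤ p. A rise preserves it
    -- and a turn restarts it with 1 ≤ x.
    walk-steps : ∀ {p d s} {v : Vec ℕ s} {k j} → Walk p d v k → d ≤ p → B j ≡ p → Suffix v j →
                 ∀ i → j ≤ i → suc i < n → 1 ≤ B (suc i) × B (suc i) ≤ suc (B i)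
    walk-steps {j = j} stop d≤p Bj (len , _) i j≤i i+1<n =
      ⊥-elim (<-irrefl refl (<-≤-trans i+1<n (≤-trans (≤-reflexive (trans (sym len) (+-identityʳ (suc j))))
          (s≤s j≤i))))
    walk-steps {j = j} (rise w) d≤p refl suffix i j≤i i+1<n with m≤n⇒m<n∨m≡n j≤i
    ... | inj₁ j<i  = walk-steps w (s≤s d≤p) (sym (suffix-head suffix)) (suffix-tail suffix) i j<i i+1<n
    ... | inj₂ refl = subst (1 ≤_) (suffix-head suffix) (s≤s z≤n) , ≤-reflexive (sym (suffix-head suffix))
    walk-steps {j = j} (turn 1≤x x≤d w) d≤p refl suffix i j≤i i+1<n with m≤n⇒m<n∨m≡n j≤i
    ... | inj₁ j<i  = walk-steps w 1≤x (sym (suffix-head suffix)) (suffix-tail suffix) i j<i i+1<n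
    ... | inj₂ refl = subst (1 ≤_) (suffix-head suffix) 1≤x
      , subst (_≤ suc (B j)) (suffix-head suffix) (m≤n⇒m≤1+n (≤-trans x≤d d≤p))

    last-row : ∀ {j} → suc j ≡ n → Row j
    last-row {j} refl = ≤-refl , λ l → ⊥-elim (<-irrefl refl l)

    -- `R` is the last row before j, or 0 if there is none. The walk is followed until j reaches the
    -- middle row l; since a position followed by a rise is not a row, this happens at a turn, where
    -- `x ≤ d` pushes the next left end beyond `R`.
    walk-sparse : Steps → ∀ {p d s} {v : Vec ℕ s} {k j} R → Walk p d v k → d ≤ p → B j ≡ p → Suffix v j → d + R ≡ j →
                  (∀ {i} → i < j → Row i → i ≤ R) →
                  ∀ {i l m} → i < l → j ≤ l → l < m → Row i → Row l → Row m → i + B m < m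
    walk-sparse steps {j = j} R stop d≤p Bj (len , _) _ _ {m = m} i<l j≤l l<m _ _ (m<n , _) =
      ⊥-elim (<-irrefl refl (<-≤-trans m<n (≤-trans (≤-reflexive (trans (sym len) (+-identityʳ (suc j)))) (≤-trans
          (s≤s j≤l) l<m))))
    walk-sparse steps {j = j} R (rise w) d≤p refl suffix dR below i<l j≤l l<m ri rl rm with m≤n⇒m<n∨m≡n j≤l
    ... | inj₂ refl = ⊥-elim (¬Row-rise (suffix-next suffix) (sym (suffix-head suffix)) rl)
    ... | inj₁ j<l  = walk-sparse steps R w (s≤s d≤p) (sym (suffix-head suffix)) (suffix-tail suffix) (cong suc dR)
      below′ i<l j<l l<m ri rl rm
      where
      below′ : ∀ {i} → i < suc j → Row i → i ≤ R
      below′ (s≤s i≤j) row with m≤n⇒m<n∨m≡n i≤j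
      ... | inj₁ i<j  = below i<j row
      ... | inj₂ refl = ⊥-elim (¬Row-rise (suffix-next suffix) (sym (suffix-head suffix)) row)
    walk-sparse steps {j = j} R (turn {d = d} {x = x} 1≤x x≤d w) d≤p
        refl suffix dR below {i} {l} {m} i<l j≤l l<m ri rl rm
      with m≤n⇒m<n∨m≡n j≤l
    ... | inj₁ j<l  = walk-sparse steps j w 1≤x (sym (suffix-head suffix)) (suffix-tail suffix) refl
      (λ { (s≤s i≤j) _ → i≤j }) i<l j<l l<m ri rl rm
    -- In terms of left ends: i ≤ R < j + 1 - d ≤ j + 1 - x ≤ m - B m, where j + 1 - x is the left
    -- end at j + 1.
    ... | inj₂ refl = +-cancelˡ-≤ j _ _ (begin
        j + suc (i + B m)        ≡⟨ solve 3 (λ j i b → j :+ (con 1 :+ (i :+ b))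
            := i :+ (con 1 :+ j :+ b)) refl j i (B m) ⟩
        i + (suc j + B m)        ≤⟨ +-mono-≤ (below i<l ri) (left-mono steps l<m (proj₁ rm)) ⟩
        R + (m + B (suc j))      ≡⟨ cong (λ b → R + (m + b)) (suffix-head suffix) ⟨
        R + (m + x)              ≤⟨ +-monoʳ-≤ R (+-monoʳ-≤ m x≤d) ⟩
        R + (m + d)              ≡⟨ solve 3 (λ r m d → r :+ (m :+ d) := (d :+ r) :+ m) refl R m d ⟩
        d + R + m                ≡⟨ cong (_+ m) dR ⟩
        j + m                    ∎)
      where
      open ≤-Reasoning
      open +-*-Solver

    module _ (steps : Steps) (uncut : Uncut) (sparse : Sparse) where

      -- If the height does not increase, a clique ends at j, and the bound `x ≤ d` of a turn says
      -- that the left end at j + 1 lies beyond `R`. Without an earlier row `R` is 0, and the bound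
      -- follows from `B j ≤ j`.
      toWalk : ∀ {d s} (v : Vec ℕ s) {j} R → Suffix v j → d + R ≡ j → R
          ≡ 0 ⊎ (R < j × Row R) → ∃[ k ] Walk (B j) d v k
      toWalk [] R suffix dR prev = 1 , stop
      toWalk {d} {suc s} (x ∷ v) {j} R suffix dR prev with B (suc j) ≤? B j
      ... | no ¬fall rewrite trans (suffix-head suffix) (≤-antisym (proj₂ steps j (suffix-next suffix)) (≰⇒> ¬fall))
        with toWalk {suc d} v R (suffix-tail suffix) (cong suc dR) (prev′ prev)
        where
        prev′ : R ≡ 0 ⊎ (R < j × Row R) → R ≡ 0 ⊎ (R < suc j × Row R)
        prev′ (inj₁ eq)        = inj₁ eq
        prev′ (inj₂ (lt , row)) = inj₂ (m≤n⇒m≤1+n lt , row)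
      ... | k , w = k , rise (subst (λ p → Walk p (suc d) v k) (≤-antisym (proj₂ steps j (suffix-next suffix))
          (≰⇒> ¬fall)) w)
      toWalk {d} {suc s} (x ∷ v) {j} R suffix dR prev | yes fall rewrite suffix-head suffix
        with toWalk {1} v j (suffix-tail suffix) refl (inj₂ (≤-refl , (<⇒≤ (suffix-next suffix) , λ _ → fall)))
      ... | k , w = suc k , turn (uncut j (suffix-next suffix)) (+-cancelˡ-≤ R _ _ (≤-trans (bound prev)
          (≤-reflexive (trans (sym dR) (+-comm d R))))) w
        where
        rowⱼ : Row j
        rowⱼ = <⇒≤ (suffix-next suffix) , λ _ → fall

        bound : R ≡ 0 ⊎ (R < j × Row R) → R + B (suc j) ≤ j
        bound (inj₁ refl) = ≤-trans fall (B≤ steps (proj₁ rowⱼ))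
        -- Sparseness concerns completed cliques, whereas j + 1 need not be a row; it is applied to
        -- the row m that ends the run of rises from j + 1 and shares its left end.
        bound (inj₂ (R<j , rowR)) with nextRow steps s (suc j) (trans (+-comm s (suc (suc j))) (proj₁
            (suffix-tail suffix)))
        ... | m , j<m , rowₘ , shifted = ≤-pred (+-cancelˡ-≤ m _ _ (begin
            m + suc (R + B (suc j))
                ≡⟨ solve 3 (λ m r b → m :+ (con 1 :+ (r :+ b)) := (con 1 :+ r) :+ (m :+ b)) refl m R (B (suc j)) ⟩
            suc R + (m + B (suc j))    ≡⟨ cong (suc R +_) shifted ⟨
            suc R + (suc j + B m)
                ≡⟨ solve 3 (λ r j b → (con 1 :+ r) :+ (j :+ b) := (con 1 :+ (r :+ b)) :+ j) refl R (suc j) (B m) ⟩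
            suc (R + B m) + suc j      ≤⟨ +-monoˡ-≤ (suc j) (sparse R<j j<m rowR rowⱼ rowₘ) ⟩
            m + suc j                  ∎))
          where
          open ≤-Reasoning
          open +-*-Solver

    -- The right ends of the peak-cliques in increasing order. This list mediates between the weight
    -- of the walk and the number of peak-edges.
    rows : ∀ {p d s} {v : Vec ℕ s} {k} → Walk p d v k → ℕ → List ℕ
    rows stop         j = j ∷ []
    rows (rise w)     j = rows w (suc j)
    rows (turn _ _ w) j = j ∷ rows w (suc j)

    length-rows : ∀ {p d s} {v : Vec ℕ s} {k} (w : Walk p d v k) j → length (rows w j) ≡ k
    length-rows stop         j = refl
    length-rows (rise w)     j = length-rows w (suc j)
    length-rows (turn _ _ w) j = cong suc (length-rows w (suc j))

    rows-from : ∀ {p d s} {v : Vec ℕ s} {k} (w : Walk p d v k) j → All (j ≤_) (rows w j)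
    rows-from stop         j = ≤-refl ∷ []
    rows-from (rise w)     j = All.map <⇒≤ (rows-from w (suc j))
    rows-from (turn _ _ w) j = ≤-refl ∷ All.map <⇒≤ (rows-from w (suc j))

    rows-unique : ∀ {p d s} {v : Vec ℕ s} {k} (w : Walk p d v k) j → AllPairs _≢_ (rows w j)
    rows-unique stop         j = [] ∷ []
    rows-unique (rise w)     j = rows-unique w (suc j)
    rows-unique (turn _ _ w) j = All.map <⇒≢ (rows-from w (suc j)) ∷ rows-unique w (suc j)

    rows-sound : ∀ {p d s} {v : Vec ℕ s} {k} (w : Walk p d v k) {j} → d ≤ p → B j
        ≡ p → Suffix v j → All Row (rows w j)
    rows-sound stop {j} _ _ (len , _) = last-row (trans (sym (+-identityʳ (suc j))) len) ∷ []
    rows-sound (rise w) d≤p refl suffix = rows-sound w (s≤s d≤p) (sym (suffix-head suffix)) (suffix-tail suffix)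
    rows-sound (turn 1≤x x≤d w) {j} d≤p refl suffix =
        (<⇒≤ (suffix-next suffix) , λ _ → subst (_≤ B j) (suffix-head suffix) (≤-trans x≤d d≤p))
      ∷ rows-sound w 1≤x (sym (suffix-head suffix)) (suffix-tail suffix)

    rows-complete : ∀ {p d s} {v : Vec ℕ s} {k} (w : Walk p d v k) {j} → B j ≡ p → Suffix v j →
                    ∀ {i} → j ≤ i → Row i → i ∈ rows w j
    rows-complete stop {j} _ (len , _) j≤i (i<n , _) =
      here (≤-antisym (≤-pred (≤-trans i<n (≤-reflexive (trans (sym len) (+-identityʳ (suc j)))))) j≤i)
    rows-complete (rise w) refl suffix j≤i row with m≤n⇒m<n∨m≡n j≤i
    ... | inj₁ j<i  = rows-complete w (sym (suffix-head suffix)) (suffix-tail suffix) j<i row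
    ... | inj₂ refl = ⊥-elim (¬Row-rise (suffix-next suffix) (sym (suffix-head suffix)) row)
    rows-complete (turn _ _ w) refl suffix j≤i row with m≤n⇒m<n∨m≡n j≤i
    ... | inj₁ j<i  = there (rows-complete w (sym (suffix-head suffix)) (suffix-tail suffix) j<i row)
    ... | inj₂ refl = here refl

-- Peak-edges as rows, and peak-nesting as sparseness.

module PeakCliques where

  open import Data.Empty using (⊥; ⊥-elim)
  open import Data.Fin.Base as Fin using (Fin; toℕ; fromℕ<)
  open import Data.Fin.Properties as Fin using (toℕ<n; toℕ-fromℕ<; toℕ-injective)
  open import Data.List.Base using ([]; _∷_; length; filter; cartesianProduct; allFin; map)
  open import Data.List.Extrema.Nat using (xs≤max; max≤v⁺)
  open import Data.List.Membership.Propositional using (_∈_)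
  open import Data.List.Membership.Propositional.Properties using (∈-filter⁺; ∈-filter⁻; ∈-cartesianProduct⁺; ∈-allFin; ∈-map⁺; ∈-map⁻)
  open import Data.List.Membership.Propositional.Properties.WithK using (unique∧set⇒bag)
  open import Data.List.Properties using (length-map)
  open import Data.List.Relation.Binary.BagAndSetEquality using (∼bag⇒↭)
  open import Data.List.Relation.Binary.Permutation.Propositional.Properties using (↭-length)
  open import Data.List.Relation.Unary.All as All using (All; []; _∷_)
  import Data.List.Relation.Unary.All.Properties as All
  open import Data.List.Relation.Unary.AllPairs using ([]; _∷_)
  open import Data.List.Relation.Unary.Any using (here; there)
  open import Data.List.Relation.Unary.Unique.Propositional using (Unique)
  import Data.List.Relation.Unary.Unique.Propositional.Properties as Unique
  open import Data.Nat.Base using (ℕ; zero; suc; _+_; _∸_; _≤_; _<_; z≤n; s≤s)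
  open import Data.Nat.Properties
  open import Data.Product.Base using (∃-syntax; _×_; _,_; proj₁; proj₂)
  open import Data.Sum.Base using (_⊎_; inj₁; inj₂)
  open import Data.Vec.Base using (Vec; []; _∷_; lookup)
  open import Defs
  open import Function.Bundles using (mk⇔)
  open import Relation.Binary.Definitions using (tri<; tri≈; tri>)
  open import Relation.Binary.PropositionalEquality
  open import Relation.Nullary using (¬_)
  open Walks

  at-lookup : ∀ {s} (v : Vec ℕ s) i → at v (toℕ i) ≡ lookup v i
  at-lookup (x ∷ v) Fin.zero    = refl
  at-lookup (x ∷ v) (Fin.suc i) = at-lookup v i

  three-members : ∀ {A : Set} {x y z : A} {xs} → x ∈ xs → y ∈ xs → z ∈ xs → x ≢ y → x ≢ z → y ≢ z → 3 ≤ length xs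
  three-members {xs = _ ∷ _ ∷ _ ∷ _} _ _ _ _ _ _ = s≤s (s≤s (s≤s z≤n))
  three-members {xs = _ ∷ []} (here refl) (here refl) _ x≢y _ _ = ⊥-elim (x≢y refl)
  three-members {xs = _ ∷ _ ∷ []} (here refl) (here refl) _ x≢y _ _ = ⊥-elim (x≢y refl)
  three-members {xs = _ ∷ _ ∷ []} (here refl) (there (here refl)) (here refl) _ x≢z _ = ⊥-elim (x≢z refl)
  three-members {xs = _ ∷ _ ∷ []} (here refl) (there (here refl)) (there (here refl)) _ _ y≢z = ⊥-elim (y≢z refl)
  three-members {xs = _ ∷ _ ∷ []} (there (here refl)) (there (here refl)) _ x≢y _ _ = ⊥-elim (x≢y refl)
  three-members {xs = _ ∷ _ ∷ []} (there (here refl)) (here refl) (there (here refl)) _ x≢z _ = ⊥-elim (x≢z refl)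
  three-members {xs = _ ∷ _ ∷ []} (there (here refl)) (here refl) (here refl) _ _ y≢z = ⊥-elim (y≢z refl)

  sort₃ : ∀ {P : ℕ → Set} {x y z} → P x → P y → P z → x ≢ y → x ≢ z → y ≢ z →
          ∃[ i ] ∃[ j ] ∃[ k ] i < j × j < k × P i × P j × P k
  sort₃ {x = x} {y} {z} px py pz x≢y x≢z y≢z with <-cmp x y | <-cmp x z | <-cmp y z
  ... | tri≈ _ x≡y _ | _ | _ = ⊥-elim (x≢y x≡y)
  ... | _ | tri≈ _ x≡z _ | _ = ⊥-elim (x≢z x≡z)
  ... | _ | _ | tri≈ _ y≡z _ = ⊥-elim (y≢z y≡z)
  ... | tri< x<y _ _ | _ | tri< y<z _ _ = x , y , z , x<y , y<z , px , py , pz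
  ... | _ | tri< x<z _ _ | tri> _ _ z<y = x , z , y , x<z , z<y , px , pz , py
  ... | tri> _ _ y<x | tri< x<z _ _ | _ = y , x , z , y<x , x<z , py , px , pz
  ... | _ | tri> _ _ z<x | tri< y<z _ _ = y , z , x , y<z , z<x , py , pz , px
  ... | tri< x<y _ _ | tri> _ _ z<x | _ = z , x , y , z<x , x<y , pz , px , py
  ... | tri> _ _ y<x | _ | tri> _ _ z<y = z , y , x , z<y , y<x , pz , py , px

  module _ {s} (a : Vec ℕ (suc s)) where

    n : ℕ
    n = suc s

    B : ℕ → ℕ
    B = at a

    open Rows B n

    lookup-B : ∀ i → lookup a i ≡ B (toℕ i)
    lookup-B i = sym (at-lookup a i)

    lookup-fromℕ< : ∀ {i} (i<n : i < n) → lookup a (fromℕ< i<n) ≡ B i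
    lookup-fromℕ< i<n = trans (lookup-B (fromℕ< i<n)) (cong B (toℕ-fromℕ< i<n))

    area⇒steps : IsAreaSequence a → Steps
    area⇒steps (low , step) = n≤0⇒n≡0 (≤-pred (subst (_< 1) (lookup-B Fin.zero) (low Fin.zero))) , λ i i+1<n →
      subst₂ (λ x y → x ≤ suc y) (lookup-fromℕ< i+1<n) (lookup-fromℕ< (<⇒≤ i+1<n))
        (step (fromℕ< i+1<n) (fromℕ< (<⇒≤ i+1<n))
          (cong suc (trans (toℕ-fromℕ< i+1<n) (cong suc (sym (toℕ-fromℕ< (<⇒≤ i+1<n)))))))

    steps⇒area : Steps → IsAreaSequence a
    steps⇒area steps = (λ i → s≤s (subst (_≤ toℕ i) (sym (lookup-B i)) (B≤ steps (toℕ<n i)))) , λ i j eq →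
      subst₂ (λ x y → x ≤ suc y) (sym (trans (lookup-B i) (cong B (suc-injective eq)))) (sym (lookup-B j))
        (proj₂ steps (toℕ j) (subst (_< n) (suc-injective eq) (toℕ<n i)))

    noCut⇒uncut : NoCut a → Uncut
    noCut⇒uncut noCut i i+1<n = n≢0⇒n>0 λ eq → noCut (fromℕ< i+1<n)
      (subst (λ k → 1 < suc k) (sym (toℕ-fromℕ< i+1<n)) (s≤s (s≤s z≤n))) (trans (lookup-fromℕ< i+1<n) eq)

    uncut⇒noCut : Uncut → NoCut a
    uncut⇒noCut uncut Fin.zero    (s≤s ())
    uncut⇒noCut uncut (Fin.suc i) _ eq = <-irrefl refl
      (subst (1 ≤_) (trans (sym (lookup-B (Fin.suc i))) eq) (uncut (toℕ i) (toℕ<n (Fin.suc i))))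

    adj⇒ : ∀ {u w} → Adj< a u w → toℕ u < toℕ w × toℕ w ≤ toℕ u + B (toℕ w)
    adj⇒ {u} {w} (s≤s u<w , l) = u<w , ≤-pred (subst (λ b → suc (toℕ w) ≤ suc (toℕ u) + b) (lookup-B w)
      (subst (suc (toℕ w) ≤_) (+-comm (lookup a w) (suc (toℕ u))) (≤-trans (m≤n+m∸n (suc (toℕ w)) (lookup a w))
          (+-monoʳ-≤ (lookup a w) l))))

    adj⇐ : ∀ {u w} → toℕ u < toℕ w → toℕ w ≤ toℕ u + B (toℕ w) → Adj< a u w
    adj⇐ {u} {w} u<w l = s≤s u<w , m≤n+o⇒m∸n≤o (suc (toℕ w)) (lookup a w)
      (subst (suc (toℕ w) ≤_) (+-comm (suc (toℕ u)) (lookup a w)) (subst (λ b → suc (toℕ w) ≤ suc (toℕ u) + b) (sym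
          (lookup-B w)) (s≤s l)))

    module _ (steps : Steps) (uncut : Uncut) where

      -- Maximality to the left pins u to the left end of w, and maximality to the right makes w a
      -- row. In an uncut sequence neighbouring positions are adjacent, so an isolated vertex is
      -- position 0 of a sequence of size 1.
      peakEdge⇒ : ∀ {u w} → PeakEdge a (u , w) → Row (toℕ w) × toℕ u + B (toℕ w) ≡ toℕ w
      peakEdge⇒ {u} (inj₁ (refl , isolated)) = isolated-row u isolated
        where
        isolated-row : ∀ u → Isolated a u → Row (toℕ u) × toℕ u + B (toℕ u) ≡ toℕ u
        isolated-row Fin.zero isolated = (s≤s z≤n , λ 1<n → ⊥-elim (isolated (fromℕ< 1<n) (inj₁ (adj⇐
            (subst (0 <_) (sym (toℕ-fromℕ< 1<n)) (s≤s z≤n))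
            (subst (λ k → k ≤ B k) (sym (toℕ-fromℕ< 1<n)) (uncut 0 1<n))))))
          , proj₁ steps
        isolated-row (Fin.suc i) isolated = ⊥-elim (isolated (Fin.inject₁ i) (inj₂ (adj⇐
          (s≤s (≤-reflexive (Fin.toℕ-inject₁ i)))
          (subst (λ k → suc (toℕ i) ≤ k + B (suc (toℕ i))) (sym (Fin.toℕ-inject₁ i))
            (subst (_≤ toℕ i + B (suc (toℕ i))) (+-comm (toℕ i) 1) (+-monoʳ-≤ (toℕ i) (uncut (toℕ i) (toℕ<n
                (Fin.suc i)))))))))
      peakEdge⇒ {u} {w} (inj₂ (edge , maximalʳ , maximalˡ)) = (toℕ<n w , fall) , left
        where
        u<w = proj₁ (adj⇒ edge)

        left-end : ∀ u → (∀ k → suc (label k) ≡ label u → ¬ Adj a k w) → toℕ u < toℕ w → toℕ u + B (toℕ w) ≤ toℕ w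
        left-end Fin.zero    _       _   = B≤ steps (toℕ<n w)
        left-end (Fin.suc i) maximal u<w = ≰⇒> λ l → maximal (Fin.inject₁ i) (cong (λ k → suc (suc k))
            (Fin.toℕ-inject₁ i))
          (inj₁ (adj⇐ (subst (_< toℕ w) (sym (Fin.toℕ-inject₁ i)) (<⇒≤ u<w))
            (subst (λ k → toℕ w ≤ k + B (toℕ w)) (sym (Fin.toℕ-inject₁ i)) l)))

        left : toℕ u + B (toℕ w) ≡ toℕ w
        left = ≤-antisym (left-end u maximalˡ u<w) (proj₂ (adj⇒ edge))

        fall : suc (toℕ w) < n → B (suc (toℕ w)) ≤ B (toℕ w)
        -- If the height rose after w, the left end would stay at u, and u would be joined to w + 1.
        fall l = ≮⇒≥ λ gt → maximalʳ (fromℕ< l) (cong suc (toℕ-fromℕ< l)) (inj₁ (adj⇐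
          (subst (toℕ u <_) (sym (toℕ-fromℕ< l)) (m≤n⇒m≤1+n u<w))
          (subst (λ k → k ≤ toℕ u + B k) (sym (toℕ-fromℕ< l))
            (subst (λ k → suc k ≤ toℕ u + B (suc (toℕ w))) left
              (subst (_≤ toℕ u + B (suc (toℕ w))) (+-suc (toℕ u) (B (toℕ w))) (+-monoʳ-≤ (toℕ u) gt))))))

      -- If u = w, the height at w is 0. Uncutness then forces w to be position 0, and since w is a
      -- row a second position would have height 0 as well; hence n = 1 and the vertex is isolated.
      peakEdge⇐ : ∀ {u w} → Row (toℕ w) → toℕ u + B (toℕ w) ≡ toℕ w → PeakEdge a (u , w)
      peakEdge⇐ {u} {w} (w<n , fall) left = decide (m≤n⇒m<n∨m≡n (subst (toℕ u ≤_) left (m≤m+n (toℕ u) (B (toℕ w)))))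
        where
        decide : toℕ u < toℕ w ⊎ toℕ u ≡ toℕ w → PeakEdge a (u , w)
        decide (inj₁ u<w) = inj₂ (adj⇐ u<w (≤-reflexive (sym left)) , maximalʳ , maximalˡ)
          where
          maximalʳ : ∀ k → label k ≡ suc (label w) → ¬ Adj a u k
          maximalʳ k eq (inj₂ e) = <-asym (proj₁ (adj⇒ e)) (subst (toℕ u <_) (sym (suc-injective eq)) (m≤n⇒m≤1+n u<w))
          maximalʳ k eq (inj₁ e) = <-irrefl refl (begin-strict
            toℕ w                          <⟨ ≤-reflexive (sym (suc-injective eq)) ⟩
            toℕ k                          ≤⟨ proj₂ (adj⇒ e) ⟩
            toℕ u + B (toℕ k)              ≡⟨ cong (λ k → toℕ u + B k) (suc-injective eq) ⟩
            toℕ u + B (suc (toℕ w))        ≤⟨ +-monoʳ-≤ (toℕ u) (fall (subst (_< n) (suc-injective eq) (toℕ<n k))) ⟩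
            toℕ u + B (toℕ w)              ≡⟨ left ⟩
            toℕ w                          ∎)
            where open ≤-Reasoning
          maximalˡ : ∀ k → suc (label k) ≡ label u → ¬ Adj a k w
          maximalˡ k eq (inj₂ e) = <-asym (proj₁ (adj⇒ e)) (<-trans (≤-reflexive (suc-injective eq)) u<w)
          maximalˡ k eq (inj₁ e) = <-irrefl refl (begin-strict
            toℕ w                          ≤⟨ proj₂ (adj⇒ e) ⟩
            toℕ k + B (toℕ w)              <⟨ ≤-reflexive (cong (_+ B (toℕ w)) (suc-injective eq)) ⟩
            toℕ u + B (toℕ w)              ≡⟨ left ⟩
            toℕ w                          ∎)
            where open ≤-Reasoning
        decide (inj₂ u≡w) = inj₁ (toℕ-injective u≡w , λ j adj → single (zero-height w Bw≡0 fall) u j adj)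
          where
          Bw≡0 : B (toℕ w) ≡ 0
          Bw≡0 = +-cancelˡ-≡ (toℕ w) _ _ (trans (trans (cong (_+ B (toℕ w)) (sym u≡w)) left) (sym (+-identityʳ
              (toℕ w))))

          zero-height : ∀ w → B (toℕ w) ≡ 0 → (suc (toℕ w) < n → B (suc (toℕ w)) ≤ B (toℕ w)) → ¬ 1 < n
          zero-height Fin.zero    eq fall 1<n = <-irrefl refl (≤-trans (uncut 0 1<n) (subst (B 1 ≤_) eq (fall 1<n)))
          zero-height (Fin.suc w) eq fall _   = <-irrefl refl (subst (1 ≤_) eq (uncut (toℕ w) (toℕ<n (Fin.suc w))))

          single : ¬ 1 < n → ∀ u j → ¬ Adj a u j
          single 1≮n u j (inj₂ e) = 1≮n (<-≤-trans (s≤s (≤-trans (s≤s z≤n) (proj₁ (adj⇒ e)))) (toℕ<n u))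
          single 1≮n u j (inj₁ e) = 1≮n (<-≤-trans (s≤s (≤-trans (s≤s z≤n) (proj₁ (adj⇒ e)))) (toℕ<n j))

      peakEdge-injective : ∀ {e f} → PeakEdge a e → PeakEdge a f → toℕ (proj₂ e) ≡ toℕ (proj₂ f) → e ≡ f
      peakEdge-injective {u , w} {u′ , w′} pe pf eq with toℕ-injective {i = w} {w′} eq
      ... | refl = cong (_, w) (toℕ-injective (+-cancelʳ-≡ (B (toℕ w)) _ _ (trans (proj₂ (peakEdge⇒ pe)) (sym (proj₂
          (peakEdge⇒ pf))))))

      edge-at : ∀ {i} → Row i → ∃[ u ] ∃[ w ] PeakEdge a (u , w) × toℕ w ≡ i × toℕ u + B i ≡ i
      edge-at {i} row@(i<n , _) = fromℕ< u<n , fromℕ< i<n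
        , peakEdge⇐ (subst Row (sym w≡) row) (subst (λ k → toℕ (fromℕ< u<n) + B k ≡ k) (sym w≡) left) , w≡ , left
        where
        u<n : i ∸ B i < n
        u<n = ≤-<-trans (m∸n≤m i (B i)) i<n
        w≡ : toℕ (fromℕ< i<n) ≡ i
        w≡ = toℕ-fromℕ< i<n
        left : toℕ (fromℕ< u<n) + B i ≡ i
        left = trans (cong (_+ B i) (toℕ-fromℕ< u<n)) (m∸n+n≡m (B≤ steps i<n))

      peakEdges-unique : Unique (peakEdges a)
      peakEdges-unique = Unique.filter⁺ (peakEdge? a) (Unique.cartesianProduct⁺ (Unique.allFin⁺ n) (Unique.allFin⁺ n))

      ∈-peakEdges : ∀ {e} → PeakEdge a e → e ∈ peakEdges a
      ∈-peakEdges {u , w} pe = ∈-filter⁺ (peakEdge? a) (∈-cartesianProduct⁺ (∈-allFin u) (∈-allFin w)) pe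

      peakEdges-∈ : ∀ {e} → e ∈ peakEdges a → PeakEdge a e
      peakEdges-∈ e∈ = proj₂ (∈-filter⁻ (peakEdge? a) {xs = cartesianProduct (allFin n) (allFin n)} e∈)

      -- Both lists are mapped to pairs of numbers, left end and right end. The images are free of
      -- duplicates and have the same members, so they are permutations of each other and have equal
      -- length.
      peak≡length : ∀ is → Unique is → (∀ {i} → i ∈ is → Row i) → (∀ {i} → Row i → i ∈ is) → peak a ≡ length is
      peak≡length is unique sound complete = trans (sym (length-map position (peakEdges a))) (trans (↭-length (∼bag⇒↭
        (unique∧set⇒bag
          (Unique.map⁺ position-injective peakEdges-unique)
          (Unique.map⁺ {f = edge} (cong proj₂) unique)
          (mk⇔ to from)))) (length-map edge is))
        where
        position : Fin n × Fin n → ℕ × ℕ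
        position (u , w) = toℕ u , toℕ w

        edge : ℕ → ℕ × ℕ
        edge i = i ∸ B i , i

        position-injective : ∀ {e f} → position e ≡ position f → e ≡ f
        position-injective eq = cong₂ _,_ (toℕ-injective (cong proj₁ eq)) (toℕ-injective (cong proj₂ eq))

        to : ∀ {q} → q ∈ map position (peakEdges a) → q ∈ map edge is
        to q∈ with ∈-map⁻ position q∈
        ... | (u , w) , e∈ , refl with peakEdge⇒ (peakEdges-∈ e∈)
        ... | row , left = subst (_∈ map edge is) (cong (_, toℕ w) (trans (cong (_∸ B (toℕ w)) (sym left)) (m+n∸n≡m
            (toℕ u) (B (toℕ w)))))
          (∈-map⁺ edge (complete row))

        from : ∀ {q} → q ∈ map edge is → q ∈ map position (peakEdges a)
        from q∈ with ∈-map⁻ edge q∈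
        ... | i , i∈ , refl with edge-at (sound i∈)
        ... | u , w , pe , w≡i , left = subst (_∈ map position (peakEdges a))
          (cong₂ _,_ (trans (sym (m+n∸n≡m (toℕ u) (B i))) (cong (_∸ B i) left)) w≡i) (∈-map⁺ position
              (∈-peakEdges pe))

      -- If the clique ending at k reached back to i, the vertex i would lie in all three cliques:
      -- it is the right end of the first, and the middle one starts no later than the last.
      pnest⇒sparse : pnest a ≤ 2 → Sparse
      pnest⇒sparse nest {i} {j} {k} i<j j<k rowᵢ rowⱼ rowₖ = ≰⇒> λ k≤i+Bk → <⇒≱ (three k≤i+Bk) (begin
          peakNesting a v
              ≤⟨ All.lookup (All.map⁻ (xs≤max 0 (map (peakNesting a) (allFin n)))) (∈-allFin v) ⟩
          pnest a                              ≤⟨ nest ⟩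
          2                                    ∎)
        where
        open ≤-Reasoning
        v : Fin n
        v = fromℕ< (proj₁ rowᵢ)

        through : ∀ {l} → i ≤ l → l ≤ i + B l → Row l →
                  ∃[ e ] e ∈ filter (inPeakClique? a v) (peakEdges a) × toℕ (proj₂ e) ≡ l
        through {l} i≤l l≤i+Bl row with edge-at row
        ... | u , w , pe , w≡l , left = (u , w) , ∈-filter⁺ (inPeakClique? a v) (∈-peakEdges pe)
          ( s≤s (subst (toℕ u ≤_) (sym (toℕ-fromℕ< (proj₁ rowᵢ))) (+-cancelʳ-≤ (B l) _ _ (≤-trans
              (≤-reflexive left) l≤i+Bl)))
          , s≤s (subst₂ _≤_ (sym (toℕ-fromℕ< (proj₁ rowᵢ))) (sym w≡l) i≤l) )
          , w≡l

        distinct : ∀ {e f : Fin n × Fin n} {x y} → toℕ (proj₂ e) ≡ x → toℕ (proj₂ f) ≡ y → x < y → e ≢ f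
        distinct refl refl x<y refl = <-irrefl refl x<y

        three : k ≤ i + B k → 2 < peakNesting a v
        three k≤i+Bk with through ≤-refl (m≤m+n i (B i)) rowᵢ | through (<⇒≤ i<j) j≤i+Bj rowⱼ | through (<⇒≤
            (<-trans i<j j<k)) k≤i+Bk rowₖ
          where
          j≤i+Bj : j ≤ i + B j
          -- By monotonicity of left ends, j - B j ≤ k - B k ≤ i.
          j≤i+Bj = +-cancelˡ-≤ k _ _ (begin
            k + j              ≡⟨ +-comm k j ⟩
            j + k              ≤⟨ +-monoʳ-≤ j k≤i+Bk ⟩
            j + (i + B k)      ≡⟨ x∙yz≈y∙xz j i (B k) ⟩
            i + (j + B k)      ≤⟨ +-monoʳ-≤ i (left-mono steps (<⇒≤ j<k) (proj₁ rowₖ)) ⟩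
            i + (k + B j)      ≡⟨ x∙yz≈y∙xz i k (B j) ⟩
            k + (i + B j)      ∎)
            where open import Algebra.Properties.CommutativeSemigroup +-commutativeSemigroup using (x∙yz≈y∙xz)
        ... | e , e∈ , e≡ | f , f∈ , f≡ | g , g∈ , g≡ =
          three-members e∈ f∈ g∈ (distinct e≡ f≡ i<j) (distinct e≡ g≡ (<-trans i<j j<k)) (distinct f≡ g≡ j<k)

      -- Peak-cliques are determined by their right ends, so three of them through v can be sorted
      -- as i < j < k. The last begins no later than v ≤ i, against sparseness.
      sparse⇒pnest : Sparse → pnest a ≤ 2
      sparse⇒pnest sparse = max≤v⁺ {xs = map (peakNesting a) (allFin n)} z≤n (All.map⁺ (All.tabulate λ
          {v} _ → bound v))
        where
        Through : Fin n → ℕ → Set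
        Through v i = Row i × toℕ v ≤ i × i ≤ toℕ v + B i

        member : ∀ {v e} → e ∈ filter (inPeakClique? a v) (peakEdges a) → PeakEdge a e × Through v (toℕ (proj₂ e))
        member {v} {u , w} e∈ with ∈-filter⁻ (inPeakClique? a v) {xs = peakEdges a} e∈
        ... | e∈′ , (s≤s u≤v , s≤s v≤w) with peakEdge⇒ (peakEdges-∈ e∈′)
        ... | row , left = peakEdges-∈ e∈′ , row , v≤w , ≤-trans (≤-reflexive (sym left)) (+-monoˡ-≤ (B (toℕ w)) u≤v)

        contra : ∀ {v i j k} → i < j → j < k → Through v i → Through v j → Through v k → ⊥
        contra {k = k} i<j j<k (rowᵢ , v≤i , _) (rowⱼ , _) (rowₖ , _ , k≤v+Bk) =
          <⇒≱ (sparse i<j j<k rowᵢ rowⱼ rowₖ) (≤-trans k≤v+Bk (+-monoˡ-≤ (B k) v≤i))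

        few : ∀ v es → Unique es → (∀ {e} → e ∈ es → PeakEdge a e × Through v (toℕ (proj₂ e))) → length es ≤ 2
        few v []          _ _ = z≤n
        few v (_ ∷ [])    _ _ = s≤s z≤n
        few v (_ ∷ _ ∷ []) _ _ = s≤s (s≤s z≤n)
        few v (e ∷ f ∷ g ∷ _) ((e≢f ∷ e≢g ∷ _) ∷ (f≢g ∷ _) ∷ _) mem
          with mem (here refl) | mem (there (here refl)) | mem (there (there (here refl)))
        ... | pe , te | pf , tf | pg , tg with sort₃ {Through v} te tf tg
            (λ eq → e≢f (peakEdge-injective pe pf eq)) (λ eq → e≢g (peakEdge-injective pe pg eq)) (λ eq → f≢g
                (peakEdge-injective pf pg eq))
        ... | i , j , k , i<j , j<k , ti , tj , tk = ⊥-elim (contra i<j j<k ti tj tk)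

        bound : ∀ v → peakNesting a v ≤ 2
        bound v = few v (filter (inPeakClique? a v) (peakEdges a)) (Unique.filter⁺
            (inPeakClique? a v) peakEdges-unique) member

-- Counting walks by coefficients and the three-term recurrence.

module Enumeration where

  open import Data.Bool.Base using (Bool; true; false; if_then_else_; T)
  open import Data.Empty using (⊥; ⊥-elim)
  open import Data.Integer.Base as ℤ using (ℤ; +_)
  import Data.Integer.Properties as ℤ
  import Data.Integer.Solver
  open import Data.List.Base using (List; []; _∷_; filter; map; applyUpTo; upTo; cartesianProductWith; _++_)
  open import Data.List.Properties using (map-++; map-∘; map-applyUpTo)
  import Data.List.Relation.Unary.All as All
  open import Data.Nat.Base using (ℕ; zero; suc; _+_; _*_; _∸_; _≤_; _<_; z≤n; s≤s; _≡ᵇ_; _<ᵇ_)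
  open import Data.Nat.ListAction using (sum)
  open import Data.Nat.ListAction.Properties using (sum-++)
  open import Data.Nat.Properties
  open import Data.Nat.Solver using (module +-*-Solver)
  open import Data.Product.Base using (∃-syntax; _×_; _,_; proj₁; proj₂)
  open import Data.Sum.Base using (inj₁)
  open import Data.Vec.Base using (Vec; []; _∷_)
  open import Defs
  open import Function.Base using (id)
  open import Relation.Binary.PropositionalEquality
  open import Relation.Nullary using (yes; no; ¬_; Dec)
  open PolynomialRings
  open SturmSequence
  open Walks
  open PeakCliques

  inN₂ᶜ⇒walk : ∀ {s x} (v : Vec ℕ s) → InN₂ᶜ (x ∷ v) → x ≡ 0 × ∃[ k ] Walk 0 0 v k × peak (x ∷ v) ≡ k
  inN₂ᶜ⇒walk {s} {x} v (area , nest , connected) = x≡0 , go (toWalk steps uncut (pnest⇒sparse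
      (x ∷ v) steps uncut nest) v 0 suffix refl (inj₁ refl))
    where
    open Rows (at (x ∷ v)) (suc s)
    steps : Steps
    steps = area⇒steps (x ∷ v) area
    uncut : Uncut
    uncut = noCut⇒uncut (x ∷ v) (connected⇒noCut (x ∷ v) area connected)
    x≡0 : x ≡ 0
    x≡0 = proj₁ steps
    suffix : Suffix v 0
    suffix = refl , λ _ → refl
    go : ∃[ k ] Walk x 0 v k → ∃[ k ] Walk 0 0 v k × peak (x ∷ v) ≡ k
    go (k , w) = k , subst (λ p → Walk p 0 v k) x≡0 w
      , trans (peak≡length (x ∷ v) steps uncut (rows w 0) (rows-unique w 0)
          (All.lookup (rows-sound w z≤n refl suffix)) (rows-complete w refl suffix z≤n))
        (length-rows w 0)

  walk⇒inN₂ᶜ : ∀ {s x} (v : Vec ℕ s) {k} → x ≡ 0 → Walk 0 0 v k → InN₂ᶜ (x ∷ v)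
  walk⇒inN₂ᶜ {s} {x} v x≡0 w = steps⇒area (x ∷ v) steps , sparse⇒pnest (x ∷ v) steps uncut sparse , noCut⇒connected
      (x ∷ v) (uncut⇒noCut (x ∷ v) uncut)
    where
    open Rows (at (x ∷ v)) (suc s)
    suffix : Suffix v 0
    suffix = refl , λ _ → refl
    steps : Steps
    steps = x≡0 , λ i l → proj₂ (walk-steps w z≤n x≡0 suffix i z≤n l)
    uncut : Uncut
    uncut i l = proj₁ (walk-steps w z≤n x≡0 suffix i z≤n l)
    sparse : Sparse
    sparse i<j = walk-sparse steps 0 w z≤n x≡0 suffix refl (λ ()) i<j z≤n

  -- Generating functions are handled as coefficient functions with values in ℕ: `δ k` represents
  -- the monomial with exponent k, and `shift` is multiplication by t.
  δ : ℕ → ℕ → ℕ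
  δ k c = if k ≡ᵇ c then 1 else 0

  shift : (ℕ → ℕ) → ℕ → ℕ
  shift f zero    = 0
  shift f (suc c) = f c

  -- 1 ≤ x ≤ d
  between : ℕ → ℕ → Bool
  between zero    d = false
  between (suc x) d = x <ᵇ d

  -- The coefficient of tᶜ in tᵏ if v is a walk with k peaks, and 0 if it is not a walk.
  weight : ℕ → ℕ → ∀ {s} → Vec ℕ s → ℕ → ℕ
  weight p d []      c = δ 1 c
  weight p d (x ∷ v) c =
    (if x ≡ᵇ suc p then weight (suc p) (suc d) v c else 0) +
    (if between x d then shift (weight x 1 v) c else 0)

  ¬T⇒false : ∀ {b} → ¬ T b → b ≡ false
  ¬T⇒false {false} _ = refl
  ¬T⇒false {true}  f = ⊥-elim (f _)

  T⇒true : ∀ {b} → T b → b ≡ true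
  T⇒true {true} _ = refl

  between-sound : ∀ x d → T (between x d) → 1 ≤ x × x ≤ d
  between-sound (suc x) d t = s≤s z≤n , <ᵇ⇒< x d t

  between-complete : ∀ {x d} → 1 ≤ x → x ≤ d → T (between x d)
  between-complete {suc x} _ l = <⇒<ᵇ l

  -- A rise has entry p + 1 > d, so under `d ≤ p` at most one of the two summands of `weight`
  -- survives, and a walk contributes a single monomial.
  weight-walk : ∀ {p d s} {v : Vec ℕ s} {k} → d ≤ p → Walk p d v k → ∀ c → weight p d v c ≡ δ k c
  weight-walk d≤p stop c = refl
  weight-walk {p} {d} d≤p (rise {v = v} w) c
    rewrite T⇒true (≡⇒≡ᵇ p p refl) | ¬T⇒false {p <ᵇ d} (λ t → <⇒≱ (<ᵇ⇒< p d t) d≤p) =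
    trans (+-identityʳ (weight (suc p) (suc d) v c)) (weight-walk (s≤s d≤p) w c)
  weight-walk {p} {d} d≤p (turn {x = x} 1≤x x≤d w) c
    rewrite ¬T⇒false {x ≡ᵇ suc p} (λ t → <⇒≱ (s≤s (≤-trans x≤d d≤p)) (≤-reflexive (sym (≡ᵇ⇒≡ x (suc p) t))))
          | T⇒true (between-complete 1≤x x≤d) with c
  ... | zero   = refl
  ... | suc c′ = weight-walk 1≤x w c′

  weight-¬walk : ∀ p d {s} (v : Vec ℕ s) → (∀ k → ¬ Walk p d v k) → ∀ c → weight p d v c ≡ 0
  weight-¬walk p d []      none c = ⊥-elim (none 1 stop)
  weight-¬walk p d (x ∷ v) none c = cong₂ _+_ first (second c)
    where
    first : (if x ≡ᵇ suc p then weight (suc p) (suc d) v c else 0) ≡ 0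
    first with x ≡ᵇ suc p in eq
    ... | false = refl
    ... | true  = weight-¬walk (suc p) (suc d) v (λ k w → none k
      (subst (λ x → Walk p d (x ∷ v) k) (sym (≡ᵇ⇒≡ x (suc p) (subst T (sym eq) _))) (rise w))) c

    second : ∀ c → (if between x d then shift (weight x 1 v) c else 0) ≡ 0
    second c with between x d in eq
    second c       | false = refl
    second zero    | true  = refl
    second (suc c) | true  = weight-¬walk x 1 v (λ k w → none (suc k) (turn (proj₁ bounds) (proj₂ bounds) w)) c
      where bounds = between-sound x d (subst T (sym eq) _)

  module _ {A : Set} where

    sum-map-0 : ∀ (xs : List A) → sum (map (λ _ → 0) xs) ≡ 0
    sum-map-0 []       = refl
    sum-map-0 (x ∷ xs) = sum-map-0 xs

    sum-map-+ : ∀ (f g : A → ℕ) xs → sum (map (λ x → f x + g x) xs) ≡ sum (map f xs) + sum (map g xs)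
    sum-map-+ f g []       = refl
    sum-map-+ f g (x ∷ xs) rewrite sum-map-+ f g xs =
      solve 4 (λ a b c d → a :+ b :+ (c :+ d)
          := a :+ c :+ (b :+ d)) refl (f x) (g x) (sum (map f xs)) (sum (map g xs))
      where open +-*-Solver

    sum-map-if : ∀ b (f : A → ℕ) xs → sum (map (λ x → if b then f x else 0) xs) ≡ (if b then sum (map f xs) else 0)
    sum-map-if true  f xs = refl
    sum-map-if false f xs = sum-map-0 xs

    sum-map-filter : ∀ {P : A → Set} (P? : ∀ x → Dec (P x)) {f g : A → ℕ} → (∀ {x} → P x → f x
        ≡ g x) → (∀ {x} → ¬ P x → g x ≡ 0) →
                     ∀ xs → sum (map f (filter P? xs)) ≡ sum (map g xs)
    sum-map-filter P? yes-eq no-eq []       = refl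
    sum-map-filter P? {f} {g} yes-eq no-eq (x ∷ xs) with P? x
    ... | yes p = cong₂ _+_ (yes-eq p) (sum-map-filter P? yes-eq no-eq xs)
    ... | no ¬p = trans (sum-map-filter P? yes-eq no-eq xs) (cong (_+ sum (map g xs)) (sym (no-eq ¬p)))

  sum-map-product : ∀ {A B C : Set} (h : A → B → C) (f : C → ℕ) xs ys →
                    sum (map f (cartesianProductWith h xs ys)) ≡ sum (map (λ x → sum (map (λ y → f (h x y)) ys)) xs)
  sum-map-product h f []       ys = refl
  sum-map-product h f (x ∷ xs) ys = begin
    sum (map f (map (h x) ys ++ cartesianProductWith h xs ys))
      ≡⟨ cong sum (map-++ f (map (h x) ys) _) ⟩
    sum (map f (map (h x) ys) ++ map f (cartesianProductWith h xs ys))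
      ≡⟨ sum-++ (map f (map (h x) ys)) _ ⟩
    sum (map f (map (h x) ys)) + sum (map f (cartesianProductWith h xs ys))
      ≡⟨ cong₂ _+_ (cong sum (sym (map-∘ ys))) (sum-map-product h f xs ys) ⟩
    sum (map (λ y → f (h x y)) ys) + sum (map (λ x → sum (map (λ y → f (h x y)) ys)) xs) ∎
    where open ≡-Reasoning

  sum-applyUpTo-cong : ∀ {f g : ℕ → ℕ} m → (∀ x → x < m → f x ≡ g x) → sum (applyUpTo f m) ≡ sum (applyUpTo g m)
  sum-applyUpTo-cong zero    eq = refl
  sum-applyUpTo-cong (suc m) eq = cong₂ _+_ (eq 0 (s≤s z≤n)) (sum-applyUpTo-cong m (λ x l → eq (suc x) (s≤s l)))

  sum-applyUpTo-0 : ∀ m → sum (applyUpTo (λ _ → 0) m) ≡ 0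
  sum-applyUpTo-0 zero    = refl
  sum-applyUpTo-0 (suc m) = sum-applyUpTo-0 m

  sum-applyUpTo-+ : ∀ (f g : ℕ → ℕ) m → sum (applyUpTo (λ x → f x + g x) m)
      ≡ sum (applyUpTo f m) + sum (applyUpTo g m)
  sum-applyUpTo-+ f g m = begin
    sum (applyUpTo (λ x → f x + g x) m)              ≡⟨ cong sum (map-applyUpTo id (λ x → f x + g x) m) ⟨
    sum (map (λ x → f x + g x) (upTo m))             ≡⟨ sum-map-+ f g (upTo m) ⟩
    sum (map f (upTo m)) + sum (map g (upTo m))
        ≡⟨ cong₂ _+_ (cong sum (map-applyUpTo id f m)) (cong sum (map-applyUpTo id g m)) ⟩
    sum (applyUpTo f m) + sum (applyUpTo g m)        ∎
    where open ≡-Reasoning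

  sum-point : ∀ a c m → a < m → sum (applyUpTo (λ x → if x ≡ᵇ a then c else 0) m) ≡ c
  sum-point zero    c (suc m) _       = trans (cong (_+_ c) (sum-applyUpTo-0 m)) (+-identityʳ c)
  sum-point (suc a) c (suc m) (s≤s l) = sum-point a c m l

  sum-between : ∀ d c m → d < m → sum (applyUpTo (λ x → if between x d then c else 0) m) ≡ d * c
  sum-between d c (suc m) (s≤s d≤m) = below d m d≤m
    where
    below : ∀ d m → d ≤ m → sum (applyUpTo (λ x → if x <ᵇ d then c else 0) m) ≡ d * c
    below zero    m       _       = sum-applyUpTo-0 m
    below (suc d) (suc m) (s≤s l) = cong (_+_ c) (below d m l)

  -- The coefficient of tᶜ in F(s, d).
  total : ℕ → ℕ → ℕ → ℕ
  total zero    d c = δ 1 c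
  total (suc s) d c = total s (suc d) c + d * shift (total s 1) c

  sum-shift : ∀ {A : Set} (f : A → ℕ → ℕ) c xs → sum (map (λ x → shift (f x) c) xs)
      ≡ shift (λ c → sum (map (λ x → f x c) xs)) c
  sum-shift f zero    xs = sum-map-0 xs
  sum-shift f (suc c) xs = refl

  shift-cong : ∀ {f g} → (∀ c → f c ≡ g c) → ∀ c → shift f c ≡ shift g c
  shift-cong eq zero    = refl
  shift-cong eq (suc c) = eq c

  -- The height p disappears: the rise selects the single entry p + 1, and after a turn the
  -- remaining total is F(s, 1) for each of the d entries, which yields the factor d. The bound
  -- `p + s < m` keeps every reachable entry within the range of `vectors m s`.
  sum-weight : ∀ m s p d → d ≤ p → p + s < m → ∀ c → sum (map (λ v → weight p d v c) (vectors m s)) ≡ total s d c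
  sum-weight m zero    p d d≤p p+s<m c = +-identityʳ (δ 1 c)
  sum-weight m (suc s) p d d≤p p+s<m c = begin
    sum (map (λ v → weight p d v c) (vectors m (suc s)))
      ≡⟨ sum-map-product _∷_ (λ v → weight p d v c) (upTo m) (vectors m s) ⟩
    sum (map (λ x → sum (map (λ v → weight p d (x ∷ v) c) (vectors m s))) (upTo m))
      ≡⟨ cong sum (map-applyUpTo id _ m) ⟩
    sum (applyUpTo (λ x → sum (map (λ v → weight p d (x ∷ v) c) (vectors m s))) m)
      ≡⟨ sum-applyUpTo-cong m (λ x _ → entry x) ⟩
    sum (applyUpTo (λ x → (if x ≡ᵇ suc p then total s (suc d) c else 0) + (if between x d then shift
        (total s 1) c else 0)) m)
      ≡⟨ sum-applyUpTo-+ (λ x → if x ≡ᵇ suc p then total s (suc d) c else 0) (λ x → if between x d then shift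
          (total s 1) c else 0) m ⟩
    sum (applyUpTo (λ x → if x ≡ᵇ suc p then total s (suc d) c else 0) m) + sum (applyUpTo
        (λ x → if between x d then shift (total s 1) c else 0) m)
      ≡⟨ cong₂ _+_ (sum-point (suc p) (total s (suc d) c) m (≤-<-trans (m≤m+n (suc p) s) p+1+s<m)) (sum-between d
          (shift (total s 1) c) m (≤-<-trans d≤p (≤-<-trans (m≤m+n p (suc s)) p+s<m))) ⟩
    total (suc s) d c ∎
    where
    open ≡-Reasoning
    p+1+s<m : suc p + s < m
    p+1+s<m = subst (_< m) (+-suc p s) p+s<m

    rising : ∀ x → sum (map (λ v → if x ≡ᵇ suc p then weight (suc p) (suc d) v c else 0) (vectors m s))
        ≡ (if x ≡ᵇ suc p then total s (suc d) c else 0)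
    rising x = trans (sum-map-if (x ≡ᵇ suc p) (λ v → weight (suc p) (suc d) v c) (vectors m s))
      (cong (λ y → if x ≡ᵇ suc p then y else 0) (sum-weight m s (suc p) (suc d) (s≤s d≤p) p+1+s<m c))

    turning : ∀ x → sum (map (λ v → if between x d then shift (weight x 1 v) c else 0) (vectors m s))
        ≡ (if between x d then shift (total s 1) c else 0)
    turning x = trans (sum-map-if (between x d) (λ v → shift (weight x 1 v) c) (vectors m s)) (turned
        (between x d) refl)
      where
      turned : ∀ b → between x d ≡ b → (if b then sum (map (λ v → shift (weight x 1 v) c) (vectors m s)) else 0)
          ≡ (if b then shift (total s 1) c else 0)
      turned false _  = refl
      turned true  eq = trans (sum-shift (weight x 1) c (vectors m s)) (shift-cong (sum-weight m s x 1 (proj₁ bounds)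
        (≤-<-trans (+-mono-≤ (≤-trans (proj₂ bounds) d≤p) (n≤1+n s)) p+s<m)) c)
        where bounds = between-sound x d (subst T (sym eq) _)

    entry : ∀ x → sum (map (λ v → weight p d (x ∷ v) c) (vectors m s)) ≡
                  (if x ≡ᵇ suc p then total s (suc d) c else 0) + (if between x d then shift (total s 1) c else 0)
    entry x = trans (sum-map-+ (λ v → if x ≡ᵇ suc p then weight (suc p) (suc d) v c else 0)
        (λ v → if between x d then shift (weight x 1 v) c else 0) (vectors m s))
      (cong₂ _+_ (rising x) (turning x))

  coeff-X^ : ∀ k c → ℤ[t].coeff (ℤ[t].X^ k) c ≡ + δ k c
  coeff-X^ zero    zero    = refl
  coeff-X^ zero    (suc c) = refl
  coeff-X^ (suc k) zero    = ℤ-Coefficients.coeff-linear*-zero (+ 0) (+ 1) (ℤ[t].X^ k)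
  coeff-X^ (suc k) (suc c) = trans (ℤ-Coefficients.coeff-linear*-suc (+ 0) (+ 1) (ℤ[t].X^ k) c)
    (trans (ℤ.+-identityˡ _) (trans (ℤ.*-identityˡ _) (coeff-X^ k c)))

  coeff-∑ₚ : ∀ {A : Set} (f : A → ℤ[t].Poly) (g : A → ℕ) c → (∀ x → ℤ[t].coeff (f x) c ≡ + g x) →
             ∀ xs → ℤ[t].coeff (ℤ[t].∑ₚ (map f xs)) c ≡ + sum (map g xs)
  coeff-∑ₚ f g c eq []       = refl
  coeff-∑ₚ f g c eq (x ∷ xs) = trans (ℤ-Coefficients.coeff-+ (f x) (ℤ[t].∑ₚ (map f xs)) c)
    (cong₂ ℤ._+_ (eq x) (coeff-∑ₚ f g c eq xs))

  -- Supplies the forced first entry 0. Being 0 outside the admissible sequences, it lets the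
  -- filtered sum become a sum over all vectors, which splits entry by entry.
  whole : ∀ {s} → ℕ → Vec ℕ (suc s) → ℕ
  whole c (x ∷ v) = if x ≡ᵇ 0 then weight 0 0 v c else 0

  whole-in : ∀ {s} c (a : Vec ℕ (suc s)) → InN₂ᶜ a → δ (peak a) c ≡ whole c a
  whole-in c (x ∷ v) good = go x (proj₁ (inN₂ᶜ⇒walk v good)) (proj₂ (inN₂ᶜ⇒walk v good))
    where
    go : ∀ x {l} → x ≡ 0 → ∃[ k ] Walk 0 0 v k × l ≡ k → δ l c ≡ whole c (x ∷ v)
    go _ refl (k , w , refl) = sym (weight-walk z≤n w c)

  whole-out : ∀ {s} c (a : Vec ℕ (suc s)) → ¬ InN₂ᶜ a → whole c a ≡ 0
  whole-out c (x ∷ v) bad = go x (λ x≡0 w → bad (walk⇒inN₂ᶜ {x = x} v x≡0 w))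
    where
    go : ∀ x → (x ≡ 0 → ∀ {k} → Walk 0 0 v k → ⊥) → whole c (x ∷ v) ≡ 0
    go zero    none = weight-¬walk 0 0 v (λ k → none refl) c
    go (suc x) none = refl

  coeff-∑-peaks : ∀ {s} c (as : List (Vec ℕ (suc s))) →
                  ℤ[t].coeff (ℤ[t].∑ₚ (map (λ a → ℤ[t].X^ (peak a)) (filter inN₂ᶜ? as))) c ≡ + sum (map (whole c) as)
  coeff-∑-peaks c as = trans
    (coeff-∑ₚ (λ a → ℤ[t].X^ (peak a)) (λ a → δ (peak a) c) c (λ a → coeff-X^ (peak a) c) (filter inN₂ᶜ? as))
    (cong +_ (sum-map-filter inN₂ᶜ? {λ a → δ (peak a) c} {whole c} (λ {a} → whole-in c a) (λ {a} → whole-out c a) as))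

  sum-whole : ∀ s c → sum (map (whole c) (vectors (suc s) (suc s))) ≡ total s 0 c
  sum-whole s c = begin
    sum (map (whole c) (vectors (suc s) (suc s)))
      ≡⟨ sum-map-product _∷_ (whole c) (upTo (suc s)) (vectors (suc s) s) ⟩
    sum (map (λ x → sum (map (λ v → whole c (x ∷ v)) (vectors (suc s) s))) (upTo (suc s)))
      ≡⟨ cong sum (map-applyUpTo id _ (suc s)) ⟩
    sum (applyUpTo (λ x → sum (map (λ v → whole c (x ∷ v)) (vectors (suc s) s))) (suc s))
      ≡⟨ sum-applyUpTo-cong (suc s) (λ x _ → trans (sum-map-if (x ≡ᵇ 0) (λ v → weight 0 0 v c) (vectors (suc s) s))
           (cong (λ y → if x ≡ᵇ 0 then y else 0) (sum-weight (suc s) s 0 0 z≤n ≤-refl c))) ⟩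
    sum (applyUpTo (λ x → if x ≡ᵇ 0 then total s 0 c else 0) (suc s))
      ≡⟨ sum-point 0 (total s 0 c) (suc s) (s≤s z≤n) ⟩
    total s 0 c ∎
    where open ≡-Reasoning

  coeff-Peakᶜ : ∀ s c → ℤ[t].coeff (Peakᶜ (suc s)) c ≡ + total s 0 c
  coeff-Peakᶜ s c = trans (coeff-∑-peaks c (vectors (suc s) (suc s))) (cong +_ (sum-whole s c))

  -- The coefficient of d in F(s, d).
  slope : ℕ → ℕ → ℕ
  slope zero    c = 0
  slope (suc s) c = slope s c + shift (total s 1) c

  total-linear : ∀ s d c → total s d c ≡ total s 0 c + d * slope s c
  total-linear zero    d c = sym (trans (cong (_+_ (δ 1 c)) (*-zeroʳ d)) (+-identityʳ (δ 1 c)))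
  total-linear (suc s) d c = begin
    total s (suc d) c + d * σ                                ≡⟨ cong (_+ d * σ) (total-linear s (suc d) c) ⟩
    total s 0 c + suc d * slope s c + d * σ
        ≡⟨ solve 4 (λ t b d h → t :+ (con 1 :+ d) :* b :+ d :* h
        := t :+ con 1 :* b :+ con 0 :+ d :* (b :+ h)) refl (total s 0 c) (slope s c) d σ ⟩
    -- The summand 0 is the unfolded `0 * shift (total s 1) c` in `total (suc s) 0 c`.
    total s 0 c + 1 * slope s c + 0 + d * (slope s c + σ)
        ≡⟨ cong (λ t → t + 0 + d * (slope s c + σ)) (total-linear s 1 c) ⟨
    total s 1 c + 0 + d * (slope s c + σ)                    ∎
    where
    open ≡-Reasoning
    open +-*-Solver
    σ : ℕ
    σ = shift (total s 1) c

  -- Write u = F(s + 1, 0), which equals F(s, 1). Then F(s + 2, 0) = u + slope(s + 1) and slope(s +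
  -- 1) = slope(s) + t u, where slope(s) = u - F(s, 0). Moving F(s, 0) to the left keeps the
  -- identity in ℕ.
  total-recurrence : ∀ s c → total (2 + s) 0 c + total s 0 c ≡ 2 * total (1 + s) 0 c + shift (total (1 + s) 0) c
  total-recurrence s c = begin
    total (1 + s) 1 c + 0 + total s 0 c
        ≡⟨ cong (λ t → t + 0 + total s 0 c) (total-linear (1 + s) 1 c) ⟩
    u + 1 * (slope s c + shift (total s 1) c) + 0 + total s 0 c
        ≡⟨ solve 4 (λ u b h t → u :+ con 1 :* (b :+ h) :+ con 0 :+ t
        := u :+ (t :+ con 1 :* b :+ con 0) :+ h) refl u (slope s c) (shift (total s 1) c) (total s 0 c) ⟩
    u + (total s 0 c + 1 * slope s c + 0) + shift (total s 1) c
        ≡⟨ cong₂ (λ t h → u + (t + 0) + h) (sym (total-linear s 1 c)) (shift-cong (λ c → sym (+-identityʳ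
        (total s 1 c))) c) ⟩
    u + u + shift (total (1 + s) 0) c
        ≡⟨ solve 2 (λ u h → u :+ u :+ h := con 2 :* u :+ h) refl u (shift (total (1 + s) 0) c) ⟩
    2 * u + shift (total (1 + s) 0) c                       ∎
    where
    open ≡-Reasoning
    open +-*-Solver
    u : ℕ
    u = total (1 + s) 0 c

  infix 8 _⊛_
  _⊛_ : ℤ[t].Poly → ℤ[t].Poly → ℤ[t].Poly
  p ⊛ q = (ℤ[t].X ℤ[t].+ₚ ℤ[t].const (+ 2)) ℤ[t].*ₚ p ℤ[t].-ₚ q

  Peakᶜ-1 : Peakᶜ 1 ℤ[t].≈ₚ ℤ[t].X
  Peakᶜ-1 c = trans (coeff-Peakᶜ 0 c) (X-coeff c)
    where
    X-coeff : ∀ c → + δ 1 c ≡ ℤ[t].coeff ℤ[t].X c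
    X-coeff zero          = refl
    X-coeff (suc zero)    = refl
    X-coeff (suc (suc c)) = refl

  Peakᶜ-2 : Peakᶜ 2 ℤ[t].≈ₚ ℤ[t].X
  Peakᶜ-2 c = trans (coeff-Peakᶜ 1 c) (trans (cong +_ (+-identityʳ (δ 1 c))) (trans (sym (coeff-Peakᶜ 0 c))
      (Peakᶜ-1 c)))

  difference : ∀ x y u h → x + y ≡ 2 * u + h → + x ≡ + 2 ℤ.* + u ℤ.+ + 1 ℤ.* + h ℤ.- + y
  difference x y u h eq = begin
    + x                                          ≡⟨ solve 2 (λ x y → x := x :+ y :- y) refl (+ x) (+ y) ⟩
    + (x + y) ℤ.- + y                            ≡⟨ cong (λ z → + z ℤ.- + y) eq ⟩
    + (2 * u) ℤ.+ + h ℤ.- + y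
        ≡⟨ cong₂ (λ v w → v ℤ.+ w ℤ.- + y) (ℤ.pos-* 2 u) (sym (ℤ.*-identityˡ (+ h))) ⟩
    + 2 ℤ.* + u ℤ.+ + 1 ℤ.* + h ℤ.- + y          ∎
    where
    open ≡-Reasoning
    open Data.Integer.Solver.+-*-Solver

  -- The vanishing summand gives the constant coefficient the same shape as the others, so that
  -- `difference` applies to both cases, here with h = 0.
  coeff-⊛-zero : ∀ p q {x y} → ℤ[t].coeff p 0 ≡ x → ℤ[t].coeff q 0 ≡ y →
                 ℤ[t].coeff (p ⊛ q) 0 ≡ + 2 ℤ.* x ℤ.+ + 1 ℤ.* + 0 ℤ.- y
  coeff-⊛-zero p q refl refl = trans (coeff-step-zero p q)
    (cong (ℤ._- ℤ[t].coeff q 0) (sym (ℤ.+-identityʳ (+ 2 ℤ.* ℤ[t].coeff p 0))))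

  coeff-⊛-suc : ∀ p q k {x y z} → ℤ[t].coeff p (suc k) ≡ x → ℤ[t].coeff p k ≡ y → ℤ[t].coeff q (suc k) ≡ z →
                ℤ[t].coeff (p ⊛ q) (suc k) ≡ + 2 ℤ.* x ℤ.+ + 1 ℤ.* y ℤ.- z
  coeff-⊛-suc p q k refl refl refl = coeff-step-suc p q k

  Peakᶜ-recurrence : ∀ s → Peakᶜ (3 + s) ℤ[t].≈ₚ Peakᶜ (2 + s) ⊛ Peakᶜ (1 + s)
  Peakᶜ-recurrence s zero = trans (coeff-Peakᶜ (2 + s) 0)
    (trans (difference (total (2 + s) 0 0) (total s 0 0) (total (1 + s) 0 0) 0 (total-recurrence s 0))
      (sym (coeff-⊛-zero (Peakᶜ (2 + s)) (Peakᶜ (1 + s)) (coeff-Peakᶜ (1 + s) 0) (coeff-Peakᶜ s 0))))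
  Peakᶜ-recurrence s (suc c) = trans (coeff-Peakᶜ (2 + s) (suc c))
    (trans (difference (total (2 + s) 0 (suc c)) (total s 0 (suc c)) (total (1 + s) 0 (suc c)) (total (1 + s) 0 c)
        (total-recurrence s (suc c)))
      (sym (coeff-⊛-suc (Peakᶜ (2 + s)) (Peakᶜ (1 + s)) c (coeff-Peakᶜ (1 + s) (suc c)) (coeff-Peakᶜ (1 + s) c)
          (coeff-Peakᶜ s (suc c)))))

  ⊛-cong : ∀ p p′ q q′ → p ℤ[t].≈ₚ p′ → q ℤ[t].≈ₚ q′ → p ⊛ q ℤ[t].≈ₚ p′ ⊛ q′
  ⊛-cong p p′ q q′ p≈ q≈ zero    = trans (coeff-⊛-zero p q (p≈ 0) (q≈ 0)) (sym (coeff-⊛-zero p′ q′ refl refl))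
  ⊛-cong p p′ q q′ p≈ q≈ (suc k) = trans (coeff-⊛-suc p q k (p≈ (suc k)) (p≈ k) (q≈ (suc k))) (sym
      (coeff-⊛-suc p′ q′ k refl refl refl))

  ⊛-shift : ∀ p q → (+ 0 ∷ p) ⊛ (+ 0 ∷ q) ℤ[t].≈ₚ + 0 ∷ p ⊛ q
  ⊛-shift p q zero          = coeff-⊛-zero (+ 0 ∷ p) (+ 0 ∷ q) refl refl
  ⊛-shift p q (suc zero)    = trans (coeff-⊛-suc (+ 0 ∷ p) (+ 0 ∷ q) 0 refl refl refl) (sym (coeff-⊛-zero p q
      refl refl))
  ⊛-shift p q (suc (suc k)) = trans (coeff-⊛-suc (+ 0 ∷ p) (+ 0 ∷ q) (suc k) refl refl refl) (sym (coeff-⊛-suc p q k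
      refl refl refl))

  Peakᶜ≈t*Q : ∀ n → Peakᶜ (suc n) ℤ[t].≈ₚ + 0 ∷ Q (n ∸ 1)
  Peakᶜ≈t*Q zero          = Peakᶜ-1
  Peakᶜ≈t*Q (suc zero)    = Peakᶜ-2
  -- The repeated initial value t is consistent with the definition of Q: `Q 0 ⊛ Q 0` computes to
  -- `Q 1`, that is, (t + 2) - 1 = t + 1.
  Peakᶜ≈t*Q (suc (suc zero)) c = trans (Peakᶜ-recurrence 0 c)
    (trans (⊛-cong (Peakᶜ 2) ℤ[t].X (Peakᶜ 1) ℤ[t].X Peakᶜ-2 Peakᶜ-1 c) (⊛-shift (Q 0) (Q 0) c))
  Peakᶜ≈t*Q (suc (suc (suc m))) c = trans (Peakᶜ-recurrence (suc m) c)
    (trans (⊛-cong (Peakᶜ (3 + m)) (+ 0 ∷ Q (suc m)) (Peakᶜ (2 + m)) (+ 0 ∷ Q m) (Peakᶜ≈t*Q (suc (suc m)))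
        (Peakᶜ≈t*Q (suc m)) c)
      (⊛-shift (Q (suc m)) (Q m) c))

open import Defs
open import Data.Integer.Base using (+_)
open import Data.Nat.Base using (ℕ; _≤_; _∸_; s≤s)
open import Data.Product.Base using (_×_; _,_)
open import Relation.Binary.PropositionalEquality using (refl)
open RealRootedness using (P-realRooted; P-generalizedSturm)
open Enumeration using (Peakᶜ-1; Peakᶜ-2; Peakᶜ-recurrence; Peakᶜ≈t*Q)

corollary5p9 : (Peakᶜ 1 ℤ[t].≈ₚ ℤ[t].X) ×
    (Peakᶜ 2 ℤ[t].≈ₚ ℤ[t].X) ×
    (∀ (n : ℕ) → 3 ≤ n →
    Peakᶜ n ℤ[t].≈ₚ
    (ℤ[t].X ℤ[t].+ₚ ℤ[t].const (+ 2)) ℤ[t].*ₚ Peakᶜ (n ∸ 1) ℤ[t].-ₚ Peakᶜ (n ∸ 2)) ×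
    (∀ (n : ℕ) → RealRooted (toℝ[t] (Peakᶜ n))) ×
    IsGeneralizedSturm (λ n → toℝ[t] (Peakᶜ n))
corollary5p9 = Peakᶜ-1 , Peakᶜ-2 , (λ { _ (s≤s (s≤s (s≤s {n = s} _))) → Peakᶜ-recurrence s })
  , P-realRooted Peakᶜ refl Peakᶜ≈t*Q , P-generalizedSturm Peakᶜ refl Peakᶜ≈t*Q
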